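{- For every $\varepsilon>0$ there is a polynomial-time $(4+\varepsilon)$-approximation algorithm for budget-restrained makespan minimization (given a budget $b$, minimize the makespan among valid schedules with cost at most $b$) in the generalized Server Cloud Scheduling model on extended chain task graphs, with $z$ identical server machines, $k$ cloud contexts, communication delays depending on the direction and on the machine contexts, and an arbitrary cost function $\mathrm{cost}:\mathcal{J}\times\{c_1,\dots,c_k\}\to\mathbb{N}_0$.
   Context: Generalized Server Cloud Scheduling: the input is a directed acyclic task graph $G=(\mathcal{J},E)$ with one source $s$ and one sink $t$ (which must be processed on server machines: $p_s(s)=p_s(t)=0$, and their cloud processing times are $\infty$). There are $z$ identical server machines $s_1,\dots,s_z$ and $k$ cloud contexts $c_1,\dots,c_k$, each consisting of unboundedly many machines. Job $j$ has processing time $p_s(j)\in\mathbb{N}_0$ on any server machine and $p_{c_i}(j)\in\mathbb{N}_0$ on a machine of cloud context $c_i$. For each edge $(i,j)$ and machine types $m_1,m_2\in\{s,c_1,\dots,c_k\}$ there is a delay $c_{m_1,m_2}(i,j)\in\mathbb{N}_0$ (not necessarily symmetric), with $c_{m,m}(i,j)=0$. A schedule is a pair $(C,\eta)$ with completion times $C:\mathcal{J}\to\mathbb{N}_0$ and assignment $\eta:\mathcal{J}\to\{s_1,\dots,s_z\}\cup\{c_1,\dots,c_k\}$; write $p_{\eta(j)}(j)$ for the processing time of $j$ at its assigned location and use type $s$ for any server machine in delays. It is valid if (a) no two distinct jobs assigned to the same server machine overlap in time: $C(i)\le C(j)-p_s(j)$ or $C(i)-p_s(i)\ge C(j)$; (b)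 for every edge $(i,j)$: $C(i)+c_{\eta(i),\eta(j)}(i,j)\le C(j)-p_{\eta(j)}(j)$. The makespan is $C(t)$ and the cost is $\sum_{j:\eta(j)\in\{c_1,\dots,c_k\}}\mathrm{cost}(j,\eta(j))$. Extended chain: start from a chain $s=0\to1\to\dots\to n\to n+1=t$; for any subset of the chain edges $(j-1,j)$, remove the edge, add a set $\mathcal{J}_j$ of new jobs, and for each $j'\in\mathcal{J}_j$ add edges $(j-1,j')$ and $(j',j)$. -}

module Defs where

open import Data.Bool using (Bool; T; if_then_else_)
open import Data.Fin using (Fin; zero; suc; inject₁; fromℕ; toℕ)
open import Data.Integer using (+_)
open import Data.List using (List; []; _∷_; foldr; sum; tabulate)
open import Data.Maybe using (Maybe; just; nothing; maybe′)
open import Data.Nat using (ℕ; _+_; _*_; _^_; _≤_; _≡ᵇ_)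
open import Data.Nat.Binary using (ℕᵇ; 2[1+_]; 1+[2_]) renaming (zero to 0ᵇ; fromℕ to toBinary)
open import Data.Product using (Σ-syntax; ∃-syntax; _×_; _,_)
open import Data.Rational using (ℚ) renaming (_/_ to _/ℚ_; _*_ to _*ℚ_; _≤_ to _≤ℚ_)
open import Data.Sum using (_⊎_)
open import Function.Bundles using (_⇔_; _↔_; Inverse)
open import Relation.Binary.Construct.Closure.Transitive using (TransClosure)
open import Relation.Binary.PropositionalEquality using (_≡_; _≢_)
open import Relation.Nullary using (¬_)

-- The machine model is N. D. Jones's imperative language WHILE over binary
-- trees ("Computability and Complexity from a Programming Perspective", 1997),
-- with his unit-cost time measure.  Values are shared, never copied, which is
-- why every tree operation costs one step; polynomial time for WHILE coincides
-- with polynomial time for Turing machines.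

infixr 5 _∙_

data Tree : Set where
  nil : Tree
  _∙_ : Tree → Tree → Tree

size : Tree → ℕ
size nil     = 1
size (a ∙ b) = 1 + size a + size b

head tail : Tree → Tree
head nil     = nil
head (a ∙ b) = a
tail nil     = nil
tail (a ∙ b) = b

Variable : Set
Variable = ℕ

data Expr : Set where
  var   : Variable → Expr
  nil   : Expr
  cons  : Expr → Expr → Expr
  hd tl : Expr → Expr

infix  6 _:=_
infixr 5 _⨾_

data Command : Set where
  skip          : Command
  _:=_          : Variable → Expr → Command
  _⨾_           : Command → Command → Command
  IF_THEN_ELSE_ : Expr → Command → Command → Command
  WHILE_DO_     : Expr → Command → Command

Store : Set
Store = Variable → Tree

_[_↦_] : Store → Variable → Tree → Store
(σ [ x ↦ v ]) y = if y ≡ᵇ x then v else σ y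

eval : Expr → Store → Tree
eval (var x)    σ = σ x
eval nil        σ = nil
eval (cons e f) σ = eval e σ ∙ eval f σ
eval (hd e)     σ = head (eval e σ)
eval (tl e)     σ = tail (eval e σ)

evalTime : Expr → ℕ
evalTime (var x)    = 1
evalTime nil        = 1
evalTime (cons e f) = 1 + evalTime e + evalTime f
evalTime (hd e)     = 1 + evalTime e
evalTime (tl e)     = 1 + evalTime e

-- Exec C σ τ t: started in σ, the command C halts in τ after t steps.
-- As a condition, nil is false and every other tree is true.
data Exec : Command → Store → Store → ℕ → Set where
  skip : ∀ {σ} → Exec skip σ σ 1
  assign : ∀ {x e σ} →
    Exec (x := e) σ (σ [ x ↦ eval e σ ]) (1 + evalTime e)
  seq : ∀ {C D σ τ υ t u} →
    Exec C σ τ t → Exec D τ υ u → Exec (C ⨾ D) σ υ (1 + t + u)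
  if-true : ∀ {e C D σ τ t} → eval e σ ≢ nil →
    Exec C σ τ t → Exec (IF e THEN C ELSE D) σ τ (1 + evalTime e + t)
  if-false : ∀ {e C D σ τ t} → eval e σ ≡ nil →
    Exec D σ τ t → Exec (IF e THEN C ELSE D) σ τ (1 + evalTime e + t)
  while-true : ∀ {e C σ τ υ t u} → eval e σ ≢ nil →
    Exec C σ τ t → Exec (WHILE e DO C) τ υ u →
    Exec (WHILE e DO C) σ υ (1 + evalTime e + t + u)
  while-false : ∀ {e C σ} → eval e σ ≡ nil →
    Exec (WHILE e DO C) σ σ (1 + evalTime e)

-- Variable 0 holds the input at the start and the output at the end.
initial : Tree → Store
initial d = (λ _ → nil) [ 0 ↦ d ]

Computes_On_To_InTime_ : Command → Tree → Tree → ℕ → Set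
Computes C On d To r InTime t = ∃[ τ ] (Exec C (initial d) τ t × τ 0 ≡ r)

encodeList : List Tree → Tree
encodeList = foldr _∙_ nil

encodeTable : ∀ {n} → (Fin n → Tree) → Tree
encodeTable f = encodeList (tabulate f)

encodeℕᵇ : ℕᵇ → Tree
encodeℕᵇ 0ᵇ        = nil
encodeℕᵇ 2[1+ x ]  = nil ∙ encodeℕᵇ x
encodeℕᵇ 1+[2 x ]  = (nil ∙ nil) ∙ encodeℕᵇ x

-- Numbers are written in binary, so that the input length is logarithmic in
-- the processing times, delays, costs, the budget and the number of servers.
encodeℕ : ℕ → Tree
encodeℕ n = encodeℕᵇ (toBinary n)

encodeFin : ∀ {n} → Fin n → Tree
encodeFin i = encodeℕ (toℕ i)

record MinimizationProblem : Set₁ where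
  field
    Input          : Set
    Solution       : Input → Set
    Feasible       : (I : Input) → Solution I → Set
    value          : (I : Input) → Solution I → ℕ
    encodeInput    : Input → Tree
    encodeSolution : (I : Input) → Solution I → Tree

fromNat : ℕ → ℚ
fromNat n = + n /ℚ 1

-- S is feasible with value at most ρ times the optimum.
IsApproximate : (ρ : ℚ) (Π : MinimizationProblem) →
  let open MinimizationProblem Π in (I : Input) → Solution I → Set
IsApproximate ρ Π I S =
  Feasible I S ×
  (∀ S′ → Feasible I S′ → fromNat (value I S) ≤ℚ ρ *ℚ fromNat (value I S′))
  where open MinimizationProblem Π

-- The size of the output is charged as well: with sharing, t steps can build a
-- tree of size exponential in t, and a Turing machine has to write it out.
HasPolynomialTimeApproximation : ℚ → MinimizationProblem → Set
HasPolynomialTimeApproximation ρ Π =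
  Σ[ P ∈ Command ] Σ[ a ∈ ℕ ] Σ[ d ∈ ℕ ] ((I : Input) →
    Σ[ S ∈ Solution I ] Σ[ t ∈ ℕ ]
      (Computes P On encodeInput I To encodeSolution I S InTime t ×
       t + size (encodeSolution I S) ≤ a * size (encodeInput I) ^ d + a ×
       IsApproximate ρ Π I S))
  where open MinimizationProblem Π

data Context (k : ℕ) : Set where
  server : Context k
  cloud  : Fin k → Context k

data Location (z k : ℕ) : Set where
  onServer : Fin z → Location z k
  onCloud  : Fin k → Location z k

context : ∀ {z k} → Location z k → Context k
context (onServer _) = server
context (onCloud c)  = cloud c

record Instance : Set where
  field
    jobs servers clouds : ℕ
    servers-positive    : 1 ≤ servers

  Job : Set
  Job = Fin jobs

  field
    edge : Job → Job → Bool

  Edge : Job → Job → Set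
  Edge i j = T (edge i j)

  field
    acyclic       : ∀ i → ¬ TransClosure Edge i i
    source sink   : Job
    unique-source : ∀ j → (∀ i → ¬ Edge i j) ⇔ j ≡ source
    unique-sink   : ∀ i → (∀ j → ¬ Edge i j) ⇔ i ≡ sink

    -- The infinite cloud processing times of source and sink are expressed by
    -- the fields source-on-server and sink-on-server of IsValid; the values
    -- processing (cloud c) j for these two jobs are never used.
    processing        : Context clouds → Job → ℕ
    source-processing : processing server source ≡ 0
    sink-processing   : processing server sink ≡ 0

    -- Only the values at edges are meaningful (and encoded).
    delay      : Context clouds → Context clouds → Job → Job → ℕ
    delay-self : ∀ m i j → Edge i j → delay m m i j ≡ 0

    cost   : Job → Fin clouds → ℕ
    budget : ℕ

record Schedule (I : Instance) : Set where
  open Instance I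
  field
    completion : Job → ℕ
    location   : Job → Location servers clouds

module _ (I : Instance) (S : Schedule I) where
  open Instance I
  open Schedule S renaming (completion to C; location to η)

  duration : Job → ℕ
  duration j = processing (context (η j)) j

  -- The subtractions in "C(i) ≤ C(j) − p(j)" are moved to the other side,
  -- since truncated subtraction would allow negative starting times.
  record IsValid : Set where
    field
      source-on-server : context (η source) ≡ server
      sink-on-server   : context (η sink) ≡ server
      no-overlap : ∀ i j q → i ≢ j → η i ≡ onServer q → η j ≡ onServer q →
        C i + processing server j ≤ C j ⊎ C j + processing server i ≤ C i
      precedence : ∀ i j → Edge i j →
        C i + delay (context (η i)) (context (η j)) i j + duration j ≤ C j

  makespan : ℕ
  makespan = C sink

  costAt : Job → Context clouds → ℕ
  costAt j server    = 0
  costAt j (cloud c) = cost j c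

  totalCost : ℕ
  totalCost = sum (tabulate (λ j → costAt j (context (η j))))

-- The chain 0 → 1 → … → n + 1.  Its edge j → j + 1 (indexed here by j) is kept
-- if mid j is nothing, and replaced by m new parallel jobs if mid j is just m.
record ChainExtension : Set where
  field
    n   : ℕ
    mid : Fin (1 + n) → Maybe ℕ

  data Vertex : Set where
    chain : Fin (2 + n) → Vertex
    new   : (j : Fin (1 + n)) → Fin (maybe′ (λ m → m) 0 (mid j)) → Vertex

  data Arc : Vertex → Vertex → Set where
    keep  : ∀ {j} → mid j ≡ nothing → Arc (chain (inject₁ j)) (chain (suc j))
    enter : ∀ {j x} → Arc (chain (inject₁ j)) (new j x)
    leave : ∀ {j x} → Arc (new j x) (chain (suc j))

record IsExtendedChain (I : Instance) : Set where
  open Instance I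
  field
    extension : ChainExtension

  open ChainExtension extension

  field
    iso        : Job ↔ Vertex
    iso-edge   : ∀ i j → Edge i j ⇔ Arc (Inverse.to iso i) (Inverse.to iso j)
    iso-source : Inverse.to iso source ≡ chain zero
    iso-sink   : Inverse.to iso sink ≡ chain (fromℕ (1 + n))

encodeContextTable : ∀ {k} → (Context k → Tree) → Tree
encodeContextTable f = f server ∙ encodeTable (λ c → f (cloud c))

-- In the adjacency matrix, nil stands for "no edge" and each edge is
-- represented by its (nonempty) table of delays.
encodeInstance : Instance → Tree
encodeInstance I = encodeList
  ( encodeℕ jobs ∷ encodeℕ servers ∷ encodeℕ clouds
  ∷ encodeFin source ∷ encodeFin sink
  ∷ encodeTable (λ i → encodeTable (λ j →
      if edge i j
      then encodeContextTable (λ m₁ → encodeContextTable (λ m₂ →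
             encodeℕ (delay m₁ m₂ i j)))
      else nil))
  ∷ encodeTable (λ j → encodeContextTable (λ m → encodeℕ (processing m j)))
  ∷ encodeTable (λ j → encodeTable (λ c → encodeℕ (cost j c)))
  ∷ encodeℕ budget
  ∷ [])
  where open Instance I

encodeLocation : ∀ {z k} → Location z k → Tree
encodeLocation (onServer q) = nil ∙ encodeFin q
encodeLocation (onCloud c)  = (nil ∙ nil) ∙ encodeFin c

encodeSchedule : (I : Instance) → Schedule I → Tree
encodeSchedule I S =
  encodeTable (λ j → encodeℕ (completion j) ∙ encodeLocation (location j))
  where open Schedule S

extendedChainMakespan : MinimizationProblem
extendedChainMakespan = record
  { Input          = Σ[ I ∈ Instance ] IsExtendedChain I
  ; Solution       = λ (I , _) → Schedule I
  ; Feasible       = λ (I , _) S → IsValid I S × totalCost I S ≤ Instance.budget I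
  ; value          = λ (I , _) S → makespan I S
  ; encodeInput    = λ (I , _) → encodeInstance I
  ; encodeSolution = λ (I , _) S → encodeSchedule I S
  }

-- The program achieves the ratio 4 for every ε.  Fix a unit 2^e, round all
-- delays and processing times up to multiples of it, and cap them at a horizon
-- H that is linear in the number of jobs; from then on times are unary numbers.
-- Between consecutive cut vertices a, b of the chain let L bound every path
-- length from a to b and let the server jobs in between have total size at most
-- L times the number of machines; the optimum satisfies this for a value L that
-- is its own segment length up to rounding.  Conversely, such a segment is
-- scheduled in time 3L: server jobs start at time L or later, filling the
-- machines one after the other, each until its load exceeds L, so that every
-- job starts by 2L and reaches b by 3L.  A dynamic program over the jobs in
-- processing order, with states (contexts, L, elapsed time, machine, load),
-- finds the cheapest such schedule for each elapsed time exactly.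
-- The program takes the smallest e for which some elapsed time up to H is
-- affordable.  For e = 0 nothing was rounded.  For e > 0 the failure of e − 1
-- shows that the optimum exceeds H/3 units up to rounding, so that the rounding
-- errors, O(1) units per job, stay below the remaining factor 4/3.
--
-- Polynomial running time is obtained by writing the program in a first-order
-- language with folds and bounding the heights of all its intermediate values
-- by an abstract interpretation.
module Submission where

open import Defs
open import Data.Bool using (Bool; true; false; T; if_then_else_; _∧_; _∨_; not)
open import Data.Empty using (⊥; ⊥-elim)
open import Data.Fin using (Fin; zero; suc; toℕ; fromℕ<; inject₁)
open import Data.Fin.Properties using (toℕ<n; toℕ-injective; toℕ-fromℕ<; toℕ-inject₁; toℕ-fromℕ)
import Data.Fin.Properties as Fin
import Data.Integer as ℤ
import Data.Integer.Properties as ℤ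
open import Data.List using (List; []; _∷_; _++_; filter; length; tabulate)
open import Data.List.Membership.Propositional using () renaming (_∈_ to _∈ᴸ_)
open import Data.List.Membership.Propositional.Properties
  using (∈-++⁺ˡ; ∈-++⁺ʳ; ∈-++⁻; ∈-filter⁻)
open import Data.List.Properties using (length-filter; length-++)
open import Data.List.Relation.Unary.All using ([]; _∷_)
import Data.List.Relation.Unary.All as All
open import Data.List.Relation.Unary.AllPairs using ([]; _∷_)
open import Data.List.Relation.Unary.Any using (here; there)
open import Data.List.Relation.Unary.Unique.Propositional using (Unique)
open import Data.List.Relation.Unary.Unique.Propositional.Properties
  using () renaming (++⁺ to unique-++⁺; filter⁺ to unique-filter⁺)
open import Data.Maybe using (nothing; maybe′)
open import Data.Nat
  using (ℕ; zero; suc; _+_; _*_; _^_; _∸_; _⊔_; _⊓_; _≤_; _<_; _≡ᵇ_; z≤n; s≤s; >-nonZero)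
open import Data.Nat.Binary using (2[1+_]; 1+[2_])
  renaming (zero to zeroᵇ; fromℕ to toBinary; toℕ to toℕᵇ)
import Data.Nat.Binary.Properties as Binary
open import Data.Nat.DivMod using (_/_; _%_; m≡m%n+[m/n]*n; m%n<n)
open import Data.Nat.ListAction using (sum)
open import Data.Nat.Properties
open import Data.Nat.Tactic.RingSolver using (solve-∀)
open import Data.Product using (Σ-syntax; ∃-syntax; _×_; _,_; proj₁; proj₂)
open import Data.Rational using (ℚ; 0ℚ)
import Data.Rational as ℚ
import Data.Rational.Properties as ℚ
import Data.Rational.Unnormalised as ℚᵘ
import Data.Rational.Unnormalised.Properties as ℚᵘ
open import Data.Sum using (_⊎_; inj₁; inj₂)
open import Data.Unit using (⊤; tt)
open import Data.Vec using (Vec; []; _∷_; lookup)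
open import Function using (_∘_; id; case_of_)
open import Function.Bundles using (Equivalence; Inverse)
open import Relation.Binary.Definitions using (tri<; tri≈; tri>)
open import Relation.Binary.PropositionalEquality
open import Relation.Nullary using (¬_; Dec; yes; no; does)
open import Relation.Nullary.Decidable using (¬?)

-- A first-order functional language compiled to WHILE

-- The constants balance as follows. Let N be the number of jobs, M the optimum and u the unit of a
-- failed scale. Rounding costs at most 13 errors of two units per job, so the optimum yields a
-- solution of value at most 3M + 26Nu. Failure means that this value passes the horizon, which is
-- at least 188Nu; hence 3M ≥ 162Nu, that is M ≥ 54Nu. At the next scale the unit is 2u and the
-- rounding costs 52Nu, and 2u more are lost because the output appends digits 1 instead of zeros.
-- The sum is at most 54Nu, hence at most M, which is what the factor 4 leaves above 3M.
--
-- Long times are truncated and hence read too small. This does no harm: a time that enters an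
-- accepted schedule is bounded by the horizon, and there the reading is not truncated.
--
-- Certifying polynomial time shapes the program. The tables of the dynamic program are
-- accumulators, and no loop may run over an accumulator. Each such loop runs over another list
-- instead, the list of states or a fuel made from the input, and takes the table or number apart in
-- step with it.

height : Tree → ℕ
height nil     = 0
height (a ∙ b) = suc (height a ⊔ height b)

iter : (Tree → Tree → Tree) → Tree → Tree → Tree
iter f nil      a = a
iter f (x ∙ xs) a = iter f xs (f x a)

cond : Tree → Tree → Tree → Tree
cond nil     a b = b
cond (_ ∙ _) a b = a

-- A first-order language of total tree functions; in the body of a fold,
-- variable 0 is the current list element and variable 1 the accumulator.
data Tm : ℕ → Set
data Args (n : ℕ) : ℕ → Set

infixr 4 _,,_

data Tm where
  var        : ∀ {n} → Fin n → Tm n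
  nil        : ∀ {n} → Tm n
  _∙_        : ∀ {n} → Tm n → Tm n → Tm n
  hd tl      : ∀ {n} → Tm n → Tm n
  bind       : ∀ {n} → Tm n → Tm (suc n) → Tm n
  if         : ∀ {n} → Tm n → Tm n → Tm n → Tm n
  fold       : ∀ {n} → Tm n → Tm n → Tm (2 + n) → Tm n
  call       : ∀ {n k} → Tm k → Args n k → Tm n

data Args n where
  []   : Args n 0
  _,,_ : ∀ {k} → Tm n → Args n k → Args n (suc k)

⟦_⟧  : ∀ {n} → Tm n → Vec Tree n → Tree
⟦_⟧* : ∀ {n k} → Args n k → Vec Tree n → Vec Tree k
⟦ var i ⟧ ρ      = lookup ρ i
⟦ nil ⟧ ρ        = nil
⟦ s ∙ t ⟧ ρ      = ⟦ s ⟧ ρ ∙ ⟦ t ⟧ ρ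
⟦ hd t ⟧ ρ       = head (⟦ t ⟧ ρ)
⟦ tl t ⟧ ρ       = tail (⟦ t ⟧ ρ)
⟦ bind s t ⟧ ρ   = ⟦ t ⟧ (⟦ s ⟧ ρ ∷ ρ)
⟦ if c s t ⟧ ρ   = cond (⟦ c ⟧ ρ) (⟦ s ⟧ ρ) (⟦ t ⟧ ρ)
⟦ fold l i b ⟧ ρ = iter (λ x a → ⟦ b ⟧ (x ∷ a ∷ ρ)) (⟦ l ⟧ ρ) (⟦ i ⟧ ρ)
⟦ call f ts ⟧ ρ  = ⟦ f ⟧ (⟦ ts ⟧* ρ)
⟦ [] ⟧* ρ        = []
⟦ t ,, ts ⟧* ρ   = ⟦ t ⟧ ρ ∷ ⟦ ts ⟧* ρ

-- Variable 0 receives the value of a term, variable 1 holds its environment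
-- as a list, and variable 2 is a stack for everything that must survive.
compileVar : ∀ {n} → Expr → Fin n → Expr
compileVar e zero    = hd e
compileVar e (suc i) = compileVar (tl e) i

env : ∀ {n} → Vec Tree n → Tree
env []      = nil
env (a ∷ ρ) = a ∙ env ρ

compile  : ∀ {n} → Tm n → Command
compile* : ∀ {n k} → Args n k → Command
compile (var i)      = 0 := compileVar (var 1) i
compile nil          = 0 := nil
compile (s ∙ t)      =
  compile s ⨾ 2 := cons (var 0) (var 2) ⨾
  compile t ⨾ 0 := cons (hd (var 2)) (var 0) ⨾ 2 := tl (var 2)
compile (hd t)       = compile t ⨾ 0 := hd (var 0)
compile (tl t)       = compile t ⨾ 0 := tl (var 0)
compile (bind s t)   =
  compile s ⨾ 1 := cons (var 0) (var 1) ⨾ compile t ⨾ 1 := tl (var 1)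
compile (if c s t)   = compile c ⨾ IF var 0 THEN compile s ELSE compile t
compile (fold l i b) =
  compile l ⨾ 2 := cons (var 0) (var 2) ⨾
  compile i ⨾ 1 := cons (var 0) (var 1) ⨾
  (WHILE hd (var 2) DO
    (1 := cons (hd (hd (var 2))) (var 1) ⨾
     compile b ⨾
     1 := cons (var 0) (tl (tl (var 1))) ⨾
     2 := cons (tl (hd (var 2))) (tl (var 2)))) ⨾
  0 := hd (var 1) ⨾ 1 := tl (var 1) ⨾ 2 := tl (var 2)
compile (call f ts)  =
  compile* ts ⨾
  -- The environment of the caller takes the place of the argument list on the stack while `f` runs.
  0 := hd (var 2) ⨾ 2 := cons (var 1) (tl (var 2)) ⨾ 1 := var 0 ⨾
  compile f ⨾
  1 := hd (var 2) ⨾ 2 := tl (var 2)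
-- The argument list grows on top of the stack from the last argument to the first, so it ends up in
-- the order of an environment.
compile* []          = 2 := cons nil (var 2)
compile* (t ,, ts)   =
  compile* ts ⨾ compile t ⨾ 2 := cons (cons (var 0) (hd (var 2))) (tl (var 2))

varTime : ∀ {n} → Fin n → ℕ → ℕ
varTime zero    t = 2 + t
varTime (suc i) t = varTime i (suc t)

iterTime : (Tree → Tree → Tree) → (Tree → Tree → ℕ) → Tree → Tree → ℕ
iterTime f g nil      a = 3
iterTime f g (x ∙ xs) a = g x a + iterTime f g xs (f x a)

branchTime : Tree → ℕ → ℕ → ℕ
branchTime nil     m n = n
branchTime (_ ∙ _) m n = m

-- The constants are the costs of the emitted assignments plus one for each sequencing. Exact counts
-- let `runs` assemble derivations from the bare constructors of `Exec`; estimates come only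
-- afterwards.
time  : ∀ {n} → Tm n → Vec Tree n → ℕ
time* : ∀ {n k} → Args n k → Vec Tree n → ℕ
time (var i) ρ      = varTime i 1
time nil ρ          = 2
time (s ∙ t) ρ      = 1 + time s ρ + (5 + (1 + time t ρ + 9))
time (hd t) ρ       = 1 + time t ρ + 3
time (tl t) ρ       = 1 + time t ρ + 3
time (bind s t) ρ   = 1 + time s ρ + (5 + (1 + time t (⟦ s ⟧ ρ ∷ ρ) + 3))
time (if c s t) ρ   = 1 + time c ρ + (2 + branchTime (⟦ c ⟧ ρ) (time s ρ) (time t ρ))
time (fold l i b) ρ =
  1 + time l ρ + (5 + (1 + time i ρ + (5 + (1 +
  iterTime (λ x a → ⟦ b ⟧ (x ∷ a ∷ ρ)) (λ x a → 3 + (7 + (1 + time b (x ∷ a ∷ ρ) + 14)))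
           (⟦ l ⟧ ρ) (⟦ i ⟧ ρ)
  + 11))))
time (call f ts) ρ  = 1 + time* ts ρ + (13 + (1 + time f (⟦ ts ⟧* ρ) + 7))
time* [] ρ          = 4
time* (t ,, ts) ρ   = 1 + time* ts ρ + (1 + time t ρ + 8)

-- Correctness and exact running time of compiled terms

Runs : Command → Store → Tree → Tree → ℕ → Set
Runs C σ v s n = Σ[ τ ∈ Store ] (Exec C σ τ n × τ 0 ≡ v × τ 1 ≡ σ 1 × τ 2 ≡ s)

eval-compileVar : ∀ {n} (i : Fin n) (ρ : Vec Tree n) (e : Expr) σ →
  eval e σ ≡ env ρ → eval (compileVar e i) σ ≡ lookup ρ i
eval-compileVar zero    (a ∷ ρ) e σ eq = cong head eq
eval-compileVar (suc i) (a ∷ ρ) e σ eq = eval-compileVar i ρ (tl e) σ (cong tail eq)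

evalTime-compileVar : ∀ {n} (i : Fin n) e → 1 + evalTime (compileVar e i) ≡ varTime i (evalTime e)
evalTime-compileVar zero    e = refl
evalTime-compileVar (suc i) e = evalTime-compileVar i (tl e)

nonnil : {x y t : Tree} → t ≡ x ∙ y → t ≢ nil
nonnil refl ()

-- Every compiled term restores the environment and the stack; with this invariant the pieces of
-- code compose.
runs  : ∀ {n} (t : Tm n) (ρ : Vec Tree n) σ → σ 1 ≡ env ρ →
  Runs (compile t) σ (⟦ t ⟧ ρ) (σ 2) (time t ρ)
runs* : ∀ {n k} (ts : Args n k) (ρ : Vec Tree n) σ → σ 1 ≡ env ρ →
  Σ[ τ ∈ Store ] (Exec (compile* ts) σ τ (time* ts ρ) ×
    τ 1 ≡ σ 1 × τ 2 ≡ env (⟦ ts ⟧* ρ) ∙ σ 2)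
-- During a fold the accumulator sits on top of the environment and the rest of the list on top of
-- the stack.
runsLoop : ∀ {n} (b : Tm (2 + n)) (ρ : Vec Tree n) (l a r : Tree) σ →
  σ 1 ≡ a ∙ env ρ → σ 2 ≡ l ∙ r →
  let f = λ x a → ⟦ b ⟧ (x ∷ a ∷ ρ) in
  Σ[ τ ∈ Store ] (Exec (WHILE hd (var 2) DO
    (1 := cons (hd (hd (var 2))) (var 1) ⨾
     compile b ⨾
     1 := cons (var 0) (tl (tl (var 1))) ⨾
     2 := cons (tl (hd (var 2))) (tl (var 2)))) σ τ
    (iterTime f (λ x a → 3 + (7 + (1 + time b (x ∷ a ∷ ρ) + 14))) l a) ×
    τ 1 ≡ iter f l a ∙ env ρ × τ 2 ≡ nil ∙ r)

runs (var i) ρ σ σ₁ = _ ,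
  subst (Exec _ σ _) (evalTime-compileVar i (var 1)) assign ,
  eval-compileVar i ρ (var 1) σ σ₁ , refl , refl
runs nil ρ σ σ₁ = _ , assign , refl , refl , refl
runs (s ∙ t) ρ σ σ₁
  with τ , e , τ₀ , τ₁ , τ₂ ← runs s ρ σ σ₁
  with υ , e′ , υ₀ , υ₁ , υ₂ ← runs t ρ (τ [ 2 ↦ τ 0 ∙ τ 2 ]) (trans τ₁ σ₁) =
  _ , seq e (seq assign (seq e′ (seq assign assign))) ,
  cong₂ _∙_ (trans (cong head υ₂) τ₀) υ₀ , trans υ₁ τ₁ , trans (cong tail υ₂) τ₂
runs (hd t) ρ σ σ₁ with τ , e , τ₀ , τ₁ , τ₂ ← runs t ρ σ σ₁ =
  _ , seq e assign , cong head τ₀ , τ₁ , τ₂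
runs (tl t) ρ σ σ₁ with τ , e , τ₀ , τ₁ , τ₂ ← runs t ρ σ σ₁ =
  _ , seq e assign , cong tail τ₀ , τ₁ , τ₂
runs (bind s t) ρ σ σ₁
  with τ , e , τ₀ , τ₁ , τ₂ ← runs s ρ σ σ₁
  with υ , e′ , υ₀ , υ₁ , υ₂ ← runs t (⟦ s ⟧ ρ ∷ ρ) (τ [ 1 ↦ τ 0 ∙ τ 1 ])
         (cong₂ _∙_ τ₀ (trans τ₁ σ₁)) =
  _ , seq e (seq assign (seq e′ assign)) ,
  υ₀ , trans (cong tail υ₁) τ₁ , trans υ₂ τ₂
runs (if c s t) ρ σ σ₁
  with τ , e , τ₀ , τ₁ , τ₂ ← runs c ρ σ σ₁
  with ⟦ c ⟧ ρ
... | nil with υ , e′ , υ₀ , υ₁ , υ₂ ← runs t ρ τ (trans τ₁ σ₁) =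
  _ , seq e (if-false τ₀ e′) , υ₀ , trans υ₁ τ₁ , trans υ₂ τ₂
... | _ ∙ _ with υ , e′ , υ₀ , υ₁ , υ₂ ← runs s ρ τ (trans τ₁ σ₁) =
  _ , seq e (if-true (nonnil τ₀) e′) , υ₀ , trans υ₁ τ₁ , trans υ₂ τ₂
runs (fold l i b) ρ σ σ₁
  with τ , e , τ₀ , τ₁ , τ₂ ← runs l ρ σ σ₁
  with υ , e′ , υ₀ , υ₁ , υ₂ ← runs i ρ (τ [ 2 ↦ τ 0 ∙ τ 2 ]) (trans τ₁ σ₁)
  with φ , e″ , φ₁ , φ₂ ← runsLoop b ρ (⟦ l ⟧ ρ) (⟦ i ⟧ ρ) (σ 2) (υ [ 1 ↦ υ 0 ∙ υ 1 ])
         (cong₂ _∙_ υ₀ (trans υ₁ (trans τ₁ σ₁))) (trans υ₂ (cong₂ _∙_ τ₀ τ₂)) =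
  _ , seq e (seq assign (seq e′ (seq assign (seq e″ (seq assign (seq assign assign)))))) ,
  cong head φ₁ , trans (cong tail φ₁) (sym σ₁) , cong tail φ₂
runs (call f ts) ρ σ σ₁
  with τ , e , τ₁ , τ₂ ← runs* ts ρ σ σ₁
  with υ , e′ , υ₀ , υ₁ , υ₂ ← runs f (⟦ ts ⟧* ρ)
         (((τ [ 0 ↦ head (τ 2) ]) [ 2 ↦ τ 1 ∙ tail (τ 2) ]) [ 1 ↦ head (τ 2) ])
         (cong head τ₂) =
  _ , seq e (seq assign (seq assign (seq assign (seq e′ (seq assign assign))))) ,
  υ₀ , trans (cong head υ₂) τ₁ , trans (cong tail υ₂) (cong tail τ₂)
runs* [] ρ σ σ₁ = _ , assign , refl , refl
runs* (t ,, ts) ρ σ σ₁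
  with τ , e , τ₁ , τ₂ ← runs* ts ρ σ σ₁
  with υ , e′ , υ₀ , υ₁ , υ₂ ← runs t ρ τ (trans τ₁ σ₁) =
  _ , seq e (seq e′ assign) , trans υ₁ τ₁ ,
  cong₂ _∙_ (cong₂ _∙_ υ₀ (cong head (trans υ₂ τ₂))) (cong tail (trans υ₂ τ₂))
runsLoop b ρ nil a r σ σ₁ σ₂ = _ , while-false (cong head σ₂) , σ₁ , σ₂
runsLoop b ρ (x ∙ xs) a r σ σ₁ σ₂
  with τ , e , τ₀ , τ₁ , τ₂ ← runs b (x ∷ a ∷ ρ) (σ [ 1 ↦ head (head (σ 2)) ∙ σ 1 ])
         (cong₂ _∙_ (cong (head ∘ head) σ₂) σ₁)
  with υ , e′ , υ₁ , υ₂ ← runsLoop b ρ xs (⟦ b ⟧ (x ∷ a ∷ ρ)) r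
         ((τ [ 1 ↦ τ 0 ∙ tail (tail (τ 1)) ]) [ 2 ↦ tail (head (τ 2)) ∙ tail (τ 2) ])
         (cong₂ _∙_ τ₀ (trans (cong (tail ∘ tail) τ₁) (cong tail σ₁)))
         (cong₂ _∙_ (trans (cong (tail ∘ head) τ₂) (cong (tail ∘ head) σ₂))
                    (trans (cong tail τ₂) (cong tail σ₂))) =
  _ , while-true (nonnil (cong head σ₂)) (seq assign (seq e (seq assign assign))) e′ , υ₁ , υ₂

-- Polynomial bounds on values and running times

data Poly : Set where
  con     : ℕ → Poly
  size♯   : Poly
  _⊕_ _⊗_ : Poly → Poly → Poly

infixl 6 _⊕_
infixl 7 _⊗_

at : Poly → ℕ → ℕ
at (con c) n = c
at size♯   n = n
at (p ⊕ q) n = at p n + at q n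
at (p ⊗ q) n = at p n * at q n

coefficient degree : Poly → ℕ
coefficient (con c) = c
coefficient size♯       = 1
coefficient (p ⊕ q) = coefficient p + coefficient q
coefficient (p ⊗ q) = coefficient p * coefficient q
degree (con c) = 0
degree size♯       = 1
degree (p ⊕ q) = degree p + degree q
degree (p ⊗ q) = degree p + degree q

-- Adding the degrees for `⊕` as well avoids a maximum: for positive n, powers only grow with the
-- exponent.
at≤monomial : ∀ p {m n} → 1 ≤ n → m ≤ n → at p m ≤ coefficient p * n ^ degree p
at≤monomial (con c) _ _ = ≤-reflexive (sym (*-identityʳ c))
at≤monomial size♯ {m} {n} _ m≤n =
  ≤-trans m≤n (≤-reflexive (sym (trans (+-identityʳ _) (*-identityʳ n))))
at≤monomial (p ⊕ q) {m} {n} 1≤n m≤n = begin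
  at p m + at q m
    ≤⟨ +-mono-≤ (at≤monomial p 1≤n m≤n) (at≤monomial q 1≤n m≤n) ⟩
  a * n ^ d + b * n ^ e
    ≤⟨ +-mono-≤ (*-monoʳ-≤ a (^-monoʳ-≤ n ⦃ >-nonZero 1≤n ⦄ (m≤m+n d e)))
                (*-monoʳ-≤ b (^-monoʳ-≤ n ⦃ >-nonZero 1≤n ⦄ (m≤n+m e d))) ⟩
  a * n ^ (d + e) + b * n ^ (d + e)
    ≡⟨ *-distribʳ-+ (n ^ (d + e)) a b ⟨
  (a + b) * n ^ (d + e) ∎
  where
  open ≤-Reasoning
  a = coefficient p
  b = coefficient q
  d = degree p
  e = degree q
at≤monomial (p ⊗ q) {m} {n} 1≤n m≤n = begin
  at p m * at q m
    ≤⟨ *-mono-≤ (at≤monomial p 1≤n m≤n) (at≤monomial q 1≤n m≤n) ⟩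
  (a * n ^ d) * (b * n ^ e)
    ≡⟨ [m*n]*[o*p]≡[m*o]*[n*p] a (n ^ d) b (n ^ e) ⟩
  (a * b) * (n ^ d * n ^ e)
    ≡⟨ cong (a * b *_) (^-distribˡ-+-* n d e) ⟨
  (a * b) * n ^ (d + e) ∎
  where
  open ≤-Reasoning
  a = coefficient p
  b = coefficient q
  d = degree p
  e = degree q

-- In the manner of Bellantoni and Cook, variables are split into normal
-- (false) and safe (true) ones.  The height of a result exceeds the heights of
-- the safe variables by at most a polynomial in the heights of the normal
-- ones; folds over normal lists preserve this, since their accumulator is safe.
some : ∀ {n} → Vec Bool n → Bool
some []      = false
some (b ∷ φ) = b ∨ some φ

flag  : ∀ {n} → Tm n → Vec Bool n → Bool
flag* : ∀ {n k} → Args n k → Vec Bool n → Vec Bool k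
flag (var i) φ      = lookup φ i
flag nil φ          = false
flag (s ∙ t) φ      = flag s φ ∨ flag t φ
flag (hd t) φ       = flag t φ
flag (tl t) φ       = flag t φ
flag (bind s t) φ   = flag t (flag s φ ∷ φ)
flag (if c s t) φ   = flag s φ ∨ flag t φ
-- The body may mention any variable, so a single safe one makes the result safe.
flag (fold l i b) φ = some φ
flag (call f ts) φ  = flag f (flag* ts φ)
flag* [] φ          = []
flag* (t ,, ts) φ   = flag t φ ∷ flag* ts φ

ok  : ∀ {n} → Tm n → Vec Bool n → Bool
ok* : ∀ {n k} → Args n k → Vec Bool n → Bool
ok (var i) φ      = true
ok nil φ          = true
ok (s ∙ t) φ      = ok s φ ∧ ok t φ
ok (hd t) φ       = ok t φ
ok (tl t) φ       = ok t φ
ok (bind s t) φ   = ok s φ ∧ ok t (flag s φ ∷ φ)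
ok (if c s t) φ   = ok c φ ∧ (ok s φ ∧ ok t φ)
ok (fold l i b) φ = not (flag l φ) ∧ (ok l φ ∧ (ok i φ ∧ ok b (false ∷ true ∷ φ)))
ok (call f ts) φ  = ok* ts φ ∧ ok f (flag* ts φ)
ok* [] φ          = true
ok* (t ,, ts) φ   = ok t φ ∧ ok* ts φ

growth  : ∀ {n} → Tm n → Vec Poly n → Poly
growth* : ∀ {n k} → Args n k → Vec Poly n → Vec Poly k
growth (var i) Γ      = lookup Γ i
growth nil Γ          = con 0
-- The maximum of the two heights is replaced by their sum, which stays within `Poly`.
growth (s ∙ t) Γ      = con 1 ⊕ (growth s Γ ⊕ growth t Γ)
growth (hd t) Γ       = growth t Γ
growth (tl t) Γ       = growth t Γ
growth (bind s t) Γ   = growth t (growth s Γ ∷ Γ)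
growth (if c s t) Γ   = growth s Γ ⊕ growth t Γ
-- Elements are no higher than the list. The accumulator gets `con 0` because its height is carried
-- by the safe allowance.
growth (fold l i b) Γ = growth i Γ ⊕ growth l Γ ⊗ growth b (growth l Γ ∷ con 0 ∷ Γ)
growth (call f ts) Γ  = growth f (growth* ts Γ)
growth* [] Γ          = []
growth* (t ,, ts) Γ   = growth t Γ ∷ growth* ts Γ

timeBound  : ∀ {n} → Tm n → Vec Poly n → Poly
timeBound* : ∀ {n k} → Args n k → Vec Poly n → Poly
timeBound (var i) Γ      = con (varTime i 1)
timeBound nil Γ          = con 2
timeBound (s ∙ t) Γ      = con 1 ⊕ timeBound s Γ ⊕ (con 5 ⊕ (con 1 ⊕ timeBound t Γ ⊕ con 9))
timeBound (hd t) Γ       = con 1 ⊕ timeBound t Γ ⊕ con 3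
timeBound (tl t) Γ       = con 1 ⊕ timeBound t Γ ⊕ con 3
timeBound (bind s t) Γ   =
  con 1 ⊕ timeBound s Γ ⊕ (con 5 ⊕ (con 1 ⊕ timeBound t (growth s Γ ∷ Γ) ⊕ con 3))
timeBound (if c s t) Γ   =
  con 1 ⊕ timeBound c Γ ⊕ (con 2 ⊕ (timeBound s Γ ⊕ timeBound t Γ))
timeBound (fold l i b) Γ =
  con 1 ⊕ timeBound l Γ ⊕ (con 5 ⊕ (con 1 ⊕ timeBound i Γ ⊕ (con 5 ⊕ (con 1 ⊕
  (growth l Γ ⊗ (con 3 ⊕ (con 7 ⊕ (con 1 ⊕ timeBound b (growth l Γ ∷ con 0 ∷ Γ) ⊕ con 14)))
     ⊕ con 3)
  ⊕ con 11))))
timeBound (call f ts) Γ  =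
  con 1 ⊕ timeBound* ts Γ ⊕ (con 13 ⊕ (con 1 ⊕ timeBound f (growth* ts Γ) ⊕ con 7))
timeBound* [] Γ          = con 4
timeBound* (t ,, ts) Γ   = con 1 ⊕ timeBound* ts Γ ⊕ (con 1 ⊕ timeBound t Γ ⊕ con 8)

allowance : Bool → ℕ → ℕ
allowance false W = 0
allowance true  W = W

allowance-∨ˡ : ∀ b c W → allowance b W ≤ allowance (b ∨ c) W
allowance-∨ˡ false c W = z≤n
allowance-∨ˡ true  c W = ≤-refl

allowance-∨ʳ : ∀ b c W → allowance c W ≤ allowance (b ∨ c) W
allowance-∨ʳ false c     W = ≤-refl
allowance-∨ʳ true  false W = z≤n
allowance-∨ʳ true  true  W = ≤-refl

allowance≤ : ∀ b W → allowance b W ≤ W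
allowance≤ false W = z≤n
allowance≤ true  W = ≤-refl

allowance-mono : ∀ b {V W} → V ≤ W → allowance b V ≤ allowance b W
allowance-mono false V≤W = z≤n
allowance-mono true  V≤W = V≤W

-- Heights rather than sizes: with sharing, sizes can grow exponentially, whereas a `cons` raises
-- the height by one only. The height still bounds the length of a list and thus the number of
-- rounds of a fold.
Bounded : ℕ → ℕ → Bool → Poly → Tree → Set
Bounded n W b p v = height v ≤ allowance b W + at p n

data AllBounded (n W : ℕ) : ∀ {k} → Vec Bool k → Vec Poly k → Vec Tree k → Set where
  []  : AllBounded n W [] [] []
  _∷_ : ∀ {k b p v} {φ : Vec Bool k} {Γ ρ} → Bounded n W b p v → AllBounded n W φ Γ ρ →
        AllBounded n W (b ∷ φ) (p ∷ Γ) (v ∷ ρ)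

height-head : ∀ t → height (head t) ≤ height t
height-head nil     = z≤n
height-head (a ∙ b) = m≤n⇒m≤1+n (m≤m⊔n _ _)

height-tail : ∀ t → height (tail t) ≤ height t
height-tail nil     = z≤n
height-tail (a ∙ b) = m≤n⇒m≤1+n (m≤n⊔m (height a) _)

lookup-bounded : ∀ {n W k} {φ : Vec Bool k} {Γ ρ} (i : Fin k) → AllBounded n W φ Γ ρ →
  Bounded n W (lookup φ i) (lookup Γ i) (lookup ρ i)
lookup-bounded zero    (v ∷ vs) = v
lookup-bounded (suc i) (v ∷ vs) = lookup-bounded i vs

all-bounded-mono : ∀ {n V W k} {φ : Vec Bool k} {Γ ρ} → V ≤ W →
  AllBounded n V φ Γ ρ → AllBounded n W φ Γ ρ
all-bounded-mono V≤W [] = []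
all-bounded-mono V≤W (_∷_ {b = b} v vs) =
  ≤-trans v (+-monoˡ-≤ _ (allowance-mono b V≤W)) ∷ all-bounded-mono V≤W vs

-- Without safe variables the allowance may be taken as zero; this is why a fold among normal
-- variables has a normal result again.
all-bounded-normal : ∀ {n W k} {φ : Vec Bool k} {Γ ρ} → some φ ≡ false →
  AllBounded n W φ Γ ρ → AllBounded n 0 φ Γ ρ
all-bounded-normal eq [] = []
all-bounded-normal {φ = false ∷ φ} eq (v ∷ vs) = v ∷ all-bounded-normal eq vs

T-∧-fst : ∀ {b c} → T (b ∧ c) → T b
T-∧-fst {true} _ = tt

T-∧-snd : ∀ {b c} → T (b ∧ c) → T c
T-∧-snd {true} t = t

T-not : ∀ {b} → T (not b) → b ≡ false
T-not {false} _ = refl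

-- The height of the list enters twice: `q` bounds the elements and `m` the number of rounds. Each
-- round adds `p`, and the enlarged `W′` is the allowance of the next one.
iter-height : ∀ (f : Tree → Tree → Tree) {p q W} l a →
  (∀ {x a W′} → height x ≤ q → W ≤ W′ → height a ≤ W′ → height (f x a) ≤ W′ + p) →
  ∀ {W′ m} → height l ≤ q → height l ≤ m → W ≤ W′ → height a ≤ W′ →
  height (iter f l a) ≤ W′ + m * p
iter-height f nil a step _ _ _ a≤ = ≤-trans a≤ (m≤m+n _ _)
iter-height f {p} (x ∙ xs) a step {W′} {suc m} l≤q (s≤s l≤m) W≤ a≤ =
  ≤-trans (iter-height f xs (f x a) step
            (≤-trans (height-tail (x ∙ xs)) l≤q) (≤-trans (m≤n⊔m (height x) _) l≤m)
            (≤-trans W≤ (m≤m+n W′ p))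
            (step (≤-trans (height-head (x ∙ xs)) l≤q) W≤ a≤))
          (≤-reflexive (+-assoc W′ p (m * p)))

iterTime-bound : ∀ (f : Tree → Tree → Tree) (g : Tree → Tree → ℕ) {c q W p} l a →
  (∀ {x a W′} → height x ≤ q → W ≤ W′ → height a ≤ W′ →
    height (f x a) ≤ W′ + p × g x a ≤ c) →
  ∀ {W′ m} → height l ≤ q → height l ≤ m → W ≤ W′ → height a ≤ W′ →
  iterTime f g l a ≤ m * c + 3
iterTime-bound f g nil a step {m = m} _ _ _ _ = m≤n+m 3 (m * _)
iterTime-bound f g {c} {p = p} (x ∙ xs) a step {W′} {suc m} l≤q (s≤s l≤m) W≤ a≤ =
  ≤-trans (+-mono-≤ (proj₂ now) (iterTime-bound f g xs (f x a) step
            (≤-trans (height-tail (x ∙ xs)) l≤q) (≤-trans (m≤n⊔m (height x) _) l≤m)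
            (≤-trans W≤ (m≤m+n W′ p)) (proj₁ now)))
          (≤-reflexive (sym (+-assoc c (m * c) 3)))
  where
  now = step (≤-trans (height-head (x ∙ xs)) l≤q) W≤ a≤

-- The bound on the time is free of `W`: loops run over normal lists only, so the heights of safe
-- values have no influence on it.
sound  : ∀ {k} (t : Tm k) {φ Γ ρ n W} → T (ok t φ) → AllBounded n W φ Γ ρ →
  Bounded n W (flag t φ) (growth t Γ) (⟦ t ⟧ ρ) × time t ρ ≤ at (timeBound t Γ) n
sound* : ∀ {k j} (ts : Args k j) {φ Γ ρ n W} → T (ok* ts φ) → AllBounded n W φ Γ ρ →
  AllBounded n W (flag* ts φ) (growth* ts Γ) (⟦ ts ⟧* ρ) × time* ts ρ ≤ at (timeBound* ts Γ) n
soundFold : ∀ {k} (l i : Tm k) (b : Tm (2 + k)) {φ Γ ρ n W} → T (ok (fold l i b) φ) →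
  AllBounded n W φ Γ ρ →
  height (⟦ fold l i b ⟧ ρ) ≤ W + at (growth (fold l i b) Γ) n ×
  time (fold l i b) ρ ≤ at (timeBound (fold l i b) Γ) n
sound (var i) o vs = lookup-bounded i vs , ≤-refl
sound nil o vs = z≤n , ≤-refl
sound (s ∙ t) {φ} {Γ} {n = n} {W} o vs
  with s≤ , s-time ← sound s {φ} (T-∧-fst o) vs
  with t≤ , t-time ← sound t {φ} (T-∧-snd {ok s φ} o) vs =
  ≤-trans (s≤s (⊔-lub
     (≤-trans s≤ (+-mono-≤ (allowance-∨ˡ (flag s φ) (flag t φ) W) (m≤m+n _ _)))
     (≤-trans t≤ (+-mono-≤ (allowance-∨ʳ (flag s φ) (flag t φ) W)
       (m≤n+m (at (growth t Γ) n) (at (growth s Γ) n))))))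
   (≤-reflexive (sym (+-suc _ _))) ,
  s≤s (+-mono-≤ s-time (+-monoʳ-≤ 6 (+-monoˡ-≤ 9 t-time)))
sound (hd t) {ρ = ρ} o vs with t≤ , t-time ← sound t o vs =
  ≤-trans (height-head (⟦ t ⟧ ρ)) t≤ , s≤s (+-monoˡ-≤ 3 t-time)
sound (tl t) {ρ = ρ} o vs with t≤ , t-time ← sound t o vs =
  ≤-trans (height-tail (⟦ t ⟧ ρ)) t≤ , s≤s (+-monoˡ-≤ 3 t-time)
sound (bind s t) {φ} o vs
  with s≤ , s-time ← sound s {φ} (T-∧-fst o) vs
  with t≤ , t-time ← sound t {flag s φ ∷ φ} (T-∧-snd {ok s φ} o) (s≤ ∷ vs) =
  t≤ , s≤s (+-mono-≤ s-time (+-monoʳ-≤ 6 (+-monoˡ-≤ 3 t-time)))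
sound (if c s t) {φ} {Γ} {ρ} {n} {W} o vs
  with c≤ , c-time ← sound c {φ} (T-∧-fst o) vs
  with s≤ , s-time ← sound s {φ} (T-∧-fst (T-∧-snd {ok c φ} o)) vs
  with t≤ , t-time ← sound t {φ} (T-∧-snd {ok s φ} (T-∧-snd {ok c φ} o)) vs
  with ⟦ c ⟧ ρ
... | nil   =
  ≤-trans t≤ (+-mono-≤ (allowance-∨ʳ (flag s φ) (flag t φ) W)
    (m≤n+m (at (growth t Γ) n) (at (growth s Γ) n))) ,
  s≤s (+-mono-≤ c-time (+-monoʳ-≤ 2 (≤-trans t-time (m≤n+m _ _))))
... | _ ∙ _ =
  ≤-trans s≤ (+-mono-≤ (allowance-∨ˡ (flag s φ) (flag t φ) W) (m≤m+n _ _)) ,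
  s≤s (+-mono-≤ c-time (+-monoʳ-≤ 2 (≤-trans s-time (m≤m+n _ _))))
sound (fold l i b) {φ} o vs with some φ in eq
... | true  = soundFold l i b {φ} o vs
... | false = soundFold l i b {φ} o (all-bounded-normal eq vs)
sound (call f ts) {φ} o vs
  with ts≤ , ts-time ← sound* ts {φ} (T-∧-fst o) vs
  with f≤ , f-time ← sound f (T-∧-snd {ok* ts φ} o) ts≤ =
  f≤ , s≤s (+-mono-≤ ts-time (+-monoʳ-≤ 14 (+-monoˡ-≤ 7 f-time)))
sound* [] o vs = [] , ≤-refl
sound* (t ,, ts) {φ} o vs
  with t≤ , t-time ← sound t {φ} (T-∧-fst o) vs
  with ts≤ , ts-time ← sound* ts {φ} (T-∧-snd {ok t φ} o) vs =
  t≤ ∷ ts≤ , s≤s (+-mono-≤ ts-time (s≤s (+-monoˡ-≤ 8 t-time)))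
soundFold l i b {φ} {Γ} {ρ} {n} {W} o vs
  with l≤ , l-time ← sound l {φ} (T-∧-fst (T-∧-snd {not (flag l φ)} o)) vs
  with i≤ , i-time ← sound i {φ}
         (T-∧-fst (T-∧-snd {ok l φ} (T-∧-snd {not (flag l φ)} o))) vs
  rewrite T-not (T-∧-fst {not (flag l φ)} o) =
  ≤-trans (iter-height f (⟦ l ⟧ ρ) (⟦ i ⟧ ρ) (λ x≤ W≤ a≤ → proj₁ (step x≤ W≤ a≤))
            l≤ l≤ (m≤m+n W _) init≤)
          (≤-reflexive (+-assoc W _ _)) ,
  s≤s (+-mono-≤ l-time (+-monoʳ-≤ 6 (+-mono-≤ i-time (+-monoʳ-≤ 6 (+-monoˡ-≤ 11
    (iterTime-bound f _ (⟦ l ⟧ ρ) (⟦ i ⟧ ρ) step l≤ l≤ (m≤m+n W _) init≤))))))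
  where
  f : Tree → Tree → Tree
  f x a = ⟦ b ⟧ (x ∷ a ∷ ρ)
  init≤ : height (⟦ i ⟧ ρ) ≤ W + at (growth i Γ) n
  init≤ = ≤-trans i≤ (+-monoˡ-≤ _ (allowance≤ (flag i φ) W))
  step : ∀ {x a W′} → height x ≤ at (growth l Γ) n → W ≤ W′ → height a ≤ W′ →
    height (f x a) ≤ W′ + at (growth b (growth l Γ ∷ con 0 ∷ Γ)) n ×
    3 + (7 + (1 + time b (x ∷ a ∷ ρ) + 14)) ≤
      3 + (7 + (1 + at (timeBound b (growth l Γ ∷ con 0 ∷ Γ)) n + 14))
  step {W′ = W′} x≤ W≤ a≤
    with b≤ , b-time ← sound b {false ∷ true ∷ φ}
           (T-∧-snd {ok i φ} (T-∧-snd {ok l φ} (T-∧-snd {not (flag l φ)} o)))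
           (x≤ ∷ ≤-trans a≤ (m≤m+n W′ 0) ∷ all-bounded-mono W≤ vs) =
    ≤-trans b≤ (+-monoˡ-≤ _ (allowance≤ (flag b (false ∷ true ∷ φ)) W′)) ,
    +-monoʳ-≤ 11 (+-monoˡ-≤ 14 b-time)

height≤size : ∀ t → height t ≤ size t
height≤size nil     = z≤n
height≤size (a ∙ b) = s≤s (⊔-lub (≤-trans (height≤size a) (m≤m+n _ _))
                                 (≤-trans (height≤size b) (m≤n+m _ _)))

1≤size : ∀ t → 1 ≤ size t
1≤size nil     = ≤-refl
1≤size (a ∙ b) = s≤s z≤n

-- Unary numbers, lists and tables

v0 : ∀ {n} → Tm (1 + n)
v0 = var zero
v1 : ∀ {n} → Tm (2 + n)
v1 = var (suc zero)
v2 : ∀ {n} → Tm (3 + n)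
v2 = var (suc (suc zero))
v3 : ∀ {n} → Tm (4 + n)
v3 = var (suc (suc (suc zero)))
v4 : ∀ {n} → Tm (5 + n)
v4 = var (suc (suc (suc (suc zero))))
v5 : ∀ {n} → Tm (6 + n)
v5 = var (suc (suc (suc (suc (suc zero)))))
v6 : ∀ {n} → Tm (7 + n)
v6 = var (suc (suc (suc (suc (suc (suc zero))))))
Yes : Tree → Set
Yes nil     = ⊥
Yes (_ ∙ _) = ⊤

Yes? : ∀ t → Yes t ⊎ t ≡ nil
Yes? nil     = inj₂ refl
Yes? (_ ∙ _) = inj₁ tt

cond-yes : ∀ {c a b} → Yes c → cond c a b ≡ a
cond-yes {_ ∙ _} _ = refl

and : ∀ {n} → Tm n → Tm n → Tm n
and s t = if s t nil

and⁻ : ∀ {a b} → Yes (cond a b nil) → Yes a × Yes b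
and⁻ {_ ∙ _} y = tt , y

and⁺ : ∀ {a b} → Yes a → Yes b → Yes (cond a b nil)
and⁺ {_ ∙ _} _ y = y

-- Every tree counts as a number in unary notation, as a list of its
-- elements, and (digit nil = 2, all other digits = 1) as a number in
-- bijective binary notation.
len : Tree → ℕ
len nil     = 0
len (_ ∙ t) = suc (len t)

infix 4 _∈_
data _∈_ (x : Tree) : Tree → Set where
  here  : ∀ {t} → x ∈ x ∙ t
  there : ∀ {y t} → x ∈ t → x ∈ y ∙ t

digit : Tree → ℕ
digit nil     = 2
digit (_ ∙ _) = 1

bval : Tree → ℕ
bval nil     = 0
bval (d ∙ t) = digit d + 2 * bval t

drop : ℕ → Tree → Tree
drop zero    t = t
drop (suc n) t = drop n (tail t)

drop-nil : ∀ n → drop n nil ≡ nil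
drop-nil zero    = refl
drop-nil (suc n) = drop-nil n

Yes-drop⁻ : ∀ n t → Yes (drop n t) → n < len t
Yes-drop⁻ n nil y rewrite drop-nil n = ⊥-elim y
Yes-drop⁻ zero (_ ∙ t) y = s≤s z≤n
Yes-drop⁻ (suc n) (_ ∙ t) y = s≤s (Yes-drop⁻ n t y)

Yes-drop⁺ : ∀ n t → n < len t → Yes (drop n t)
Yes-drop⁺ zero (_ ∙ t) _ = tt
Yes-drop⁺ (suc n) (_ ∙ t) (s≤s lt) = Yes-drop⁺ n t lt

iter-tail : ∀ a t → iter (λ _ s → tail s) a t ≡ drop (len a) t
iter-tail nil     t = refl
iter-tail (_ ∙ a) t = iter-tail a (tail t)

opaque
  -- One cell is added to `b` before as many cells are dropped as `a` has; the extra cell makes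
  -- equality count as success.
  leqU : Tm 2
  leqU = fold v0 (nil ∙ v1) (tl v1)

  leqU⁻ : ∀ {a b} → Yes (⟦ leqU ⟧ (a ∷ b ∷ [])) → len a ≤ len b
  leqU⁻ {a} {b} y rewrite iter-tail a (nil ∙ b) = ≤-pred (Yes-drop⁻ (len a) (nil ∙ b) y)

  leqU⁺ : ∀ {a b} → len a ≤ len b → Yes (⟦ leqU ⟧ (a ∷ b ∷ []))
  leqU⁺ {a} {b} a≤b rewrite iter-tail a (nil ∙ b) = Yes-drop⁺ (len a) (nil ∙ b) (s≤s a≤b)

opaque
  eqU : Tm 2
  eqU = and (call leqU (v0 ,, v1 ,, [])) (call leqU (v1 ,, v0 ,, []))

  eqU⁻ : ∀ {a b} → Yes (⟦ eqU ⟧ (a ∷ b ∷ [])) → len a ≡ len b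
  eqU⁻ y = ≤-antisym (leqU⁻ (proj₁ (and⁻ y))) (leqU⁻ (proj₂ (and⁻ y)))

  eqU⁺ : ∀ {a b} → len a ≡ len b → Yes (⟦ eqU ⟧ (a ∷ b ∷ []))
  eqU⁺ eq = and⁺ (leqU⁺ (≤-reflexive eq)) (leqU⁺ (≤-reflexive (sym eq)))

dropStep : Tree → Tree → Tree
dropStep _ a = cond (tail a) (tail (head a) ∙ tail (tail a)) a

iter-dropStep-nil : ∀ k l → iter dropStep k (l ∙ nil) ≡ l ∙ nil
iter-dropStep-nil nil     l = refl
iter-dropStep-nil (_ ∙ k) l = iter-dropStep-nil k l

iter-dropStep : ∀ k l i → len l ≤ len k → head (iter dropStep k (l ∙ i)) ≡ drop (len i) l
iter-dropStep nil nil i _ = sym (drop-nil (len i))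
iter-dropStep (x ∙ k) l nil _ = cong head (iter-dropStep-nil k l)
iter-dropStep (_ ∙ k) nil (_ ∙ i) _ = iter-dropStep k nil i z≤n
iter-dropStep (_ ∙ k) (_ ∙ l) (_ ∙ i) (s≤s l≤k) = iter-dropStep k l i l≤k

opaque
  -- The fold runs over the list and not over the index, so the index may be safe: the walk looks up
  -- vertices that are held in an accumulator.
  dropU : Tm 2
  dropU = hd (fold v0 (v0 ∙ v1) (if (tl v1) (tl (hd v1) ∙ tl (tl v1)) v1))

  dropU-spec : ∀ l i → ⟦ dropU ⟧ (l ∷ i ∷ []) ≡ drop (len i) l
  dropU-spec l i = iter-dropStep l l i ≤-refl

  nth : Tm 2
  nth = hd (call dropU (v0 ,, v1 ,, []))

  nth-spec : ∀ l i → ⟦ nth ⟧ (l ∷ i ∷ []) ≡ head (drop (len i) l)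
  nth-spec l i = cong head (dropU-spec l i)

head-drop-tabulate : ∀ {n} (f : Fin n → Tree) j → head (drop (toℕ j) (encodeTable f)) ≡ f j
head-drop-tabulate f zero    = refl
head-drop-tabulate f (suc j) = head-drop-tabulate (f ∘ suc) j

nth-table : ∀ {n} (f : Fin n → Tree) {i} j → len i ≡ toℕ j →
  ⟦ nth ⟧ (encodeTable f ∷ i ∷ []) ≡ f j
nth-table f {i} j eq =
  trans (nth-spec _ i) (trans (cong (λ n → head (drop n (encodeTable f))) eq) (head-drop-tabulate f j))

nth-nil : ∀ {i} → ⟦ nth ⟧ (nil ∷ i ∷ []) ≡ nil
nth-nil {i} = trans (nth-spec nil i) (cong head (drop-nil (len i)))

ctx# : ∀ {k} → Context k → ℕ
ctx# server    = 0
ctx# (cloud c) = suc (toℕ c)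

nth-context : ∀ {k} (f : Context k → Tree) {i} κ → len i ≡ ctx# κ →
  ⟦ nth ⟧ (encodeContextTable f ∷ i ∷ []) ≡ f κ
nth-context f {i} κ eq = trans (nth-spec _ i) (trans (cong (λ n → head (drop n (encodeContextTable f))) eq) (lemma κ))
  where
  lemma : ∀ κ → head (drop (ctx# κ) (encodeContextTable f)) ≡ f κ
  lemma server    = refl
  lemma (cloud c) = head-drop-tabulate (f ∘ cloud) c

unary : ℕ → Tree
unary zero    = nil
unary (suc n) = nil ∙ unary n

len-unary : ∀ n → len (unary n) ≡ n
len-unary zero    = refl
len-unary (suc n) = cong suc (len-unary n)

downFrom : ℕ → Tree
downFrom zero    = nil ∙ nil
downFrom (suc n) = unary (suc n) ∙ downFrom n

iter-downFrom : ∀ l n → iter (λ _ a → (nil ∙ head a) ∙ a) l (downFrom n) ≡ downFrom (len l + n)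
iter-downFrom nil     n = refl
iter-downFrom (_ ∙ l) zero = trans (iter-downFrom l 1) (cong downFrom (+-suc (len l) 0))
iter-downFrom (_ ∙ l) (suc n) = trans (iter-downFrom l (suc (suc n))) (cong downFrom (+-suc (len l) (suc n)))

opaque
  range : Tm 1
  range = fold v0 (nil ∙ nil) ((nil ∙ hd v1) ∙ v1)

  range-spec : ∀ l → ⟦ range ⟧ (l ∷ []) ≡ downFrom (len l)
  range-spec l = trans (iter-downFrom l 0) (cong downFrom (+-identityʳ (len l)))

∈-downFrom⁻ : ∀ {x} n → x ∈ downFrom n → len x ≤ n
∈-downFrom⁻ zero here = z≤n
∈-downFrom⁻ (suc n) here = ≤-reflexive (cong suc (len-unary n))
∈-downFrom⁻ (suc n) (there x∈) = m≤n⇒m≤1+n (∈-downFrom⁻ n x∈)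

∈-downFrom⁺ : ∀ {m} n → m ≤ n → unary m ∈ downFrom n
∈-downFrom⁺ {zero} zero _ = here
∈-downFrom⁺ {m} (suc n) m≤ with m≤n⇒m<n∨m≡n m≤
... | inj₁ (s≤s m≤n) = there (∈-downFrom⁺ n m≤n)
... | inj₂ refl = here

∈-range⁻ : ∀ {x} l → x ∈ ⟦ range ⟧ (l ∷ []) → len x ≤ len l
∈-range⁻ l x∈ = ∈-downFrom⁻ (len l) (subst (_ ∈_) (range-spec l) x∈)

∈-range⁺ : ∀ {m} l → m ≤ len l → unary m ∈ ⟦ range ⟧ (l ∷ [])
∈-range⁺ l m≤ = subst (_ ∈_) (sym (range-spec l)) (∈-downFrom⁺ (len l) m≤)

pairStep : Tree → Tree → Tree → Tree
pairStep x y a = (x ∙ y) ∙ a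

prodStep : Tree → Tree → Tree → Tree
prodStep ys x a = iter (pairStep x) ys a

pairs-keep : ∀ {z} x ys a → z ∈ a → z ∈ iter (pairStep x) ys a
pairs-keep x nil a z∈ = z∈
pairs-keep x (y ∙ ys) a z∈ = pairs-keep x ys _ (there z∈)

pairs⁺ : ∀ {x y} ys a → y ∈ ys → x ∙ y ∈ iter (pairStep x) ys a
pairs⁺ (y ∙ ys) a here = pairs-keep _ ys _ here
pairs⁺ (_ ∙ ys) a (there y∈) = pairs⁺ ys _ y∈

pairs⁻ : ∀ {z} x ys a → z ∈ iter (pairStep x) ys a → z ∈ a ⊎ ∃[ y ] (z ≡ x ∙ y × y ∈ ys)
pairs⁻ x nil a z∈ = inj₁ z∈
pairs⁻ x (y ∙ ys) a z∈ with pairs⁻ x ys _ z∈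
... | inj₁ here = inj₂ (y , refl , here)
... | inj₁ (there z∈a) = inj₁ z∈a
... | inj₂ (y′ , eq , y∈) = inj₂ (y′ , eq , there y∈)

prods-keep : ∀ {z} ys xs a → z ∈ a → z ∈ iter (prodStep ys) xs a
prods-keep ys nil a z∈ = z∈
prods-keep ys (x ∙ xs) a z∈ = prods-keep ys xs _ (pairs-keep x ys a z∈)

prods⁺ : ∀ {x y} ys xs a → x ∈ xs → y ∈ ys → x ∙ y ∈ iter (prodStep ys) xs a
prods⁺ ys (x ∙ xs) a here y∈ = prods-keep ys xs _ (pairs⁺ ys a y∈)
prods⁺ ys (_ ∙ xs) a (there x∈) y∈ = prods⁺ ys xs _ x∈ y∈

prods⁻ : ∀ {z} ys xs a → z ∈ iter (prodStep ys) xs a →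
  z ∈ a ⊎ ∃[ x ] ∃[ y ] (z ≡ x ∙ y × x ∈ xs × y ∈ ys)
prods⁻ ys nil a z∈ = inj₁ z∈
prods⁻ ys (x ∙ xs) a z∈ with prods⁻ ys xs _ z∈
... | inj₂ (x′ , y , eq , x∈ , y∈) = inj₂ (x′ , y , eq , there x∈ , y∈)
... | inj₁ z∈a with pairs⁻ x ys a z∈a
...   | inj₁ z∈a′ = inj₁ z∈a′
...   | inj₂ (y , eq , y∈) = inj₂ (x , y , eq , here , y∈)

opaque
  prod : Tm 2
  prod = fold v0 nil (fold v3 v1 ((v2 ∙ v0) ∙ v1))

  ∈-prod⁺ : ∀ {x y xs ys} → x ∈ xs → y ∈ ys → x ∙ y ∈ ⟦ prod ⟧ (xs ∷ ys ∷ [])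
  ∈-prod⁺ {xs = xs} {ys} = prods⁺ ys xs nil

  ∈-prod⁻ : ∀ {z xs ys} → z ∈ ⟦ prod ⟧ (xs ∷ ys ∷ []) → ∃[ x ] ∃[ y ] (z ≡ x ∙ y × x ∈ xs × y ∈ ys)
  ∈-prod⁻ {xs = xs} {ys} z∈ with prods⁻ ys xs nil z∈
  ... | inj₂ p = p

opaque
  reverse : Tm 1
  reverse = fold v0 nil (v0 ∙ v1)

  -- The first list arrives reversed; only the length of the result is ever used.
  append : Tm 2
  append = fold v0 v1 (v0 ∙ v1)

revOnto : Tree → Tree → Tree
revOnto = iter _∙_

opaque
  unfolding reverse append

  reverse-spec : ∀ l → ⟦ reverse ⟧ (l ∷ []) ≡ revOnto l nil
  reverse-spec l = refl

  append-spec : ∀ a b → ⟦ append ⟧ (a ∷ b ∷ []) ≡ revOnto a b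
  append-spec a b = refl

len-revOnto : ∀ a b → len (revOnto a b) ≡ len a + len b
len-revOnto nil     b = refl
len-revOnto (x ∙ a) b = trans (len-revOnto a (x ∙ b)) (+-suc (len a) (len b))

∈-revOnto⁺ʳ : ∀ {x} a b → x ∈ b → x ∈ revOnto a b
∈-revOnto⁺ʳ nil     b x∈ = x∈
∈-revOnto⁺ʳ (y ∙ a) b x∈ = ∈-revOnto⁺ʳ a (y ∙ b) (there x∈)

∈-revOnto⁺ˡ : ∀ {x} a b → x ∈ a → x ∈ revOnto a b
∈-revOnto⁺ˡ (x ∙ a) b here = ∈-revOnto⁺ʳ a (x ∙ b) here
∈-revOnto⁺ˡ (y ∙ a) b (there x∈) = ∈-revOnto⁺ˡ a (y ∙ b) x∈

∈-revOnto⁻ : ∀ {x} a b → x ∈ revOnto a b → x ∈ a ⊎ x ∈ b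
∈-revOnto⁻ nil b x∈ = inj₂ x∈
∈-revOnto⁻ (y ∙ a) b x∈ with ∈-revOnto⁻ a (y ∙ b) x∈
... | inj₁ x∈a = inj₁ (there x∈a)
... | inj₂ here = inj₁ here
... | inj₂ (there x∈b) = inj₂ x∈b

-- Bijective binary numbers

doubleStep : Tree → Tree → Tree
doubleStep _ a = cond (head a) (tail (head a) ∙ (nil ∙ (nil ∙ tail a))) a

iter-doubleStep : ∀ k r o → len (tail (iter doubleStep k (r ∙ o))) ≡ len o + 2 * (len r ⊓ len k)
iter-doubleStep nil r o rewrite ⊓-zeroʳ (len r) = sym (+-identityʳ (len o))
iter-doubleStep (_ ∙ k) nil o = iter-doubleStep k nil o
iter-doubleStep (_ ∙ k) (_ ∙ r) o = trans (iter-doubleStep k r (nil ∙ (nil ∙ o))) (lemma (len o) (len r ⊓ len k))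
  where
  lemma : ∀ m n → suc (suc m) + 2 * n ≡ m + 2 * suc n
  lemma = solve-∀

opaque
  -- Twice the minimum of the lengths, which keeps repeated doubling polynomial.
  double : Tm 2
  double = tl (fold v0 (v1 ∙ nil) (if (hd v1) (tl (hd v1) ∙ (nil ∙ (nil ∙ tl v1))) v1))

  double-spec : ∀ F r → len (⟦ double ⟧ (F ∷ r ∷ [])) ≡ 2 * (len r ⊓ len F)
  double-spec F r = iter-doubleStep F r nil

hornerStep : Tree → Tree → Tree → Tree
hornerStep F d a = cond d (nil ∙ ⟦ double ⟧ (F ∷ a ∷ [])) (nil ∙ (nil ∙ ⟦ double ⟧ (F ∷ a ∷ [])))

msbValue : ℕ → Tree → ℕ
msbValue a nil      = a
msbValue a (d ∙ ds) = msbValue (digit d + 2 * a) ds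

hornerStep-spec : ∀ F d a → len (hornerStep F d a) ≡ digit d + 2 * (len a ⊓ len F)
hornerStep-spec F nil     a = cong (2 +_) (double-spec F a)
hornerStep-spec F (_ ∙ _) a = cong suc (double-spec F a)

1≤digit : ∀ d → 1 ≤ digit d
1≤digit nil     = s≤s z≤n
1≤digit (_ ∙ _) = s≤s z≤n

-- Truncation has to be recognisable from the result alone, since a program that reads a long number
-- never sees its exact value in unary.
record Capped (F r a : ℕ) : Set where
  constructor capped
  field
    below : r ≤ a
    exact : r ≤ F → r ≡ a

-- A prefix above `F` is cut to `F`, and twice `F` plus a positive digit is above `F` again, so an
-- overflow is never forgotten.
capped-step : ∀ {F r a} d → Capped F r a → Capped F (digit d + 2 * (r ⊓ F)) (digit d + 2 * a)
capped-step {F} {r} {a} d (capped below exact) =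
  capped (+-monoʳ-≤ (digit d) (*-monoʳ-≤ 2 (≤-trans (m⊓n≤m r F) below))) exact′
  where
  exact′ : digit d + 2 * (r ⊓ F) ≤ F → digit d + 2 * (r ⊓ F) ≡ digit d + 2 * a
  exact′ le with ≤-total r F
  ... | inj₁ r≤F = cong (λ m → digit d + 2 * m) (trans (m≤n⇒m⊓n≡m r≤F) (exact r≤F))
  ... | inj₂ F≤r rewrite m≥n⇒m⊓n≡n F≤r =
    ⊥-elim (<-irrefl refl (≤-trans (+-mono-≤ (1≤digit d) (m≤m+n F (F + 0))) le))

iter-horner : ∀ F ds {a} {n} → Capped (len F) (len a) n →
  Capped (len F) (len (iter (hornerStep F) ds a)) (msbValue n ds)
iter-horner F nil c = c
iter-horner F (d ∙ ds) {a} {n} c =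
  iter-horner F ds (subst (λ m → Capped (len F) m (digit d + 2 * n)) (sym (hornerStep-spec F d a)) (capped-step d c))

msbValue-revOnto : ∀ t ds → msbValue 0 (revOnto t ds) ≡ msbValue (bval t) ds
msbValue-revOnto nil     ds = refl
msbValue-revOnto (d ∙ t) ds = msbValue-revOnto t (d ∙ ds)

opaque
  toUnary : Tm 2
  toUnary = fold (call reverse (v1 ,, [])) nil
    (if v0 (nil ∙ call double (v2 ,, v1 ,, [])) (nil ∙ (nil ∙ call double (v2 ,, v1 ,, []))))

  toUnary-spec : ∀ F t → Capped (len F) (len (⟦ toUnary ⟧ (F ∷ t ∷ []))) (bval t)
  toUnary-spec F t rewrite reverse-spec t =
    subst (Capped (len F) _) (msbValue-revOnto t nil)
      (iter-horner F (revOnto t nil) {nil} (capped z≤n (λ _ → refl)))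

-- Rounding by dropping low digits

bval-tail : ∀ t → 2 * bval (tail t) ≤ bval t × bval t ≤ 2 * bval (tail t) + 2
bval-tail nil           = z≤n , z≤n
bval-tail (nil ∙ t)     = m≤n+m _ 2 , ≤-reflexive (+-comm 2 _)
bval-tail ((_ ∙ _) ∙ t) = m≤n+m _ 1 , ≤-trans (≤-reflexive (+-comm 1 _)) (+-monoʳ-≤ _ (s≤s z≤n))

-- A dropped digit is at most 2, so the value plus 2 is at most doubled when the digit is put back.
-- In this shifted form the upper bound multiplies through, and the shift 2 becomes the rounding
-- error.
bval-drop : ∀ e t → 2 ^ e * bval (drop e t) ≤ bval t × bval t + 2 ≤ 2 ^ e * (bval (drop e t) + 2)
bval-drop zero t = ≤-reflexive (+-identityʳ _) , ≤-reflexive (sym (+-identityʳ _))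
bval-drop (suc e) t with lo , hi ← bval-drop e (tail t) with lo′ , hi′ ← bval-tail t =
  (begin
    2 ^ suc e * b        ≡⟨ *-assoc 2 (2 ^ e) b ⟩
    2 * (2 ^ e * b)      ≤⟨ *-monoʳ-≤ 2 lo ⟩
    2 * bval (tail t)    ≤⟨ lo′ ⟩
    bval t               ∎) ,
  (begin
    bval t + 2                  ≤⟨ +-monoˡ-≤ 2 hi′ ⟩
    2 * bval (tail t) + 2 + 2   ≡⟨ lemma (bval (tail t)) ⟩
    2 * (bval (tail t) + 2)     ≤⟨ *-monoʳ-≤ 2 hi ⟩
    2 * (2 ^ e * (b + 2))       ≡⟨ *-assoc 2 (2 ^ e) (b + 2) ⟨
    2 ^ suc e * (b + 2)         ∎)
  where
  open ≤-Reasoning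
  b = bval (drop e (tail t))
  lemma : ∀ n → 2 * n + 2 + 2 ≡ 2 * (n + 2)
  lemma = solve-∀

-- The rounding error in units; at scale 0 rounding is exact.
slack : ℕ → ℕ
slack zero    = 0
slack (suc _) = 2

opaque
  round : Tm 3
  round = if v0 (nil ∙ (nil ∙ D)) D
   where
    D : Tm 3
    D = call toUnary (v1 ,, call dropU (v2 ,, v0 ,, []) ,, [])

  round-len : ∀ e F t → len (⟦ round ⟧ (e ∷ F ∷ t ∷ [])) ≡
    slack (len e) + len (⟦ toUnary ⟧ (F ∷ drop (len e) t ∷ []))
  round-len nil     F t rewrite dropU-spec t nil = refl
  round-len (x ∙ e) F t rewrite dropU-spec t (x ∙ e) = refl

round-upper : ∀ e F t → let u = 2 ^ len e in
  u * len (⟦ round ⟧ (e ∷ F ∷ t ∷ [])) ≤ bval t + u * slack (len e)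
round-upper e F t rewrite round-len e F t = begin
  u * (slack (len e) + r)     ≡⟨ cong (u *_) (+-comm (slack (len e)) r) ⟩
  u * (r + slack (len e))     ≡⟨ *-distribˡ-+ u r (slack (len e)) ⟩
  u * r + u * slack (len e)   ≤⟨ +-monoˡ-≤ _ (*-monoʳ-≤ u (Capped.below (toUnary-spec F (drop (len e) t)))) ⟩
  u * bval (drop (len e) t) + u * slack (len e) ≤⟨ +-monoˡ-≤ _ (proj₁ (bval-drop (len e) t)) ⟩
  bval t + u * slack (len e)  ∎
  where
  open ≤-Reasoning
  u = 2 ^ len e
  r = len (⟦ toUnary ⟧ (F ∷ drop (len e) t ∷ []))

round-lower : ∀ e F t → len (⟦ round ⟧ (e ∷ F ∷ t ∷ [])) ≤ len F →
  bval t ≤ 2 ^ len e * len (⟦ round ⟧ (e ∷ F ∷ t ∷ []))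
round-lower e F t r≤F rewrite round-len e F t
  with c ← toUnary-spec F (drop (len e) t)
  rewrite Capped.exact c (≤-trans (m≤n+m _ (slack (len e))) r≤F) with e
... | nil = ≤-reflexive (sym (+-identityʳ _))
... | x ∙ e′ = ≤-trans (m≤m+n _ 2) (≤-trans (proj₂ (bval-drop (len (x ∙ e′)) t))
        (≤-reflexive (cong (2 ^ len (x ∙ e′) *_) (+-comm _ 2))))

bval-encodeℕᵇ : ∀ b → bval (encodeℕᵇ b) ≡ toℕᵇ b
bval-encodeℕᵇ zeroᵇ     = refl
bval-encodeℕᵇ 2[1+ b ] rewrite bval-encodeℕᵇ b = sym (*-suc 2 (toℕᵇ b))
bval-encodeℕᵇ 1+[2 b ] rewrite bval-encodeℕᵇ b = refl

bval-encodeℕ : ∀ n → bval (encodeℕ n) ≡ n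
bval-encodeℕ n = trans (bval-encodeℕᵇ (toBinary n)) (Binary.toℕ-fromℕ n)

toBinary-odd : ∀ n → toBinary (1 + 2 * n) ≡ 1+[2 toBinary n ]
toBinary-odd n = Binary.toℕ-injective (trans (Binary.toℕ-fromℕ _)
  (cong (λ m → 1 + 2 * m) (sym (Binary.toℕ-fromℕ n))))

toBinary-even : ∀ n → toBinary (2 + 2 * n) ≡ 2[1+ toBinary n ]
toBinary-even n = Binary.toℕ-injective (trans (Binary.toℕ-fromℕ _)
  (trans (cong suc (sym (+-suc n (n + 0)))) (cong (λ m → 2 * suc m) (sym (Binary.toℕ-fromℕ n)))))

-- From unary numbers to binary digits

halfStep : Tree → Tree → Tree
halfStep _ a = cond (tail (tail (tail a))) ((nil ∙ head a) ∙ tail (tail (tail a))) a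

-- The remainder of the halving is 1 or 2, since bijective notation has no digit zero.
record Split (n : ℕ) (s : Tree) : Set where
  constructor split
  field
    total : n ≡ len (tail s) + 2 * len (head s)
    pos   : 1 ≤ len (tail s)
    small : len (tail s) ≤ 2

iter-halfStep-done : ∀ k h x y → let r = x ∙ y in len r ≤ 2 → iter halfStep k (h ∙ r) ≡ h ∙ r
iter-halfStep-done nil h x y _ = refl
iter-halfStep-done (_ ∙ k) h x nil le = iter-halfStep-done k h x nil le
iter-halfStep-done (_ ∙ k) h x (z ∙ nil) le = iter-halfStep-done k h x (z ∙ nil) le
iter-halfStep-done (_ ∙ k) h x (z ∙ (w ∙ y)) (s≤s (s≤s ()))

iter-halfStep : ∀ k h x y → let r = x ∙ y in len r ≤ 2 + len k →
  Split (len r + 2 * len h) (iter halfStep k (h ∙ r))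
iter-halfStep nil h x y le = split refl (s≤s z≤n) le
iter-halfStep k@(_ ∙ _) h x nil le rewrite iter-halfStep-done k h x nil (s≤s z≤n) = split refl (s≤s z≤n) (s≤s z≤n)
iter-halfStep k@(_ ∙ _) h x (z ∙ nil) le rewrite iter-halfStep-done k h x (z ∙ nil) ≤-refl = split refl (s≤s z≤n) ≤-refl
iter-halfStep (_ ∙ k) h x (z ∙ (w ∙ y)) (s≤s (s≤s le)) =
  subst (λ n → Split n (iter halfStep k ((nil ∙ h) ∙ (w ∙ y)))) (lemma (len y) (len h))
    (iter-halfStep k (nil ∙ h) w y (m≤n⇒m≤1+n le))
  where
  lemma : ∀ m n → suc m + 2 * suc n ≡ suc (suc (suc m)) + 2 * n
  lemma = solve-∀

opaque
  half : Tm 2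
  half = fold v0 (nil ∙ v1) (if (tl (tl (tl v1))) ((nil ∙ hd v1) ∙ tl (tl (tl v1))) v1)

  half-spec : ∀ F x y → let r = x ∙ y in len r ≤ 2 + len F → Split (len r) (⟦ half ⟧ (F ∷ r ∷ []))
  half-spec F x y le =
    subst (λ n → Split n (⟦ half ⟧ (F ∷ (x ∙ y) ∷ []))) (+-identityʳ _) (iter-halfStep F nil x y le)

digitOf : Tree → Tree
digitOf r = cond (tail r) nil (nil ∙ nil)

split-positive : ∀ {n s} → Split n s → len (head s) < n
split-positive {s = s} (split refl pos small) = ≤-trans (≤-reflexive (+-comm 1 _))
  (≤-trans (+-mono-≤ (m≤m+n (len (head s)) _) pos) (≤-reflexive (+-comm (2 * len (head s)) _)))

encodeℕ-split : ∀ {n s} → Split n s → encodeℕ n ≡ digitOf (tail s) ∙ encodeℕ (len (head s))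
encodeℕ-split {s = h ∙ (_ ∙ nil)} (split refl pos small) = cong encodeℕᵇ (toBinary-odd (len h))
encodeℕ-split {s = h ∙ (_ ∙ (_ ∙ nil))} (split refl pos small) = cong encodeℕᵇ (toBinary-even (len h))
encodeℕ-split {s = nil} (split refl () small)
encodeℕ-split {s = h ∙ nil} (split refl () small)
encodeℕ-split {s = h ∙ (_ ∙ (_ ∙ (_ ∙ _)))} (split refl pos (s≤s (s≤s ())))

digitsStep : Tree → Tree → Tree → Tree
digitsStep F _ a = cond (head a)
  (head (⟦ half ⟧ (F ∷ head a ∷ [])) ∙ (digitOf (tail (⟦ half ⟧ (F ∷ head a ∷ []))) ∙ tail a)) a

iter-digitsStep : ∀ F k r o → len r ≤ len k → len r ≤ len F →
  revOnto (tail (iter (digitsStep F) k (r ∙ o))) nil ≡ revOnto o (encodeℕ (len r))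
iter-digitsStep F nil nil o _ _ = refl
iter-digitsStep F (_ ∙ k) nil o _ _ = iter-digitsStep F k nil o z≤n z≤n
iter-digitsStep F (_ ∙ k) r@(x ∙ y) o r≤k r≤F = trans
  (iter-digitsStep F k (head s) (digitOf (tail s) ∙ o)
    (≤-pred (≤-trans (split-positive s-split) r≤k)) (≤-trans (<⇒≤ (split-positive s-split)) r≤F))
  (cong (revOnto o) (sym (encodeℕ-split s-split)))
  where
  s = ⟦ half ⟧ (F ∷ r ∷ [])
  s-split = half-spec F x y (≤-trans r≤F (m≤n+m _ 2))

opaque
  toDigits : Tm 1
  toDigits = call reverse (tl (fold v0 (v0 ∙ nil)
    (if (hd v1)
        (bind (call half (v2 ,, hd v1 ,, []))
              (hd v0 ∙ (if (tl (tl v0)) nil (nil ∙ nil) ∙ tl v2)))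
        v1)) ,, [])

  -- An equality of trees and not just of values: the output has to be literally the encoding of a
  -- schedule.
  toDigits-spec : ∀ v → ⟦ toDigits ⟧ (v ∷ []) ≡ encodeℕ (len v)
  toDigits-spec v = trans (reverse-spec _) (iter-digitsStep v v v nil ≤-refl ≤-refl)

digits< : ∀ t → bval t + 2 ≤ 2 ^ suc (len t)
digits< nil     = ≤-refl
digits< (d ∙ t) = begin
  digit d + 2 * bval t + 2   ≤⟨ +-monoˡ-≤ 2 (+-monoˡ-≤ (2 * bval t) (digit≤2 d)) ⟩
  2 + 2 * bval t + 2         ≡⟨ lemma (bval t) ⟩
  2 * (bval t + 2)           ≤⟨ *-monoʳ-≤ 2 (digits< t) ⟩
  2 ^ suc (len (d ∙ t))      ∎
  where
  open ≤-Reasoning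
  lemma : ∀ n → 2 + 2 * n + 2 ≡ 2 * (n + 2)
  lemma = solve-∀
  digit≤2 : ∀ d → digit d ≤ 2
  digit≤2 nil     = ≤-refl
  digit≤2 (_ ∙ _) = s≤s z≤n

-- Addition of binary numbers

lowDigit : Tree → ℕ
lowDigit nil     = 0
lowDigit (d ∙ _) = digit d

lowDigit≤2 : ∀ t → lowDigit t ≤ 2
lowDigit≤2 nil           = z≤n
lowDigit≤2 (nil ∙ _)     = ≤-refl
lowDigit≤2 ((_ ∙ _) ∙ _) = s≤s z≤n

bval-lowDigit : ∀ t → bval t ≡ lowDigit t + 2 * bval (tail t)
bval-lowDigit nil     = refl
bval-lowDigit (d ∙ t) = refl

lowDigit-zero : ∀ t → lowDigit t ≡ 0 → bval t ≡ 0
lowDigit-zero nil _ = refl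
lowDigit-zero (nil ∙ t) ()
lowDigit-zero ((_ ∙ _) ∙ t) ()

addDigit : Tree → Tree → Tree
addDigit t s = cond t (cond (head t) (nil ∙ s) (nil ∙ (nil ∙ s))) s

len-addDigit : ∀ t s → len (addDigit t s) ≡ lowDigit t + len s
len-addDigit nil           s = refl
len-addDigit (nil ∙ _)     s = refl
len-addDigit ((_ ∙ _) ∙ _) s = refl

carry : Tree → Tree
carry s = cond (tail (tail (tail (tail s)))) ((nil ∙ (nil ∙ nil)) ∙ tail (tail (tail (tail s))))
  (cond (tail (tail s)) ((nil ∙ nil) ∙ tail (tail s)) (nil ∙ s))

-- Two digits and a carry, each at most 2, add up to at most 6 = 2 + 2 · 2, so the new carry is at
-- most 2 again.
carry-split : ∀ s → Yes s → len s ≤ 6 → Split (len s) (carry s) × len (head (carry s)) ≤ 2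
carry-split (_ ∙ nil) _ _ = split refl ≤-refl (s≤s z≤n) , z≤n
carry-split (_ ∙ (_ ∙ nil)) _ _ = split refl (s≤s z≤n) ≤-refl , z≤n
carry-split (_ ∙ (_ ∙ (_ ∙ nil))) _ _ = split refl ≤-refl (s≤s z≤n) , s≤s z≤n
carry-split (_ ∙ (_ ∙ (_ ∙ (_ ∙ nil)))) _ _ = split refl (s≤s z≤n) ≤-refl , s≤s z≤n
carry-split (_ ∙ (_ ∙ (_ ∙ (_ ∙ (_ ∙ nil))))) _ _ = split refl ≤-refl (s≤s z≤n) , ≤-refl
carry-split (_ ∙ (_ ∙ (_ ∙ (_ ∙ (_ ∙ (_ ∙ nil)))))) _ _ = split refl (s≤s z≤n) ≤-refl , ≤-refl
carry-split (_ ∙ (_ ∙ (_ ∙ (_ ∙ (_ ∙ (_ ∙ (_ ∙ _))))))) _ (s≤s (s≤s (s≤s (s≤s (s≤s (s≤s ()))))))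

digit-digitOf : ∀ r → 1 ≤ len r → len r ≤ 2 → digit (digitOf r) ≡ len r
digit-digitOf (_ ∙ nil) _ _ = refl
digit-digitOf (_ ∙ (_ ∙ nil)) _ _ = refl
digit-digitOf (_ ∙ (_ ∙ (_ ∙ _))) _ (s≤s (s≤s ()))

addSum : Tree → Tree
addSum a = addDigit (head a) (addDigit (head (tail a)) (head (tail (tail a))))

addStep : Tree → Tree → Tree
addStep _ a = cond (addSum a)
  (tail (head a) ∙ (tail (head (tail a)) ∙ (head (carry (addSum a)) ∙
    (digitOf (tail (carry (addSum a))) ∙ tail (tail (tail a)))))) a

-- The value of the digits o, lowest digit last, in front of a number x.
prefixed : Tree → ℕ → ℕ
prefixed nil     x = x
prefixed (d ∙ o) x = prefixed o (digit d + 2 * x)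

column : Tree → Tree → Tree → ℕ
column a w c = lowDigit a + (lowDigit w + len c)

-- There is no digit zero, so an empty column means that both numbers and the carry are exhausted.
column-zero : ∀ a w c → column a w c ≡ 0 → bval a + bval w + len c ≡ 0
column-zero a w c eq
  rewrite lowDigit-zero a (m+n≡0⇒m≡0 _ eq)
        | lowDigit-zero w (m+n≡0⇒m≡0 _ (m+n≡0⇒n≡0 (lowDigit a) eq)) =
  m+n≡0⇒n≡0 (lowDigit w) (m+n≡0⇒n≡0 (lowDigit a) eq)

column-split : ∀ a w c {s} → Split (column a w c) s →
  bval a + bval w + len c ≡
    len (tail s) + 2 * (bval (tail a) + bval (tail w) + len (head s))
column-split a w c {s} sp = begin
  bval a + bval w + len c
    ≡⟨ cong₂ (λ m n → m + n + len c) (bval-lowDigit a) (bval-lowDigit w) ⟩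
  (lowDigit a + 2 * bval (tail a)) + (lowDigit w + 2 * bval (tail w)) + len c
    ≡⟨ lemma₁ (lowDigit a) (bval (tail a)) (lowDigit w) (bval (tail w)) (len c) ⟩
  column a w c + 2 * (bval (tail a) + bval (tail w))
    ≡⟨ cong (_+ 2 * (bval (tail a) + bval (tail w))) (Split.total sp) ⟩
  (len (tail s) + 2 * len (head s)) + 2 * (bval (tail a) + bval (tail w))
    ≡⟨ lemma₂ (len (tail s)) (len (head s)) (bval (tail a) + bval (tail w)) ⟩
  len (tail s) + 2 * (bval (tail a) + bval (tail w) + len (head s)) ∎
  where
  open ≡-Reasoning
  lemma₁ : ∀ d m e n c → (d + 2 * m) + (e + 2 * n) + c ≡ (d + (e + c)) + 2 * (m + n)
  lemma₁ = solve-∀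
  lemma₂ : ∀ r h m → (r + 2 * h) + 2 * m ≡ r + 2 * (m + h)
  lemma₂ = solve-∀

-- Each column at least halves what remains to be added, so the fuel lasts until nothing remains.
iter-addStep : ∀ F a w c o → len c ≤ 2 → bval a + bval w + len c < 2 ^ len F →
  let o′ = tail (tail (tail (iter addStep F (a ∙ (w ∙ (c ∙ o)))))) in
  prefixed o′ 0 ≡ prefixed o (bval a + bval w + len c) × len o′ ≤ len o + len F
iter-addStep nil a w c o c≤2 lt rewrite n<1⇒n≡0 lt = refl , m≤m+n _ 0
iter-addStep (x ∙ F) a w c o c≤2 lt
  with addSum (a ∙ (w ∙ (c ∙ o))) | trans (len-addDigit a (addDigit w c)) (cong (lowDigit a +_) (len-addDigit w c))
... | nil | sum
  with p , q ← iter-addStep F a w c o c≤2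
         (subst (_< 2 ^ len F) (sym (column-zero a w c (sym sum))) (m^n>0 2 (len F))) =
  p , ≤-trans q (+-monoʳ-≤ (len o) (n≤1+n (len F)))
... | s@(_ ∙ _) | sum
  with sp , h≤2 ← carry-split s tt (≤-trans (≤-reflexive sum)
                    (+-mono-≤ (lowDigit≤2 a) (+-mono-≤ (lowDigit≤2 w) c≤2)))
  with total ← column-split a w c (subst (λ n → Split n (carry s)) sum sp)
  with p , q ← iter-addStep F (tail a) (tail w) (head (carry s)) (digitOf (tail (carry s)) ∙ o) h≤2
         (*-cancelˡ-< 2 _ (2 ^ len F) (≤-trans
           (s≤s (≤-trans (m≤n+m _ (len (tail (carry s)))) (≤-reflexive (sym total)))) lt)) =
  trans p (cong (prefixed o) (trans
    (cong (_+ 2 * (bval (tail a) + bval (tail w) + len (head (carry s)))) (digit-digitOf (tail (carry s)) (Split.pos sp) (Split.small sp)))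
    (sym total))) ,
  ≤-trans q (≤-reflexive (sym (+-suc (len o) (len F))))

revStep : Tree → Tree → Tree
revStep _ a = cond (head a) (tail (head a) ∙ (head (head a) ∙ tail a)) a

iter-revStep : ∀ F o r → len o ≤ len F → bval (tail (iter revStep F (o ∙ r))) ≡ prefixed o (bval r)
iter-revStep nil nil r _ = refl
iter-revStep (_ ∙ F) nil r _ = iter-revStep F nil r z≤n
iter-revStep (_ ∙ F) (d ∙ o) r (s≤s le) = iter-revStep F o (d ∙ r) le

addDigitTm : ∀ {n} → Tm n → Tm n → Tm n
addDigitTm t s = if t (if (hd t) (nil ∙ s) (nil ∙ (nil ∙ s))) s

opaque
  -- Costs come out of the accumulator of the dynamic program and are therefore safe. The fuel `F`
  -- drives both loops, the addition and the reversal of the digits that it produces.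
  addB : Tm 3
  addB = bind
    (tl (tl (tl (fold v0 (v1 ∙ (v2 ∙ (nil ∙ nil)))
      (bind (addDigitTm (hd v1) (addDigitTm (hd (tl v1)) (hd (tl (tl v1)))))
        (if v0
            (bind (if (tl (tl (tl (tl v0)))) ((nil ∙ (nil ∙ nil)) ∙ tl (tl (tl (tl v0))))
                      (if (tl (tl v0)) ((nil ∙ nil) ∙ tl (tl v0)) (nil ∙ v0)))
              (tl (hd v3) ∙ (tl (hd (tl v3)) ∙ (hd v0 ∙
                (if (tl (tl v0)) nil (nil ∙ nil) ∙ tl (tl (tl v3)))))))
            v2))))))
    (tl (fold v1 (v0 ∙ nil) (if (hd v1) (tl (hd v1) ∙ (hd (hd v1) ∙ tl v1)) v1)))

  addB-spec : ∀ F a w → bval a + bval w < 2 ^ len F →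
    bval (⟦ addB ⟧ (F ∷ a ∷ w ∷ [])) ≡ bval a + bval w
  addB-spec F a w lt
    with p , q ← iter-addStep F a w nil nil z≤n (subst (_< 2 ^ len F) (sym (+-identityʳ _)) lt) =
    trans (iter-revStep F _ nil q) (trans p (+-identityʳ _))

-- Comparison of binary numbers

compareStep : Tree → Tree → Tree
compareStep _ a = tail (head a) ∙ (tail (head (tail a)) ∙
  cond (head a)
    (cond (head (head a))
      (cond (head (tail a)) (cond (head (head (tail a))) (tail (tail a)) (nil ∙ nil)) nil)
      (cond (head (tail a)) (cond (head (head (tail a))) nil (tail (tail a))) nil))
    (cond (head (tail a)) (nil ∙ nil) (tail (tail a))))

-- Digits are compared from the lowest to the highest; r records the result
-- for the digits seen so far.
Below : Tree → ℕ → ℕ → Set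
Below r m n = m < n ⊎ (m ≡ n × Yes r)

data Compared (r : Tree) : ℕ → ℕ → Tree → Set where
  less    : ∀ {d e r′} → d < e → Yes r′ → Compared r d e r′
  equal   : ∀ {d} → Compared r d d r
  greater : ∀ {d e} → e < d → Compared r d e nil

compared : ∀ a w r → Compared r (lowDigit a) (lowDigit w) (tail (tail (compareStep nil (a ∙ (w ∙ r)))))
compared nil           nil           r = equal
compared nil           (nil ∙ w)     r = less (s≤s z≤n) tt
compared nil           ((_ ∙ _) ∙ w) r = less (s≤s z≤n) tt
compared (nil ∙ a)     nil           r = greater (s≤s z≤n)
compared (nil ∙ a)     (nil ∙ w)     r = equal
compared (nil ∙ a)     ((_ ∙ _) ∙ w) r = greater (s≤s (s≤s z≤n))
compared ((_ ∙ _) ∙ a) nil           r = greater (s≤s z≤n)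
compared ((_ ∙ _) ∙ a) (nil ∙ w)     r = less (s≤s (s≤s z≤n)) tt
compared ((_ ∙ _) ∙ a) ((_ ∙ _) ∙ w) r = equal

-- A low digit is worth at most 2 and so is one step of the higher part; the low digit of the larger
-- number, at least 1, makes the inequality strict.
high<⇒< : ∀ a w → bval (tail a) < bval (tail w) → bval a < bval w
high<⇒< a nil ()
high<⇒< a (d ∙ w) lt = begin-strict
  bval a                              ≡⟨ bval-lowDigit a ⟩
  lowDigit a + 2 * bval (tail a)      ≤⟨ +-monoˡ-≤ _ (lowDigit≤2 a) ⟩
  2 + 2 * bval (tail a)               ≡⟨ *-suc 2 (bval (tail a)) ⟨
  2 * suc (bval (tail a))             ≤⟨ *-monoʳ-≤ 2 lt ⟩
  2 * bval w                          <⟨ +-monoˡ-≤ (2 * bval w) (1≤digit d) ⟩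
  digit d + 2 * bval w                ∎
  where open ≤-Reasoning

below-step⁺ : ∀ {r r′} a w → Compared r (lowDigit a) (lowDigit w) r′ →
  Below r′ (bval (tail a)) (bval (tail w)) → Below r (bval a) (bval w)
below-step⁺ a w c (inj₁ lt) = inj₁ (high<⇒< a w lt)
below-step⁺ {r} {r′} a w c (inj₂ (same , y)) rewrite bval-lowDigit a | bval-lowDigit w | same = lemma (bval (tail w)) c y
  where
  lemma : ∀ {m n r′} k → Compared r m n r′ → Yes r′ → Below r (m + 2 * k) (n + 2 * k)
  lemma k (less m<n _) y = inj₁ (+-monoˡ-< (2 * k) m<n)
  lemma k equal y = inj₂ (refl , y)

below-step⁻ : ∀ {r r′} a w → Compared r (lowDigit a) (lowDigit w) r′ →
  Below r (bval a) (bval w) → Below r′ (bval (tail a)) (bval (tail w))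
below-step⁻ {r} {r′} a w c b with <-cmp (bval (tail a)) (bval (tail w))
... | tri< lt _ _ = inj₁ lt
... | tri> _ _ gt with b
...   | inj₁ lt = ⊥-elim (<-asym lt (high<⇒< w a gt))
...   | inj₂ (same , _) = ⊥-elim (<-irrefl (sym same) (high<⇒< w a gt))
below-step⁻ {r} {r′} a w c b | tri≈ _ same _ = inj₂ (same , lemma (bval (tail a)) c (subst₂ (Below r)
    (bval-lowDigit a) (trans (bval-lowDigit w) (cong (λ n → lowDigit w + 2 * n) (sym same))) b))
  where
  lemma : ∀ {m n r′} k → Compared r m n r′ → Below r (m + 2 * k) (n + 2 * k) → Yes r′
  lemma k (less _ y) b = y
  lemma k equal (inj₁ m<m) = ⊥-elim (<-irrefl refl m<m)
  lemma k equal (inj₂ (_ , y)) = y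
  lemma k (greater n<m) (inj₁ m<n) = ⊥-elim (<-asym m<n (+-monoˡ-< (2 * k) n<m))
  lemma k (greater n<m) (inj₂ (same , _)) = ⊥-elim (<-irrefl (sym same) (+-monoˡ-< (2 * k) n<m))

half< : ∀ t n → bval t < 2 ^ suc n → bval (tail t) < 2 ^ n
half< t n lt = *-cancelˡ-< 2 (bval (tail t)) (2 ^ n) (≤-trans (s≤s (proj₁ (bval-tail t))) lt)

iter-compareStep⁻ : ∀ F a w r → bval a < 2 ^ len F → bval w < 2 ^ len F →
  Yes (tail (tail (iter compareStep F (a ∙ (w ∙ r))))) → Below r (bval a) (bval w)
iter-compareStep⁻ nil a w r a< w< y = inj₂ (trans (n<1⇒n≡0 a<) (sym (n<1⇒n≡0 w<)) , y)
iter-compareStep⁻ (_ ∙ F) a w r a< w< y = below-step⁺ a w (compared a w r)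
  (iter-compareStep⁻ F (tail a) (tail w) _ (half< a (len F) a<) (half< w (len F) w<) y)

iter-compareStep⁺ : ∀ F a w r → bval a < 2 ^ len F → bval w < 2 ^ len F →
  Below r (bval a) (bval w) → Yes (tail (tail (iter compareStep F (a ∙ (w ∙ r)))))
iter-compareStep⁺ nil a w r a< w< (inj₁ lt) rewrite n<1⇒n≡0 a< | n<1⇒n≡0 w< = ⊥-elim (<-irrefl refl lt)
iter-compareStep⁺ nil a w r a< w< (inj₂ (_ , y)) = y
iter-compareStep⁺ (_ ∙ F) a w r a< w< b =
  iter-compareStep⁺ F (tail a) (tail w) _ (half< a (len F) a<) (half< w (len F) w<)
    (below-step⁻ a w (compared a w r) b)

opaque
  leqB : Tm 3
  leqB = tl (tl (fold v0 (v1 ∙ (v2 ∙ (nil ∙ nil)))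
    (tl (hd v1) ∙ (tl (hd (tl v1)) ∙
      if (hd v1)
        (if (hd (hd v1))
          (if (hd (tl v1)) (if (hd (hd (tl v1))) (tl (tl v1)) (nil ∙ nil)) nil)
          (if (hd (tl v1)) (if (hd (hd (tl v1))) nil (tl (tl v1))) nil))
        (if (hd (tl v1)) (nil ∙ nil) (tl (tl v1)))))))

  leqB⁻ : ∀ F a w → bval a < 2 ^ len F → bval w < 2 ^ len F →
    Yes (⟦ leqB ⟧ (F ∷ a ∷ w ∷ [])) → bval a ≤ bval w
  leqB⁻ F a w a< w< y with iter-compareStep⁻ F a w (nil ∙ nil) a< w< y
  ... | inj₁ lt = <⇒≤ lt
  ... | inj₂ (same , _) = ≤-reflexive same

  leqB⁺ : ∀ F a w → bval a < 2 ^ len F → bval w < 2 ^ len F →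
    bval a ≤ bval w → Yes (⟦ leqB ⟧ (F ∷ a ∷ w ∷ []))
  leqB⁺ F a w a< w< a≤w with m≤n⇒m<n∨m≡n a≤w
  ... | inj₁ lt = iter-compareStep⁺ F a w (nil ∙ nil) a< w< (inj₁ lt)
  ... | inj₂ same = iter-compareStep⁺ F a w (nil ∙ nil) a< w< (inj₂ (same , tt))

-- The program

-- The fields of a state of the dynamic program: the context of the last job,
-- the contexts of the last and of the next cut vertex, the assumed length
-- of the current segment, the completion time of the last cut vertex, the
-- current server machine and its load within the segment.
cur from to span base mach load : Tree → Tree
cur  s = head s
from s = head (tail s)
to   s = head (tail (tail s))
span s = head (tail (tail (tail s)))
base s = head (tail (tail (tail (tail s))))
mach s = head (tail (tail (tail (tail (tail s)))))
load s = tail (tail (tail (tail (tail (tail s)))))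

curᵗ fromᵗ toᵗ spanᵗ baseᵗ machᵗ loadᵗ : ∀ {n} → Tm n → Tm n
curᵗ  s = hd s
fromᵗ s = hd (tl s)
toᵗ   s = hd (tl (tl s))
spanᵗ s = hd (tl (tl (tl s)))
baseᵗ s = hd (tl (tl (tl (tl s))))
machᵗ s = hd (tl (tl (tl (tl (tl s)))))
loadᵗ s = tl (tl (tl (tl (tl (tl s)))))

serversOf sinkOf adjacencyOf processingOf costOf budgetOf : Tree → Tree
serversOf    I = head (tail I)
sinkOf       I = head (tail (tail (tail (tail I))))
adjacencyOf  I = head (tail (tail (tail (tail (tail I)))))
processingOf I = head (tail (tail (tail (tail (tail (tail I))))))
costOf       I = head (tail (tail (tail (tail (tail (tail (tail I)))))))
budgetOf     I = head (tail (tail (tail (tail (tail (tail (tail (tail I))))))))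

serversᵗ sinkᵗ adjacencyᵗ processingᵗ costᵗ budgetᵗ : ∀ {n} → Tm n → Tm n
serversᵗ    I = hd (tl I)
sinkᵗ       I = hd (tl (tl (tl (tl I))))
adjacencyᵗ  I = hd (tl (tl (tl (tl (tl I)))))
processingᵗ I = hd (tl (tl (tl (tl (tl (tl I))))))
costᵗ       I = hd (tl (tl (tl (tl (tl (tl (tl I)))))))
budgetᵗ     I = hd (tl (tl (tl (tl (tl (tl (tl (tl I))))))))

opaque
  addU : Tm 2
  addU = fold v0 v1 (nil ∙ v1)

  len-addU : ∀ a b → len (⟦ addU ⟧ (a ∷ b ∷ [])) ≡ len a + len b
  len-addU nil     b = refl
  len-addU (_ ∙ a) b = trans (len-addU a (nil ∙ b)) (+-suc (len a) (len b))

opaque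
  entry : Tm 3
  entry = call nth (call nth (v0 ,, v1 ,, []) ,, v2 ,, [])

  entry-def : ∀ {A i j} → ⟦ entry ⟧ (A ∷ i ∷ j ∷ []) ≡ ⟦ nth ⟧ (⟦ nth ⟧ (A ∷ i ∷ []) ∷ j ∷ [])
  entry-def = refl

-- A list item ((x ∙ a) ∙ y) says: process x after the cut vertex a; x is the
-- next cut vertex if y = nil, and y = nil ∙ b if b is the next one.
opaque
  preds : Tm 3
  preds = fold v1 nil (if (call entry (v2 ,, v0 ,, v4 ,, [])) (v0 ∙ v1) v1)

  preds-def : ∀ {A J b} → ⟦ preds ⟧ (A ∷ J ∷ b ∷ []) ≡
    iter (λ x l → cond (⟦ entry ⟧ (A ∷ x ∷ b ∷ [])) (x ∙ l) l) J nil
  preds-def = refl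

  mids : Tm 5
  mids = fold v1 v4 (if (call entry (v2 ,, v0 ,, v5 ,, [])) (((v0 ∙ v4) ∙ (nil ∙ v5)) ∙ v1) v1)

  mids-def : ∀ {A J a b its} → ⟦ mids ⟧ (A ∷ J ∷ a ∷ b ∷ its ∷ []) ≡
    iter (λ x l → cond (⟦ entry ⟧ (A ∷ x ∷ b ∷ [])) (((x ∙ a) ∙ (nil ∙ b)) ∙ l) l) J its
  mids-def = refl

  -- Only the adjacency matrix is given. Two or more predecessors can only be parallel jobs, and the
  -- predecessor of any one of them is the previous cut vertex; a single predecessor is itself a cut
  -- vertex.
  walkStep : Tm 3
  walkStep = bind (call preds (v0 ,, v1 ,, hd v2 ,, []))
    (if v0
      (if (tl v0)
        (bind (hd (call preds (v1 ,, v2 ,, hd v0 ,, [])))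
          (v0 ∙ call mids (v2 ,, v3 ,, v0 ,, hd v4 ,, (((hd v4 ∙ v0) ∙ nil) ∙ tl v4) ,, [])))
        (hd v0 ∙ (((hd v3 ∙ hd v0) ∙ nil) ∙ tl v3)))
      v3)

  walkStep-def : ∀ {A J c its} →
    let ps = ⟦ preds ⟧ (A ∷ J ∷ c ∷ [])
        a  = head (⟦ preds ⟧ (A ∷ J ∷ head ps ∷ []))
    in ⟦ walkStep ⟧ (A ∷ J ∷ (c ∙ its) ∷ []) ≡
       cond ps
         (cond (tail ps)
           (a ∙ ⟦ mids ⟧ (A ∷ J ∷ a ∷ c ∷ (((c ∙ a) ∙ nil) ∙ its) ∷ []))
           (head ps ∙ (((c ∙ head ps) ∙ nil) ∙ its)))
         (c ∙ its)
  walkStep-def = refl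

  walk : Tm 3
  walk = tl (fold v2 (v1 ∙ nil)
    (call walkStep (v2 ,, call range (tl v2 ,, []) ,, v1 ,, [])))

  walk-def : ∀ {A s F} → ⟦ walk ⟧ (A ∷ s ∷ F ∷ []) ≡
    tail (iter (λ _ a → ⟦ walkStep ⟧ (A ∷ ⟦ range ⟧ (tail A ∷ []) ∷ a ∷ [])) F (s ∙ nil))
  walk-def = refl

opaque
  horizonFactor : ℕ
  horizonFactor = 200

  190≤horizonFactor : 190 ≤ horizonFactor
  190≤horizonFactor = m≤m+n 190 10

pad : ∀ {n} → ℕ → Tm n → Tm n
pad zero    t = t
pad (suc k) t = nil ∙ pad k t

len-pad : ∀ {n} k (t : Tm n) ρ → len (⟦ pad k t ⟧ ρ) ≡ k + len (⟦ t ⟧ ρ)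
len-pad zero    t ρ = refl
len-pad (suc k) t ρ = cong suc (len-pad k t ρ)

opaque
  horizon : Tm 1
  horizon = fold v0 nil (pad horizonFactor v1)

  len-horizon : ∀ A → len (⟦ horizon ⟧ (A ∷ [])) ≡ len A * horizonFactor
  len-horizon A = trans (lemma A nil) (+-identityʳ _)
    where
    lemma : ∀ l a → len (iter (λ x a → ⟦ pad horizonFactor v1 ⟧ (x ∷ a ∷ A ∷ [])) l a) ≡
      len l * horizonFactor + len a
    lemma nil     a = refl
    lemma (x ∙ l) a = trans (lemma l _)
      (trans (cong (len l * horizonFactor +_) (len-pad horizonFactor v1 (x ∷ a ∷ A ∷ [])))
        (trans (sym (+-assoc (len l * horizonFactor) horizonFactor (len a)))
          (cong (_+ len a) (+-comm (len l * horizonFactor) horizonFactor))))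

opaque
  -- The number of machines is written in binary and may be exponential. Beyond the number of jobs
  -- further machines do not help, so the reading is truncated with respect to that number.
  machines : Tm 1
  machines = call toUnary (adjacencyᵗ v0 ,, serversᵗ v0 ,, [])

  machines-def : ∀ {I} → ⟦ machines ⟧ (I ∷ []) ≡ ⟦ toUnary ⟧ (adjacencyOf I ∷ serversOf I ∷ [])
  machines-def = refl

  -- All combinations are listed, sensible or not; the transition test `check` sorts them out.
  states : Tm 2
  states =
    bind (call range (tl (hd (processingᵗ v0)) ,, []))
    (bind (call range (v2 ,, []))
    (bind (call range (tl (call machines (v2 ,, [])) ,, []))
    (call prod (v2 ,, call prod (v2 ,, call prod (v2 ,, call prod (v1 ,, call prod (v1 ,,
      call prod (v0 ,, v1 ,, []) ,, []) ,, []) ,, []) ,, []) ,, []))))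

  states-def : ∀ {I H} →
    let C = ⟦ range ⟧ (tail (head (processingOf I)) ∷ [])
        R = ⟦ range ⟧ (H ∷ [])
        Q = ⟦ range ⟧ (tail (⟦ machines ⟧ (I ∷ [])) ∷ [])
        _⊠_ = λ a b → ⟦ prod ⟧ (a ∷ b ∷ [])
    in ⟦ states ⟧ (I ∷ H ∷ []) ≡ C ⊠ (C ⊠ (C ⊠ (R ⊠ (R ⊠ (Q ⊠ R)))))
  states-def = refl

-- Configurations c = e ∙ (H ∙ I): scale, horizon and instance.
opaque
  duration̂ : Tm 3
  duration̂ = call round (hd v0 ,, hd (tl v0) ,,
    call entry (processingᵗ (tl (tl v0)) ,, v2 ,, v1 ,, []) ,, [])

  duration̂-def : ∀ {e H I m x} → ⟦ duration̂ ⟧ ((e ∙ (H ∙ I)) ∷ m ∷ x ∷ []) ≡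
    ⟦ round ⟧ (e ∷ H ∷ ⟦ entry ⟧ (processingOf I ∷ x ∷ m ∷ []) ∷ [])
  duration̂-def = refl

  delaŷ : Tm 5
  delaŷ = call round (hd v0 ,, hd (tl v0) ,,
    call entry (call entry (adjacencyᵗ (tl (tl v0)) ,, v3 ,, v4 ,, []) ,, v1 ,, v2 ,, []) ,, [])

  delaŷ-def : ∀ {e H I m₁ m₂ i j} → ⟦ delaŷ ⟧ ((e ∙ (H ∙ I)) ∷ m₁ ∷ m₂ ∷ i ∷ j ∷ []) ≡
    ⟦ round ⟧ (e ∷ H ∷ ⟦ entry ⟧ (⟦ entry ⟧ (adjacencyOf I ∷ i ∷ j ∷ []) ∷ m₁ ∷ m₂ ∷ []) ∷ [])
  delaŷ-def = refl

opaque
  -- Arguments: configuration, job, previous cut vertex, next cut vertex, states.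
  latency : Tm 6
  latency = call addU (call delaŷ (v0 ,, fromᵗ v4 ,, curᵗ v5 ,, v2 ,, v1 ,, []) ,,
    call addU (call duration̂ (v0 ,, curᵗ v5 ,, v1 ,, []) ,,
      call delaŷ (v0 ,, curᵗ v5 ,, toᵗ v4 ,, v1 ,, v3 ,, []) ,, []) ,, [])

  len-latency : ∀ {c x a b u v} → len (⟦ latency ⟧ (c ∷ x ∷ a ∷ b ∷ u ∷ v ∷ [])) ≡
    len (⟦ delaŷ ⟧ (c ∷ from u ∷ cur v ∷ a ∷ x ∷ [])) +
    (len (⟦ duration̂ ⟧ (c ∷ cur v ∷ x ∷ [])) +
     len (⟦ delaŷ ⟧ (c ∷ cur v ∷ to u ∷ x ∷ b ∷ [])))
  len-latency {c} {x} {a} {b} {u} {v} =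
    trans (len-addU (⟦ delaŷ ⟧ (c ∷ from u ∷ cur v ∷ a ∷ x ∷ [])) _)
      (cong (_ +_) (len-addU (⟦ duration̂ ⟧ (c ∷ cur v ∷ x ∷ [])) _))

  -- The next context `to` and the length `span` were guessed at the last cut vertex. They are
  -- carried along unchanged, so that every job of the segment is tested against the same guess.
  midOk : Tm 6
  midOk =
    and (call eqU (fromᵗ v5 ,, fromᵗ v4 ,, []))
    (and (call eqU (toᵗ v5 ,, toᵗ v4 ,, []))
    (and (call eqU (spanᵗ v5 ,, spanᵗ v4 ,, []))
    (and (call eqU (baseᵗ v5 ,, baseᵗ v4 ,, []))
    (and (call leqU (call latency (v0 ,, v1 ,, v2 ,, v3 ,, v4 ,, v5 ,, []) ,, spanᵗ v4 ,, []))
    (if (curᵗ v5)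
      (and (call eqU (machᵗ v5 ,, machᵗ v4 ,, [])) (call eqU (loadᵗ v5 ,, loadᵗ v4 ,, [])))
      (if (call eqU (machᵗ v5 ,, machᵗ v4 ,, []))
        (and (call leqU (loadᵗ v4 ,, spanᵗ v4 ,, []))
          (call eqU (loadᵗ v5 ,,
            call addU (loadᵗ v4 ,, call duration̂ (v0 ,, curᵗ v5 ,, v1 ,, []) ,, []) ,, [])))
        (and (call eqU (machᵗ v5 ,, nil ∙ machᵗ v4 ,, []))
          (call eqU (loadᵗ v5 ,, call duration̂ (v0 ,, curᵗ v5 ,, v1 ,, []) ,, [])))))))))

  -- The components `to` and `span` of the new state are left open: they are the guesses for the
  -- segment that begins here.
  chainOk : Tm 5
  chainOk =
    and (call eqU (curᵗ v4 ,, toᵗ v3 ,, []))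
    (and (call eqU (fromᵗ v4 ,, toᵗ v3 ,, []))
    (and (call eqU (baseᵗ v4 ,,
      call addU (call duration̂ (v0 ,, toᵗ v3 ,, v1 ,, []) ,,
        call addU (spanᵗ v3 ,, call addU (spanᵗ v3 ,, call addU (spanᵗ v3 ,, baseᵗ v3 ,, [])
          ,, []) ,, []) ,, []) ,, []))
    -- The test is made even if the two cut vertices are not adjacent; the missing delay table is
    -- then read as zero, and only the rounding error remains.
    (and (call leqU (call delaŷ (v0 ,, fromᵗ v3 ,, toᵗ v3 ,, v2 ,, v1 ,, []) ,, spanᵗ v3 ,, []))
    (and (call eqU (machᵗ v4 ,, nil ,, []))
         (call eqU (loadᵗ v4 ,, nil ,, []))))))

  check : Tm 4
  check = if (tl v1)
    (call midOk (v0 ,, hd (hd v1) ,, tl (hd v1) ,, tl (tl v1) ,, v2 ,, v3 ,, []))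
    (call chainOk (v0 ,, hd (hd v1) ,, tl (hd v1) ,, v2 ,, v3 ,, []))

  check-def : ∀ {c x a y u v} → ⟦ check ⟧ (c ∷ ((x ∙ a) ∙ y) ∷ u ∷ v ∷ []) ≡
    cond y (⟦ midOk ⟧ (c ∷ x ∷ a ∷ tail y ∷ u ∷ v ∷ [])) (⟦ chainOk ⟧ (c ∷ x ∷ a ∷ u ∷ v ∷ []))
  check-def = refl

opaque
  weight : Tm 3
  weight = if (curᵗ v2) (call entry (costᵗ v0 ,, hd (hd v1) ,, tl (curᵗ v2) ,, [])) nil

  weight-def : ∀ {I x y v} → ⟦ weight ⟧ (I ∷ (x ∙ y) ∷ v ∷ []) ≡
    cond (cur v) (⟦ entry ⟧ (costOf I ∷ head x ∷ tail (cur v) ∷ [])) nil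
  weight-def = refl

  -- Completion time, in units, of the job of an item, given the state after it.
  completionTime : Tm 2
  completionTime = if (tl v0)
    (if (curᵗ v1)
      (call addU (spanᵗ v1 ,, call addU (spanᵗ v1 ,, baseᵗ v1 ,, []) ,, []))
      (call addU (spanᵗ v1 ,, call addU (loadᵗ v1 ,, baseᵗ v1 ,, []) ,, [])))
    (baseᵗ v1)

  len-completionTime-chain : ∀ {x v} → len (⟦ completionTime ⟧ ((x ∙ nil) ∷ v ∷ [])) ≡ len (base v)
  len-completionTime-chain = refl

  len-completionTime-cloud : ∀ {x y z v} → Yes (cur v) →
    len (⟦ completionTime ⟧ ((x ∙ (y ∙ z)) ∷ v ∷ [])) ≡ len (span v) + (len (span v) + len (base v))
  len-completionTime-cloud {v = v} c rewrite cond-yes {cur v}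
    {⟦ addU ⟧ (span v ∷ ⟦ addU ⟧ (span v ∷ base v ∷ []) ∷ [])}
    {⟦ addU ⟧ (span v ∷ ⟦ addU ⟧ (load v ∷ base v ∷ []) ∷ [])} c =
    trans (len-addU (span v) _) (cong (len (span v) +_) (len-addU (span v) (base v)))

  len-completionTime-server : ∀ {x y z v} → cur v ≡ nil →
    len (⟦ completionTime ⟧ ((x ∙ (y ∙ z)) ∷ v ∷ [])) ≡ len (span v) + (len (load v) + len (base v))
  len-completionTime-server {v = v} c rewrite c =
    trans (len-addU (span v) _) (cong (len (span v) +_) (len-addU (load v) (base v)))

  record̂ : Tm 2
  record̂ = hd (hd v0) ∙ (call completionTime (v0 ,, v1 ,, []) ∙ (curᵗ v1 ∙ machᵗ v1))

  record̂-def : ∀ {it v} → ⟦ record̂ ⟧ (it ∷ v ∷ []) ≡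
    head (head it) ∙ (⟦ completionTime ⟧ (it ∷ v ∷ []) ∙ (cur v ∙ mach v))
  record̂-def = refl

opaque
  better : Tm 3
  better = if v2 (if (call leqB (nil ∙ (nil ∙ v0) ,, hd v1 ,, hd v2 ,, [])) v1 v2) v1

  better-def : ∀ {B e b} → ⟦ better ⟧ (B ∷ e ∷ b ∷ []) ≡
    cond b (cond (⟦ leqB ⟧ ((nil ∙ (nil ∙ B)) ∷ head e ∷ head b ∷ [])) e b) e
  better-def = refl

  -- The table is safe, so the fold runs over the states and consumes the table in step. The states
  -- come reversed because `step` builds its table by consing.
  bestPred : Tm 5
  bestPred = tl (fold v2 (v3 ∙ nil)
    (tl (hd v1) ∙
      if (hd (hd v1))
        (if (call check (v2 ,, v3 ,, v0 ,, v6 ,, []))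
          (call better (budgetᵗ (tl (tl v2)) ,, hd (hd v1) ,, tl v1 ,, []))
          (tl v1))
        (tl v1)))

  bestPred-def : ∀ {e H I it R T v} → ⟦ bestPred ⟧ ((e ∙ (H ∙ I)) ∷ it ∷ R ∷ T ∷ v ∷ []) ≡
    tail (iter (λ u a → tail (head a) ∙
      cond (head (head a))
        (cond (⟦ check ⟧ ((e ∙ (H ∙ I)) ∷ it ∷ u ∷ v ∷ []))
          (⟦ better ⟧ (budgetOf I ∷ head (head a) ∷ tail a ∷ [])) (tail a))
        (tail a)) R (T ∙ nil))
  bestPred-def = refl

  -- Partial costs above the budget are discarded at once. Costs never decrease, so nothing is lost,
  -- and the numbers to be compared stay within reach of a fuel made from the budget.
  extend : Tm 4
  extend = if v3
    (bind (call weight (tl (tl v0) ,, v1 ,, v2 ,, []))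
    (bind (nil ∙ (nil ∙ call append (v0 ,, budgetᵗ (tl (tl v1)) ,, [])))
    (bind (call addB (v0 ,, hd v5 ,, v1 ,, []))
      (if (call leqB (v1 ,, v0 ,, budgetᵗ (tl (tl v3)) ,, []))
        (v0 ∙ (call record̂ (v4 ,, v5 ,, []) ∙ tl v6))
        nil))))
    nil

  extend-def : ∀ {e H I it v b} →
    let w = ⟦ weight ⟧ (I ∷ it ∷ v ∷ [])
        F = nil ∙ (nil ∙ ⟦ append ⟧ (w ∷ budgetOf I ∷ []))
        s = ⟦ addB ⟧ (F ∷ head b ∷ w ∷ [])
    in ⟦ extend ⟧ ((e ∙ (H ∙ I)) ∷ it ∷ v ∷ b ∷ []) ≡
       cond b (cond (⟦ leqB ⟧ (F ∷ s ∷ budgetOf I ∷ [])) (s ∙ (⟦ record̂ ⟧ (it ∷ v ∷ []) ∙ tail b)) nil) nil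
  extend-def = refl

  step : Tm 5
  step = fold v2 nil
    (call extend (v2 ,, v3 ,, v0 ,, call bestPred (v2 ,, v3 ,, v5 ,, v6 ,, v0 ,, []) ,, []) ∙ v1)

  step-def : ∀ {c it A R T} → ⟦ step ⟧ (c ∷ it ∷ A ∷ R ∷ T ∷ []) ≡
    iter (λ v t → ⟦ extend ⟧ (c ∷ it ∷ v ∷ ⟦ bestPred ⟧ (c ∷ it ∷ R ∷ T ∷ v ∷ []) ∷ []) ∙ t) A nil
  step-def = refl

  isInitial : Tm 1
  isInitial = and (call eqU (fromᵗ v0 ,, nil ,, []))
    (and (call eqU (baseᵗ v0 ,, nil ,, []))
    (and (call eqU (machᵗ v0 ,, nil ,, [])) (call eqU (loadᵗ v0 ,, nil ,, []))))

  initialTable : Tm 1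
  initialTable = fold v0 nil (if (call isInitial (v0 ,, [])) (nil ∙ nil) nil ∙ v1)

  initialTable-def : ∀ {A} → ⟦ initialTable ⟧ (A ∷ []) ≡
    iter (λ v t → cond (⟦ isInitial ⟧ (v ∷ [])) (nil ∙ nil) nil ∙ t) A nil
  initialTable-def = refl

  finalTable : Tm 4
  finalTable = fold v1 (call initialTable (v2 ,, []))
    (call step (v2 ,, v0 ,, v4 ,, v5 ,, v1 ,, []))

  finalTable-def : ∀ {c its A R} → ⟦ finalTable ⟧ (c ∷ its ∷ A ∷ R ∷ []) ≡
    iter (λ it T → ⟦ step ⟧ (c ∷ it ∷ A ∷ R ∷ T ∷ [])) its (⟦ initialTable ⟧ (A ∷ []))
  finalTable-def = refl

  select : Tm 2
  select = tl (fold v0 (v1 ∙ nil)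
    (tl (hd v1) ∙
      if (hd (hd v1))
        -- At the end `from` is the context of the sink, which has to be a server.
        (if (call eqU (fromᵗ v0 ,, nil ,, []))
          (if (tl v1)
            (if (call leqU (baseᵗ v0 ,, hd (tl v1) ,, [])) (baseᵗ v0 ∙ tl (hd (hd v1))) (tl v1))
            (baseᵗ v0 ∙ tl (hd (hd v1))))
          (tl v1))
        (tl v1)))

  select-def : ∀ {R T} → ⟦ select ⟧ (R ∷ T ∷ []) ≡
    tail (iter (λ u a → tail (head a) ∙
      cond (head (head a))
        (cond (⟦ eqU ⟧ (from u ∷ nil ∷ []))
          (cond (tail a)
            (cond (⟦ leqU ⟧ (base u ∷ head (tail a) ∷ [])) (base u ∙ tail (head (head a))) (tail a))
            (base u ∙ tail (head (head a))))
          (tail a))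
        (tail a)) R (T ∙ nil))
  select-def = refl

  solve : Tm 3
  solve = bind (call reverse (v2 ,, []))
    (call select (v0 ,, call finalTable (v1 ,, v2 ,, v3 ,, v0 ,, []) ,, []))

  solve-def : ∀ {c its A} → let R = ⟦ reverse ⟧ (A ∷ []) in
    ⟦ solve ⟧ (c ∷ its ∷ A ∷ []) ≡ ⟦ select ⟧ (R ∷ ⟦ finalTable ⟧ (c ∷ its ∷ A ∷ R ∷ []) ∷ [])
  solve-def = refl

-- The search for the scale, and the output

opaque
  -- The total length of all server processing times exceeds none of them needlessly little: at a
  -- scale of this size every server time rounds to at most three units, so the search can stop
  -- there.
  maxScale : Tm 1
  maxScale = fold v0 nil (call append (hd v0 ,, v1 ,, []))

  maxScale-def : ∀ {P} → ⟦ maxScale ⟧ (P ∷ []) ≡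
    iter (λ x a → ⟦ append ⟧ (head x ∷ a ∷ [])) P nil
  maxScale-def = refl

  -- The scales are tried in descending order and each success overwrites the previous one, so the
  -- smallest successful scale survives.
  search : Tm 4
  search = fold (call range (call maxScale (processingᵗ v0 ,, []) ,, [])) nil
    (bind (call solve (v0 ∙ (v3 ∙ v2) ,, v4 ,, v5 ,, [])) (if v0 (v1 ∙ v0) v2))

  search-def : ∀ {I H its A} → ⟦ search ⟧ (I ∷ H ∷ its ∷ A ∷ []) ≡
    iter (λ e a → cond (⟦ solve ⟧ ((e ∙ (H ∙ I)) ∷ its ∷ A ∷ []))
                       (e ∙ ⟦ solve ⟧ ((e ∙ (H ∙ I)) ∷ its ∷ A ∷ [])) a)
      (⟦ range ⟧ (⟦ maxScale ⟧ (processingOf I ∷ []) ∷ [])) nil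
  search-def = refl

  look : Tm 2
  look = fold v0 nil (if v1 v1 (if (call eqU (hd v0 ,, v3 ,, [])) (tl v0) nil))

  look-def : ∀ {t x} → ⟦ look ⟧ (t ∷ x ∷ []) ≡
    iter (λ o a → cond a a (cond (⟦ eqU ⟧ (head o ∷ x ∷ [])) (tail o) nil)) t nil
  look-def = refl

  -- Multiplication by two would need a digit zero. A low digit 1 is put in instead, which maps n to
  -- 2n + 1.
  scale : Tm 2
  scale = fold v0 v1 ((nil ∙ nil) ∙ v1)

  scale-def : ∀ {e t} → ⟦ scale ⟧ (e ∷ t ∷ []) ≡ iter (λ _ a → (nil ∙ nil) ∙ a) e t
  scale-def = refl

  row : Tm 2
  row = call scale (v0 ,, call toDigits (hd v1 ,, []) ,, []) ∙
    if (hd (tl v1)) ((nil ∙ nil) ∙ call toDigits (tl (hd (tl v1)) ,, []))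
                    (nil ∙ call toDigits (tl (tl v1) ,, []))

  row-def : ∀ {e t m q} → ⟦ row ⟧ (e ∷ (t ∙ (m ∙ q)) ∷ []) ≡
    ⟦ scale ⟧ (e ∷ ⟦ toDigits ⟧ (t ∷ []) ∷ []) ∙
      cond m ((nil ∙ nil) ∙ ⟦ toDigits ⟧ (tail m ∷ [])) (nil ∙ ⟦ toDigits ⟧ (q ∷ []))
  row-def = refl

  -- The source is never recorded; its missing record is read as unit time 0 on the first machine.
  row-nil : ∀ {e} → ⟦ row ⟧ (e ∷ nil ∷ []) ≡
    ⟦ scale ⟧ (e ∷ ⟦ toDigits ⟧ (nil ∷ []) ∷ []) ∙ (nil ∙ ⟦ toDigits ⟧ (nil ∷ []))
  row-nil = refl

  output : Tm 3
  output = fold (call range (tl v0 ,, [])) nil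
    (call row (v3 ,, call look (v4 ,, v0 ,, []) ,, []) ∙ v1)

  output-def : ∀ {A e t} → ⟦ output ⟧ (A ∷ e ∷ t ∷ []) ≡
    iter (λ x a → ⟦ row ⟧ (e ∷ ⟦ look ⟧ (t ∷ x ∷ []) ∷ []) ∙ a) (⟦ range ⟧ (tail A ∷ [])) nil
  output-def = refl

  main : Tm 1
  main =
    bind (call horizon (adjacencyᵗ v0 ,, []))
    (bind (call search (v1 ,, v0 ,,
        call walk (adjacencyᵗ v1 ,, call toUnary (adjacencyᵗ v1 ,, sinkᵗ v1 ,, []) ,, v0 ,, []) ,,
        call states (v1 ,, v0 ,, []) ,, []))
      (call output (adjacencyᵗ v2 ,, hd v0 ,, tl (tl v0) ,, [])))

  main-def : ∀ {I} →
    let A = adjacencyOf I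
        H = ⟦ horizon ⟧ (A ∷ [])
        its = ⟦ walk ⟧ (A ∷ ⟦ toUnary ⟧ (A ∷ sinkOf I ∷ []) ∷ H ∷ [])
        r = ⟦ search ⟧ (I ∷ H ∷ its ∷ ⟦ states ⟧ (I ∷ H ∷ []) ∷ [])
    in ⟦ main ⟧ (I ∷ []) ≡ ⟦ output ⟧ (A ∷ head r ∷ tail (tail r) ∷ [])
  main-def = refl

opaque
  unfolding main solve machines horizon horizonFactor walk duration̂ midOk weight addU entry
    append toDigits leqU eqU nth range prod reverse double toUnary round half addB leqB maxScale better

  -- The criterion for polynomial growth is decided by evaluation, which is why the subprograms have
  -- to be unfolded here.
  main-ok : T (ok main (false ∷ []))
  main-ok = tt

-- Cut vertices of an extended chain

2* : ℕ → ℕ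
2* n = n + n

module Graph (I : Instance) (extended : IsExtendedChain I) where
  open Instance I public
  open IsExtendedChain extended
  open ChainExtension extension

  vertex : Job → Vertex
  vertex = Inverse.to iso

  job : Vertex → Job
  job = Inverse.from iso

  vertex-job : ∀ v → vertex (job v) ≡ v
  vertex-job v = Inverse.inverseˡ iso refl

  job-vertex : ∀ j → job (vertex j) ≡ j
  job-vertex j = Inverse.inverseʳ iso refl

  vertex-injective : ∀ {i j} → vertex i ≡ vertex j → i ≡ j
  vertex-injective {i} {j} eq = trans (sym (job-vertex i)) (trans (cong job eq) (job-vertex j))

  -- Parity separates chain vertices from new jobs, and every edge raises the rank, so ranks measure
  -- the progress of the walk.
  rankᵛ : Vertex → ℕ
  rankᵛ (chain j) = 2* (toℕ j)
  rankᵛ (new j _) = suc (2* (toℕ j))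

  rank : Job → ℕ
  rank j = rankᵛ (vertex j)

  -- Cut vertices: new jobs that are the only ones on their edge count as well.
  Cut : Job → Set
  Cut b = ∀ k → rank k ≡ rank b → k ≡ b

  2*-injective : ∀ m n → 2* m ≡ 2* n → m ≡ n
  2*-injective zero    zero    eq = refl
  2*-injective zero    (suc n) ()
  2*-injective (suc m) zero    ()
  2*-injective (suc m) (suc n) eq = cong suc (2*-injective m n
    (suc-injective (trans (sym (+-suc m m)) (trans (suc-injective eq) (+-suc n n)))))

  odd≢even : ∀ m n → suc (2* m) ≢ 2* n
  odd≢even m zero ()
  odd≢even zero (suc n) eq with trans (suc-injective eq) (+-suc n n)
  ... | ()
  odd≢even (suc m) (suc n) eq =
    odd≢even m n (trans (sym (+-suc m m)) (suc-injective (trans (suc-injective eq) (+-suc n n))))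

  data ArcView (i j : Job) : Set where
    keep  : ∀ k → mid k ≡ nothing → vertex i ≡ chain (inject₁ k) → vertex j ≡ chain (suc k) → ArcView i j
    enter : ∀ k x → vertex i ≡ chain (inject₁ k) → vertex j ≡ new k x → ArcView i j
    leave : ∀ k x → vertex i ≡ new k x → vertex j ≡ chain (suc k) → ArcView i j

  arcView : ∀ {i j} → Edge i j → ArcView i j
  arcView {i} {j} e = view refl refl (Equivalence.to (iso-edge i j) e)
    where
    view : ∀ {u v} → vertex i ≡ u → vertex j ≡ v → Arc u v → ArcView i j
    view u v (keep k) = keep _ k u v
    view u v enter = enter _ _ u v
    view u v leave = leave _ _ u v

  arc-edge : ∀ {i j u v} → vertex i ≡ u → vertex j ≡ v → Arc u v → Edge i j
  arc-edge {i} {j} refl refl arc = Equivalence.from (iso-edge i j) arc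

  chain-cut : ∀ {j k} → vertex j ≡ chain k → Cut j
  chain-cut {j} {k} eq i r with vertex i in eqᵢ
  ... | chain k′ = vertex-injective (trans eqᵢ (trans (cong chain (Fin.toℕ-injective
                     (2*-injective _ _ (trans r (cong rankᵛ eq))))) (sym eq)))
  ... | new k′ x = ⊥-elim (odd≢even (toℕ k′) (toℕ k) (trans r (cong rankᵛ eq)))

  odd-rank : ∀ k {j} → rank j ≡ suc (2* (toℕ k)) → ∃[ x ] vertex j ≡ new k x
  odd-rank k {j} r with vertex j
  ... | chain k′ = ⊥-elim (odd≢even (toℕ k) (toℕ k′) (sym r))
  ... | new k′ x with refl ← Fin.toℕ-injective (2*-injective (toℕ k′) (toℕ k) (suc-injective r)) = x , refl

  rank-inject₁ : ∀ {j} k → vertex j ≡ chain (inject₁ k) → rank j ≡ 2* (toℕ k)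
  rank-inject₁ k eq = trans (cong rankᵛ eq) (cong 2* (toℕ-inject₁ k))

  rank-suc : ∀ {j} (k : Fin (1 + n)) → vertex j ≡ chain (suc k) → rank j ≡ 2 + 2* (toℕ k)
  rank-suc k eq = trans (cong rankᵛ eq) (cong suc (+-suc (toℕ k) (toℕ k)))

  rank-edge : ∀ {i j} → Edge i j → rank i < rank j
  rank-edge e with arcView e
  ... | keep k _ eqᵢ eqⱼ  = subst₂ _<_ (sym (rank-inject₁ k eqᵢ)) (sym (rank-suc k eqⱼ)) (n≤1+n _)
  ... | enter k x eqᵢ eqⱼ = subst₂ _<_ (sym (rank-inject₁ k eqᵢ)) (sym (cong rankᵛ eqⱼ)) ≤-refl
  ... | leave k x eqᵢ eqⱼ = subst₂ _<_ (sym (cong rankᵛ eqᵢ)) (sym (rank-suc k eqⱼ)) ≤-refl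

  between : ∀ {m r} → m < r → r ≤ 2 + m → r ≡ 1 + m ⊎ r ≡ 2 + m
  between m<r r≤ with m≤n⇒m<n∨m≡n m<r
  ... | inj₂ eq = inj₁ (sym eq)
  ... | inj₁ lt = inj₂ (≤-antisym r≤ lt)

  no-new : ∀ {k} → mid k ≡ nothing → ¬ Fin (maybe′ (λ m → m) 0 (mid k))
  no-new none x with () ← subst (λ m → Fin (maybe′ (λ m → m) 0 m)) none x

  record Segment (a : Job) (xs : List Job) (b : Job) : Set where
    field
      into-mid : ∀ {x i} → x ∈ᴸ xs → Edge i x → i ≡ a
      enters   : ∀ {x} → x ∈ᴸ xs → Edge a x
      leaves   : ∀ {x} → x ∈ᴸ xs → Edge x b
      into-cut : ∀ {i} → Edge i b → i ∈ᴸ xs ⊎ i ≡ a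
      -- Guarantees a path between the two cut vertices, without which their completion times would
      -- be unrelated.
      linked   : Edge a b ⊎ ∃[ x ] x ∈ᴸ xs
      forward  : rank a < rank b
      covers   : ∀ k → rank a < rank k → rank k ≤ rank b → k ∈ᴸ xs ⊎ k ≡ b
      distinct : Unique xs

  -- If `a` is a new job, any other job of its rank would be a second predecessor of `b`. Hence a
  -- new job without a parallel one is a cut vertex.
  direct-segment : ∀ {a b} → Cut b → Edge a b → (∀ i → Edge i b → i ≡ a) → Cut a × Segment a [] b
  direct-segment {a} {b} cut e only = cutₐ (arcView e) , record
    { into-mid = λ ()
    ; enters   = λ ()
    ; leaves   = λ ()
    ; into-cut = λ e′ → inj₂ (only _ e′)
    ; linked   = inj₁ e
    ; forward  = rank-edge e
    ; covers   = λ k lt le → inj₂ (covers (arcView e) k lt le)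
    ; distinct = [] }
    where
    cutₐ : ArcView a b → Cut a
    cutₐ (keep k _ eqₐ _)  = chain-cut eqₐ
    cutₐ (enter k x eqₐ _) = chain-cut eqₐ
    cutₐ (leave k x eqₐ eqb) i r with y , eqᵢ ← odd-rank k (trans r (cong rankᵛ eqₐ)) =
      only i (arc-edge eqᵢ eqb leave)
    covers : ArcView a b → ∀ k → rank a < rank k → rank k ≤ rank b → k ≡ b
    covers (keep k none eqₐ eqb) i lt le
      with between (subst (_< rank i) (rank-inject₁ k eqₐ) lt) (subst (rank i ≤_) (rank-suc k eqb) le)
    ... | inj₂ r = cut i (trans r (sym (rank-suc k eqb)))
    ... | inj₁ r with x , _ ← odd-rank k r = ⊥-elim (no-new none x)
    covers (enter k x eqₐ eqb) i lt le =
      cut i (≤-antisym le (subst (_≤ rank i) (sym (trans (cong rankᵛ eqb) (cong suc (sym (rank-inject₁ k eqₐ))))) lt))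
    covers (leave k x eqₐ eqb) i lt le =
      cut i (≤-antisym le (subst (_≤ rank i) (sym (trans (rank-suc k eqb) (cong suc (sym (cong rankᵛ eqₐ))))) lt))

  -- Only new jobs can share a successor: a new job has one predecessor, and a kept chain edge
  -- excludes new jobs next to it.
  parallel-segment : ∀ {a₁ a₂ b xs} → a₁ ≢ a₂ → Edge a₁ b → Edge a₂ b → Unique xs →
    (∀ {i} → i ∈ᴸ xs → Edge i b) → (∀ i → Edge i b → i ∈ᴸ xs) →
    ∃[ a ] (Edge a a₁ × (∀ i → Edge i a₁ → i ≡ a) × Cut a × Segment a xs b)
  parallel-segment {a₁} {a₂} {b} {xs} a₁≢a₂ e₁ e₂ unique sound complete with arcView e₁ | arcView e₂
  ... | keep k none eq₁ eqb | keep k′ _ eq₂ eqb′ with refl ← trans (sym eqb) eqb′ =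
    ⊥-elim (a₁≢a₂ (vertex-injective (trans eq₁ (sym eq₂))))
  ... | keep k none eq₁ eqb | enter k′ x eq₂ eqb′ with () ← trans (sym eqb) eqb′
  ... | keep k none eq₁ eqb | leave k′ x eq₂ eqb′ with refl ← trans (sym eqb) eqb′ = ⊥-elim (no-new none x)
  ... | enter k x eq₁ eqb | keep k′ _ eq₂ eqb′ with () ← trans (sym eqb) eqb′
  ... | enter k x eq₁ eqb | enter k′ x′ eq₂ eqb′ with refl ← trans (sym eqb) eqb′ =
    ⊥-elim (a₁≢a₂ (vertex-injective (trans eq₁ (sym eq₂))))
  ... | enter k x eq₁ eqb | leave k′ x′ eq₂ eqb′ with () ← trans (sym eqb) eqb′
  ... | leave k x eq₁ eqb | _ = a , arc-edge eqₐ eq₁ enter , only eq₁ , chain-cut eqₐ , record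
    { into-mid = λ x∈ e → into (arcView (sound x∈)) e
    ; enters   = λ x∈ → from-a (arcView (sound x∈))
    ; leaves   = sound
    ; into-cut = λ e → inj₁ (complete _ e)
    ; linked   = inj₂ (a₁ , complete a₁ e₁)
    ; forward  = subst₂ _<_ (sym (rank-inject₁ k eqₐ)) (sym (rank-suc k eqb)) (n≤1+n _)
    ; covers   = covers
    ; distinct = unique }
    where
    a = job (chain (inject₁ k))
    eqₐ : vertex a ≡ chain (inject₁ k)
    eqₐ = vertex-job _
    only : ∀ {y x′} → vertex y ≡ new k x′ → ∀ i → Edge i y → i ≡ a
    only eq i e with arcView e
    ... | keep k′ _ eqᵢ eq′ with () ← trans (sym eq) eq′
    ... | enter k′ y eqᵢ eq′ with refl ← trans (sym eq) eq′ = vertex-injective (trans eqᵢ (sym eqₐ))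
    ... | leave k′ y eqᵢ eq′ with () ← trans (sym eq) eq′
    new-pred : ∀ {y} → ArcView y b → ∃[ x′ ] vertex y ≡ new k x′
    new-pred (keep k′ none eqy eqb′) with refl ← trans (sym eqb) eqb′ = ⊥-elim (no-new none x)
    new-pred (enter k′ y eqy eqb′) with () ← trans (sym eqb) eqb′
    new-pred (leave k′ y eqy eqb′) with refl ← trans (sym eqb) eqb′ = y , eqy
    into : ∀ {y i} → ArcView y b → Edge i y → i ≡ a
    into v e with _ , eqy ← new-pred v = only eqy _ e
    from-a : ∀ {y} → ArcView y b → Edge a y
    from-a v with _ , eqy ← new-pred v = arc-edge eqₐ eqy enter
    covers : ∀ i → rank a < rank i → rank i ≤ rank b → i ∈ᴸ xs ⊎ i ≡ b
    covers i lt le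
      with between (subst (_< rank i) (rank-inject₁ k eqₐ) lt) (subst (rank i ≤_) (rank-suc k eqb) le)
    ... | inj₂ r = inj₂ (chain-cut eqb i (trans r (sym (rank-suc k eqb))))
    ... | inj₁ r with _ , eqᵢ ← odd-rank k r = inj₁ (complete i (arc-edge eqᵢ eqb leave))

  max-rank : ∀ i → rank i ≤ rank sink
  max-rank i = subst (rank i ≤_) (sym (trans (cong rankᵛ iso-sink) (cong 2* (toℕ-fromℕ (1 + n))))) (lemma (vertex i))
    where
    lemma : ∀ v → rankᵛ v ≤ 2* (1 + n)
    lemma (chain k) = +-mono-≤ (≤-pred (toℕ<n k)) (≤-pred (toℕ<n k))
    lemma (new k x) = ≤-trans (n≤1+n _) (≤-trans (≤-reflexive (cong suc (sym (+-suc (toℕ k) (toℕ k)))))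
      (+-mono-≤ (toℕ<n k) (toℕ<n k)))

  rank-sink≤ : rank sink ≤ 2* jobs
  rank-sink≤ = subst (_≤ 2* jobs) (sym (trans (cong rankᵛ iso-sink) (cong 2* (toℕ-fromℕ (1 + n)))))
    (+-mono-≤ 1+n≤ 1+n≤)
    where
    1+n≤ : 1 + n ≤ jobs
    1+n≤ = ≤-trans (n≤1+n _) (Fin.injective⇒≤ {f = λ k → job (chain k)}
      λ {k} {k′} eq → chain-injective (trans (sym (vertex-job _)) (trans (cong vertex eq) (vertex-job _))))
      where
      chain-injective : ∀ {k k′} → chain k ≡ chain k′ → k ≡ k′
      chain-injective refl = refl

  sink-cut : Cut sink
  sink-cut = chain-cut iso-sink

  source-cut : Cut source
  source-cut = chain-cut iso-source

  rank-source : rank source ≡ 0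
  rank-source = cong rankᵛ iso-source

  no-pred-source : ∀ i → ¬ Edge i source
  no-pred-source = Equivalence.from (unique-source source) refl

-- The processing order

Index : ∀ {n} → Tree → Fin n → Set
Index t i = len t ≡ toℕ i

len-table : ∀ {n} (f : Fin n → Tree) → len (encodeTable f) ≡ n
len-table {zero}  f = refl
len-table {suc n} f = cong suc (len-table (f ∘ suc))

len-tail : ∀ t → len (tail t) ≡ len t ∸ 1
len-tail nil     = refl
len-tail (_ ∙ t) = refl

entry-table : ∀ {m n} (f : Fin m → Fin n → Tree) {s t} i j → Index s i → Index t j →
  ⟦ entry ⟧ (encodeTable (λ i → encodeTable (f i)) ∷ s ∷ t ∷ []) ≡ f i j
entry-table f {s} {t} i j s≈ t≈ = trans entry-def (trans
  (cong (λ r → ⟦ nth ⟧ (r ∷ t ∷ [])) (nth-table (λ i → encodeTable (f i)) i s≈))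
  (nth-table (f i) j t≈))

data Listed {n} (f : Tree → Tree) (rest : Tree) : List (Fin n) → Tree → Set where
  []  : Listed f rest [] rest
  _∷_ : ∀ {x xs s t} → Index s x → Listed f rest xs t → Listed f rest (x ∷ xs) (f s ∙ t)

module Walk (I : Instance) (extended : IsExtendedChain I) where
  open Graph I extended public

  delayTable : Job → Job → Tree
  delayTable i j = encodeContextTable (λ m₁ → encodeContextTable (λ m₂ → encodeℕ (delay m₁ m₂ i j)))

  cell : Job → Job → Tree
  cell i j = if Instance.edge I i j then delayTable i j else nil

  adjacency : Tree
  adjacency = adjacencyOf (encodeInstance I)

  cell-edge⁺ : ∀ {i j} → Edge i j → cell i j ≡ delayTable i j
  cell-edge⁺ {i} {j} e with true ← Instance.edge I i j = refl

  cell-edge : ∀ i j → Edge i j ⊎ (¬ Edge i j × cell i j ≡ nil)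
  cell-edge i j with Instance.edge I i j
  ... | true  = inj₁ tt
  ... | false = inj₂ ((λ ()) , refl)

  entry-adjacency : ∀ {s t i j} → Index s i → Index t j → ⟦ entry ⟧ (adjacency ∷ s ∷ t ∷ []) ≡ cell i j
  entry-adjacency {i = i} {j} = entry-table cell i j

  len-adjacency : len adjacency ≡ jobs
  len-adjacency = len-table (λ i → encodeTable (cell i))

  jobIndices : Tree
  jobIndices = ⟦ range ⟧ (tail adjacency ∷ [])

  jobIndices-spec : jobIndices ≡ downFrom (jobs ∸ 1)
  jobIndices-spec = trans (range-spec (tail adjacency))
    (cong downFrom (trans (len-tail adjacency) (cong (_∸ 1) len-adjacency)))

  record PredsFrom (b : Job) (m : ℕ) (xs : List Job) : Set where
    field
      are-preds : ∀ {i} → i ∈ᴸ xs → Edge i b × m ≤ toℕ i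
      all-preds : ∀ i → m ≤ toℕ i → Edge i b → i ∈ᴸ xs
      unique    : Unique xs

  consIfPred : Tree → (Tree → Tree) → Tree → Tree → Tree
  consIfPred tb f x l = cond (⟦ entry ⟧ (adjacency ∷ x ∷ tb ∷ [])) (f x ∙ l) l

  visit : ∀ {tb b} → Index tb b → ∀ f {rest n} (n< : n < jobs) {u acc xs} → len u ≡ n →
    Listed f rest xs acc → PredsFrom b (suc n) xs →
    ∃[ ys ] (Listed f rest ys (consIfPred tb f u acc) × PredsFrom b n ys)
  visit {tb} {b} b≈ f {n = n} n< {u} {acc} {xs} u≈ l ps = go (cell-edge i b)
    where
    open PredsFrom ps
    i : Job
    i = fromℕ< n<
    n≡i : n ≡ toℕ i
    n≡i = sym (toℕ-fromℕ< n<)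
    go : Edge i b ⊎ (¬ Edge i b × cell i b ≡ nil) →
      ∃[ ys ] (Listed f _ ys (consIfPred tb f u acc) × PredsFrom b n ys)
    go (inj₁ e) rewrite trans (entry-adjacency (trans u≈ n≡i) b≈) (cell-edge⁺ e) =
      i ∷ xs , trans u≈ n≡i ∷ l , record
        { are-preds = λ { (here refl) → e , ≤-reflexive n≡i
                        ; (there i∈) → proj₁ (are-preds i∈) , <⇒≤ (proj₂ (are-preds i∈)) }
        ; all-preds = λ j n≤j e′ → case m≤n⇒m<n∨m≡n n≤j of λ
            { (inj₁ lt) → there (all-preds j lt e′)
            ; (inj₂ eq) → here (toℕ-injective (trans (sym eq) n≡i)) }
        ; unique = All.tabulate (λ j∈ eq → <-irrefl (trans n≡i (cong toℕ eq)) (proj₂ (are-preds j∈))) ∷ unique }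
    go (inj₂ (¬e , none)) rewrite trans (entry-adjacency (trans u≈ n≡i) b≈) none =
      xs , l , record
        { are-preds = λ i∈ → proj₁ (are-preds i∈) , <⇒≤ (proj₂ (are-preds i∈))
        ; all-preds = λ j n≤j e′ → case m≤n⇒m<n∨m≡n n≤j of λ
            { (inj₁ lt) → all-preds j lt e′
            ; (inj₂ eq) → ⊥-elim (¬e (subst (λ i → Edge i b) (toℕ-injective (trans (sym eq) n≡i)) e′)) }
        ; unique = unique }

  listing : ∀ {tb b} → Index tb b → ∀ f {rest} n → n < jobs → ∀ {acc xs} →
    Listed f rest xs acc → PredsFrom b (suc n) xs →
    ∃[ ys ] (Listed f rest ys (iter (consIfPred tb f) (downFrom n) acc) × PredsFrom b 0 ys)
  listing b≈ f zero    n< l ps = visit b≈ f n< refl l ps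
  listing b≈ f (suc n) n< l ps with ys , l′ , ps′ ← visit b≈ f n< (len-unary (suc n)) l ps =
    listing b≈ f n (<⇒≤ n<) l′ ps′

  pred< : jobs ∸ 1 < jobs
  pred< = lemma jobs source
    where
    lemma : ∀ n → Fin n → n ∸ 1 < n
    lemma (suc n) _ = ≤-refl

  listingAll : ∀ {tb b} → Index tb b → ∀ f rest →
    ∃[ ys ] (Listed f rest ys (iter (consIfPred tb f) jobIndices rest) × PredsFrom b 0 ys)
  listingAll {b = b} b≈ f rest rewrite jobIndices-spec =
    listing b≈ f (jobs ∸ 1) pred< [] record
      { are-preds = λ ()
      ; all-preds = λ i lt _ → ⊥-elim (<-irrefl refl (≤-trans (toℕ<n i) (≤-trans jobs≤ lt)))
      ; unique    = [] }
    where
    jobs≤ : jobs ≤ suc (jobs ∸ 1)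
    jobs≤ with jobs
    ... | zero  = z≤n
    ... | suc _ = ≤-refl

  -- A processing order, as a list of items, for the jobs js after a cut vertex.
  data Plan : Job → List Job → Tree → Set where
    end     : Plan sink [] nil
    segment : ∀ {a b xs js ta tb tb′ its rest} →
      Index ta a → Index tb b → Index tb′ b → Segment a xs b →
      Listed (λ x → (x ∙ ta) ∙ (nil ∙ tb)) (((tb′ ∙ ta) ∙ nil) ∙ rest) xs its →
      Plan b js rest → Plan a (xs ++ b ∷ js) its

  record Reached (r : ℕ) (acc : Tree) : Set where
    constructor reached
    field
      {b}    : Job
      {js}   : List Job
      {tb its} : Tree
      shape  : acc ≡ tb ∙ its
      index  : Index tb b
      cut    : Cut b
      plan   : Plan b js its
      rank≤  : rank b ≤ r

  walkStepᵗ : Tree → Tree → Tree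
  walkStepᵗ _ acc = ⟦ walkStep ⟧ (adjacency ∷ jobIndices ∷ acc ∷ [])

  predsᵗ : Tree → Tree
  predsᵗ tb = ⟦ preds ⟧ (adjacency ∷ jobIndices ∷ tb ∷ [])

  preds-spec : ∀ {tb b} → Index tb b → ∃[ xs ] (Listed id nil xs (predsᵗ tb) × PredsFrom b 0 xs)
  preds-spec b≈ with ys , l , ps ← listingAll b≈ id nil =
    ys , subst (Listed id nil ys) (sym preds-def) l , ps

  first-pred : ∀ {t a b xs} → Listed id nil xs t → PredsFrom b 0 xs →
    Edge a b → (∀ i → Edge i b → i ≡ a) → Index (head t) a
  first-pred {a = a} [] ps e only with () ← PredsFrom.all-preds ps a z≤n e
  first-pred (x≈ ∷ _) ps e only = trans x≈ (cong toℕ (only _ (proj₁ (PredsFrom.are-preds ps (here refl)))))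

  walkStep-reached : ∀ {r acc} → Reached (suc r) acc → Reached r (walkStepᵗ nil acc)
  walkStep-reached {r} (reached {b} {js} {tb} {its} refl b≈ cut plan rank≤)
    with preds-spec b≈
  ... | xs , l , ps rewrite walkStep-def {adjacency} {jobIndices} {tb} {its} with predsᵗ tb in eq | xs | l
  -- An edge replaced by no jobs at all would leave a second vertex without predecessors. Uniqueness
  -- of the source rules this out, so the walk has arrived.
  ... | .nil | [] | [] = reached refl b≈ cut plan
    (subst (_≤ r) (sym (trans (cong rank b≡source) rank-source)) z≤n)
    where
    b≡source : b ≡ source
    b≡source = Equivalence.to (unique-source b) λ i e → case PredsFrom.all-preds ps i z≤n e of λ ()
  ... | ta ∙ .nil | a ∷ [] | a≈ ∷ [] =
    reached refl a≈ (proj₁ direct) (segment a≈ b≈ b≈ (proj₂ direct) [] plan)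
      (≤-pred (≤-trans (Segment.forward (proj₂ direct)) rank≤))
    where
    direct : Cut a × Segment a [] b
    direct = direct-segment cut (proj₁ (PredsFrom.are-preds ps (here refl)))
      λ i e → case PredsFrom.all-preds ps i z≤n e of λ { (here refl) → refl }
  ... | t₁ ∙ (t₂ ∙ _) | a₁ ∷ a₂ ∷ ys | a₁≈ ∷ (_ ∷ _) = go (preds-spec a₁≈)
    where
    open PredsFrom ps
    a₁≢a₂ : a₁ ≢ a₂
    a₁≢a₂ with (p ∷ _) ∷ _ ← unique = p
    ta = head (predsᵗ t₁)
    go : ∃[ zs ] (Listed id nil zs (predsᵗ t₁) × PredsFrom a₁ 0 zs) →
      Reached r (ta ∙ ⟦ mids ⟧ (adjacency ∷ jobIndices ∷ ta ∷ tb ∷ (((tb ∙ ta) ∙ nil) ∙ its) ∷ []))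
    go (zs , m , qs)
      with listingAll b≈ (λ x → (x ∙ ta) ∙ (nil ∙ tb)) (((tb ∙ ta) ∙ nil) ∙ its)
    ... | ws , n , os
      with parallel-segment a₁≢a₂ (proj₁ (are-preds (here refl))) (proj₁ (are-preds (there (here refl))))
             (PredsFrom.unique os) (λ i∈ → proj₁ (PredsFrom.are-preds os i∈))
             (λ i e → PredsFrom.all-preds os i z≤n e)
    ... | a , e , only , cutₐ , seg =
      reached refl ta≈ cutₐ (segment ta≈ b≈ b≈ seg (subst (Listed _ _ ws) (sym mids-def) n) plan)
        (≤-pred (≤-trans (Segment.forward seg) rank≤))
      where
      ta≈ : Index ta a
      ta≈ = first-pred m qs e only

  iter-walkStep : ∀ F {r acc} → Reached (len F + r) acc → Reached r (iter walkStepᵗ F acc)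
  iter-walkStep nil     c = c
  iter-walkStep (_ ∙ F) c = iter-walkStep F (walkStep-reached c)

  items : Tree
  items = ⟦ walk ⟧ (adjacency ∷ ⟦ toUnary ⟧ (adjacency ∷ sinkOf (encodeInstance I) ∷ []) ∷
    ⟦ horizon ⟧ (adjacency ∷ []) ∷ [])

  sink-index : Index (⟦ toUnary ⟧ (adjacency ∷ sinkOf (encodeInstance I) ∷ [])) sink
  sink-index with capped below exact ← toUnary-spec adjacency (sinkOf (encodeInstance I))
    rewrite bval-encodeℕ (toℕ sink) | len-adjacency =
    exact (≤-trans below (<⇒≤ (toℕ<n sink)))

  -- The horizon serves as the step count of the walk: the rank of the sink is at most twice the
  -- number of jobs, and each step lowers the rank.
  enough-steps : 2* jobs ≤ len (⟦ horizon ⟧ (adjacency ∷ [])) + 0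
  enough-steps rewrite len-horizon adjacency | len-adjacency = begin
    jobs + jobs                  ≡⟨ cong (jobs +_) (+-identityʳ jobs) ⟨
    2 * jobs                     ≡⟨ *-comm 2 jobs ⟩
    jobs * 2                     ≤⟨ *-monoʳ-≤ jobs (≤-trans (m≤m+n 2 188) 190≤horizonFactor) ⟩
    jobs * horizonFactor         ≡⟨ +-identityʳ _ ⟨
    jobs * horizonFactor + 0     ∎
    where open ≤-Reasoning

  opaque
    items-plan : ∃[ js ] Plan source js items
    items-plan
      with reached {b} {js} shape index cut plan rank≤ ← iter-walkStep (⟦ horizon ⟧ (adjacency ∷ [])) {0}
             {⟦ toUnary ⟧ (adjacency ∷ sinkOf (encodeInstance I) ∷ []) ∙ nil}
             (reached refl sink-index sink-cut end (≤-trans rank-sink≤ enough-steps)) =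
      js , subst₂ (λ b its → Plan b js its)
        (sym (cut source (trans rank-source (sym (n≤0⇒n≡0 rank≤)))))
        (sym (trans walk-def (cong tail shape))) plan

-- The dynamic program

bval-sum< : ∀ a b → bval a + bval b < 2 ^ (2 + (len a + len b))
bval-sum< a b = begin-strict
  bval a + bval b                             <⟨ +-mono-<-≤ (digit-bound a) (<⇒≤ (digit-bound b)) ⟩
  2 ^ suc (len a) + 2 ^ suc (len b)           ≤⟨ +-mono-≤ (^-monoʳ-≤ 2 (s≤s (m≤m+n (len a) (len b))))
                                                           (^-monoʳ-≤ 2 (s≤s (m≤n+m (len b) (len a)))) ⟩
  2 ^ suc (len a + len b) + 2 ^ suc (len a + len b)
    ≡⟨ cong (2 ^ suc (len a + len b) +_) (+-identityʳ _) ⟨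
  2 ^ (2 + (len a + len b))                   ∎
  where
  open ≤-Reasoning
  digit-bound : ∀ t → bval t < 2 ^ suc (len t)
  digit-bound t = ≤-trans (≤-reflexive (+-comm 1 _)) (≤-trans (+-monoʳ-≤ (bval t) (s≤s z≤n)) (digits< t))

bval<fuel : ∀ a → bval a < 2 ^ (2 + len a)
bval<fuel a = subst₂ (λ m n → m < 2 ^ (2 + n)) (+-identityʳ (bval a)) (+-identityʳ (len a)) (bval-sum< a nil)

iter-cons⁺ : ∀ {P : Tree → Tree → Set} (f : Tree → Tree) A →
  (∀ v → v ∈ A → P v (f v)) →
  (R : Tree → Tree → Set) → (∀ {v e us es} → P v e → R us es → R (v ∙ us) (e ∙ es)) →
  ∀ {us es} → R us es → R (revOnto A us) (iter (λ v t → f v ∙ t) A es)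
iter-cons⁺ f nil p R snoc r = r
iter-cons⁺ f (v ∙ A) p R snoc r =
  iter-cons⁺ f A (λ v v∈ → p v (there v∈)) R snoc (snoc (p v here) r)

module Program (e H I A : Tree) where
  c : Tree
  c = e ∙ (H ∙ I)

  budget# : ℕ
  budget# = bval (budgetOf I)

  weight# : Tree → Tree → ℕ
  weight# it v = bval (⟦ weight ⟧ (I ∷ it ∷ v ∷ []))

  -- Sets of triples of a state, the cost spent to reach it, and the records
  -- made on the way.
  Triples : Set₁
  Triples = Tree → ℕ → Tree → Set

  Init : Triples
  Init v k tr = v ∈ A × Yes (⟦ isInitial ⟧ (v ∷ [])) × k ≡ 0 × tr ≡ nil

  data Next (it : Tree) (P : Triples) (v : Tree) : ℕ → Tree → Set where
    next : ∀ {u k tr} → v ∈ A → u ∈ A → P u k tr → Yes (⟦ check ⟧ (c ∷ it ∷ u ∷ v ∷ [])) →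
      k + weight# it v ≤ budget# → Next it P v (k + weight# it v) (⟦ record̂ ⟧ (it ∷ v ∷ []) ∙ tr)

  Reach : Tree → Triples → Triples
  Reach nil        P = P
  Reach (it ∙ its) P = Reach its (Next it P)

  -- The admissible continuations depend on the state alone, so the cheapest way to a state can
  -- replace every other one; which trace it has does not matter.
  record Entry (P : Triples) (v en : Tree) : Set where
    field
      attained : Yes en → P v (bval (head en)) (tail en)
      minimal  : ∀ {k tr} → P v k tr → Yes en × bval (head en) ≤ k

  data Table (P : Triples) : Tree → Tree → Set where
    []  : Table P nil nil
    _∷_ : ∀ {v en vs ens} → Entry P v en → Table P vs ens → Table P (v ∙ vs) (en ∙ ens)

  R : Tree
  R = ⟦ reverse ⟧ (A ∷ [])

  R-def : R ≡ revOnto A nil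
  R-def = reverse-spec A

  ∈-R⁺ : ∀ {v} → v ∈ A → v ∈ R
  ∈-R⁺ {v} v∈ = subst (v ∈_) (sym R-def) (∈-revOnto⁺ˡ A nil v∈)

  ∈-R⁻ : ∀ {v} → v ∈ R → v ∈ A
  ∈-R⁻ {v} v∈ with ∈-revOnto⁻ A nil (subst (v ∈_) R-def v∈)
  ... | inj₁ v∈A = v∈A

  table⁺ : ∀ {P} (f : Tree → Tree) → (∀ v → v ∈ A → Entry P v (f v)) →
    Table P R (iter (λ v t → f v ∙ t) A nil)
  table⁺ {P} f p = subst (λ us → Table P us (iter (λ v t → f v ∙ t) A nil)) (sym R-def)
    (iter-cons⁺ {P = Entry P} f A p (Table P) _∷_ [])

  budgetFuel : Tree
  budgetFuel = nil ∙ (nil ∙ budgetOf I)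

  Affordable : Tree → Set
  Affordable b = Yes b → bval (head b) ≤ budget#

  record Better (en b r : Tree) : Set where
    field
      exists : Yes r
      origin : r ≡ en ⊎ (Yes b × r ≡ b)
      ≤new   : bval (head r) ≤ bval (head en)
      ≤old   : Yes b → bval (head r) ≤ bval (head b)

  better-spec : ∀ en b → Yes en → Affordable en → Affordable b →
    Better en b (⟦ better ⟧ (budgetOf I ∷ en ∷ b ∷ []))
  better-spec en b y en≤ b≤ rewrite better-def {budgetOf I} {en} {b} with b
  ... | nil = record { exists = y ; origin = inj₁ refl ; ≤new = ≤-refl ; ≤old = λ () }
  ... | b₁ ∙ b₂ with ⟦ leqB ⟧ (budgetFuel ∷ head en ∷ b₁ ∷ []) in eq
  ...   | _ ∙ _ = record { exists = y ; origin = inj₁ refl ; ≤new = ≤-refl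
      ; ≤old = λ _ → leqB⁻ budgetFuel (head en) b₁ (bound (en≤ y)) (bound (b≤ tt)) (subst Yes (sym eq) tt) }
    where
    bound : ∀ {k} → k ≤ budget# → k < 2 ^ (2 + len (budgetOf I))
    bound le = ≤-trans (s≤s le) (bval<fuel (budgetOf I))
  ...   | nil = record { exists = tt ; origin = inj₂ (tt , refl) ; ≤old = λ _ → ≤-refl
      ; ≤new = <⇒≤ (≰⇒> λ le → subst Yes eq (leqB⁺ budgetFuel (head en) b₁ (bound (en≤ y)) (bound (b≤ tt)) le)) }
    where
    bound : ∀ {k} → k ≤ budget# → k < 2 ^ (2 + len (budgetOf I))
    bound le = ≤-trans (s≤s le) (bval<fuel (budgetOf I))

  -- Ensures that the fuel taken from the budget is long enough to compare the costs in a table.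
  BudgetKept : Triples → Set
  BudgetKept P = ∀ {v k tr} → P v k tr → k ≤ budget#

  bestStep : Tree → Tree → Tree → Tree → Tree
  bestStep it v u a = tail (head a) ∙
    cond (head (head a))
      (cond (⟦ check ⟧ (c ∷ it ∷ u ∷ v ∷ []))
        (⟦ better ⟧ (budgetOf I ∷ head (head a) ∷ tail a ∷ [])) (tail a))
      (tail a)

  Pred : Triples → Tree → Tree → Tree → Set
  Pred P it v b = Yes b → ∃[ u ] (u ∈ R × Yes (⟦ check ⟧ (c ∷ it ∷ u ∷ v ∷ [])) × P u (bval (head b)) (tail b))

  record BestPred (P : Triples) (it v us b₀ b : Tree) : Set where
    field
      attained : Pred P it v b
      minimal  : ∀ {u k tr} → u ∈ us → Yes (⟦ check ⟧ (c ∷ it ∷ u ∷ v ∷ [])) → P u k tr →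
                 Yes b × bval (head b) ≤ k
      ≤initial : Yes b₀ → Yes b × bval (head b) ≤ bval (head b₀)

  module _ {P : Triples} (kept : BudgetKept P) (it v : Tree) where
    affordable : ∀ {b} → Pred P it v b → Affordable b
    affordable p y with _ , _ , _ , q ← p y = kept q

    record Step (u b r : Tree) : Set where
      field
        attained : Pred P it v r
        minimal  : ∀ {k tr} → Yes (⟦ check ⟧ (c ∷ it ∷ u ∷ v ∷ [])) → P u k tr → Yes r × bval (head r) ≤ k
        ≤old     : Yes b → Yes r × bval (head r) ≤ bval (head b)

    bestStep-spec : ∀ {u en b} → u ∈ R → Entry P u en → Pred P it v b →
      Step u b (cond en (cond (⟦ check ⟧ (c ∷ it ∷ u ∷ v ∷ []))
        (⟦ better ⟧ (budgetOf I ∷ en ∷ b ∷ [])) b) b)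
    bestStep-spec {u} {nil} u∈ entry p = record
      { attained = p ; minimal = λ _ q → ⊥-elim (proj₁ (Entry.minimal entry q)) ; ≤old = λ y → y , ≤-refl }
    bestStep-spec {u} {en@(_ ∙ _)} {b} u∈ entry p with ⟦ check ⟧ (c ∷ it ∷ u ∷ v ∷ []) in eq
    ... | nil = record { attained = p ; minimal = λ chk _ → ⊥-elim (subst Yes eq chk) ; ≤old = λ y → y , ≤-refl }
    ... | _ ∙ _ = record
      { attained = λ _ → found (Better.origin bt)
      ; minimal = λ _ q → Better.exists bt , ≤-trans (Better.≤new bt) (proj₂ (Entry.minimal entry q))
      ; ≤old = λ y → Better.exists bt , Better.≤old bt y }
      where
      r = ⟦ better ⟧ (budgetOf I ∷ en ∷ b ∷ [])
      bt : Better en b r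
      bt = better-spec en b tt (λ _ → kept (Entry.attained entry tt)) (affordable {b} p)
      found : r ≡ en ⊎ (Yes b × r ≡ b) →
        ∃[ w ] (w ∈ R × Yes (⟦ check ⟧ (c ∷ it ∷ w ∷ v ∷ [])) × P w (bval (head r)) (tail r))
      found (inj₁ r≡) rewrite r≡ = u , u∈ , subst Yes (sym eq) tt , Entry.attained entry tt
      found (inj₂ (y , r≡)) rewrite r≡ = p y

    best-loop : ∀ {us ens b} → (∀ {u} → u ∈ us → u ∈ R) → Table P us ens → Pred P it v b →
      BestPred P it v us b (tail (iter (bestStep it v) us (ens ∙ b)))
    best-loop sub [] p = record { attained = p ; minimal = λ () ; ≤initial = λ y → y , ≤-refl }
    best-loop {u ∙ us} {en ∙ ens} {b} sub (entry ∷ table) p = record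
      { attained = BestPred.attained rest
      ; minimal = λ { here chk q → after (Step.minimal s chk q) ; (there u∈) → BestPred.minimal rest u∈ }
      ; ≤initial = λ y → after (Step.≤old s y) }
      where
      a r : Tree
      a = bestStep it v u ((en ∙ ens) ∙ b)
      r = tail (iter (bestStep it v) us a)
      s = bestStep-spec (sub here) entry p
      rest = best-loop (λ u∈ → sub (there u∈)) table (Step.attained s)
      after : ∀ {k} → Yes (tail a) × bval (head (tail a)) ≤ k → Yes r × bval (head r) ≤ k
      after (y , le) with y′ , le′ ← BestPred.≤initial rest y = y′ , ≤-trans le′ le

    extend-spec : v ∈ A → ∀ {b} → BestPred P it v R nil b →
      Entry (Next it P) v (⟦ extend ⟧ (c ∷ it ∷ v ∷ b ∷ []))
    extend-spec v∈ {b} best rewrite extend-def {e} {H} {I} {it} {v} {b} with b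
    ... | nil = record { attained = λ () ; minimal = λ { (next _ u∈ q chk _) →
            ⊥-elim (proj₁ (BestPred.minimal best (∈-R⁺ u∈) chk q)) } }
    ... | b₁ ∙ b₂ = go (BestPred.attained best tt)
      where
      w F s : Tree
      w = ⟦ weight ⟧ (I ∷ it ∷ v ∷ [])
      F = nil ∙ (nil ∙ ⟦ append ⟧ (w ∷ budgetOf I ∷ []))
      s = ⟦ addB ⟧ (F ∷ b₁ ∷ w ∷ [])
      go : ∃[ u ] (u ∈ R × Yes (⟦ check ⟧ (c ∷ it ∷ u ∷ v ∷ [])) × P u (bval b₁) b₂) →
        Entry (Next it P) v (cond (⟦ leqB ⟧ (F ∷ s ∷ budgetOf I ∷ [])) (s ∙ (⟦ record̂ ⟧ (it ∷ v ∷ []) ∙ b₂)) nil)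
      go (u , u∈ , chk , q) = extended
        where
        len-F : len F ≡ 2 + (len w + len (budgetOf I))
        len-F = cong (2 +_) (trans (cong len (append-spec w (budgetOf I))) (len-revOnto w (budgetOf I)))
        total< : bval b₁ + bval w < 2 ^ len F
        total< = subst (λ m → bval b₁ + bval w < 2 ^ m) (sym len-F) (≤-trans
          (s≤s (≤-trans (+-monoˡ-≤ (bval w) (kept q)) (≤-reflexive (+-comm budget# (bval w)))))
          (bval-sum< w (budgetOf I)))
        s≡ : bval s ≡ bval b₁ + bval w
        s≡ = addB-spec F b₁ w total<
        s< : bval s < 2 ^ len F
        s< = subst (_< 2 ^ len F) (sym s≡) total<
        B< : budget# < 2 ^ len F
        B< = subst (λ m → budget# < 2 ^ m) (sym len-F)
          (≤-trans (s≤s (m≤n+m budget# (bval w))) (bval-sum< w (budgetOf I)))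
        extended : Entry (Next it P) v (cond (⟦ leqB ⟧ (F ∷ s ∷ budgetOf I ∷ [])) (s ∙ (⟦ record̂ ⟧ (it ∷ v ∷ []) ∙ b₂)) nil)
        extended with ⟦ leqB ⟧ (F ∷ s ∷ budgetOf I ∷ []) in eq
        -- If the cheapest predecessor exceeds the budget, all of them do.
        ... | nil = record { attained = λ () ; minimal = λ { (next _ u∈′ q′ chk′ le) →
                ⊥-elim (subst Yes eq (leqB⁺ F s (budgetOf I) s< B<
                  (≤-trans (≤-reflexive s≡) (≤-trans (+-monoˡ-≤ (bval w)
                    (proj₂ (BestPred.minimal best (∈-R⁺ u∈′) chk′ q′))) le)))) } }
        ... | _ ∙ _ = record
          { attained = λ _ → subst (λ k → Next it P v k _) (sym s≡) (next v∈ (∈-R⁻ u∈) q chk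
              (≤-trans (≤-reflexive (sym s≡)) (leqB⁻ F s (budgetOf I) s< B< (subst Yes (sym eq) tt))))
          ; minimal = λ { (next _ u∈′ q′ chk′ le) → tt , ≤-trans (≤-reflexive s≡) (+-monoˡ-≤ (bval w)
              (proj₂ (BestPred.minimal best (∈-R⁺ u∈′) chk′ q′))) } }

  step-spec : ∀ {P T} it → BudgetKept P → Table P R T →
    Table (Next it P) R (⟦ step ⟧ (c ∷ it ∷ A ∷ R ∷ T ∷ []))
  step-spec {P} {T} it kept table rewrite step-def {c} {it} {A} {R} {T} =
    table⁺ (λ v → ⟦ extend ⟧ (c ∷ it ∷ v ∷ ⟦ bestPred ⟧ (c ∷ it ∷ R ∷ T ∷ v ∷ []) ∷ [])) λ v v∈ →
      extend-spec kept it v v∈ (subst (BestPred P it v R nil) (sym bestPred-def)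
        (best-loop kept it v id table λ ()))

  next-kept : ∀ {it P} → BudgetKept (Next it P)
  next-kept (next _ _ _ _ le) = le

  steps-spec : ∀ its {P T} → BudgetKept P → Table P R T →
    Table (Reach its P) R (iter (λ it T → ⟦ step ⟧ (c ∷ it ∷ A ∷ R ∷ T ∷ [])) its T)
  steps-spec nil        kept table = table
  steps-spec (it ∙ its) kept table = steps-spec its next-kept (step-spec it kept table)

  init-entry : ∀ v → v ∈ A → Entry Init v (cond (⟦ isInitial ⟧ (v ∷ [])) (nil ∙ nil) nil)
  init-entry v v∈ with ⟦ isInitial ⟧ (v ∷ []) in eq
  ... | nil = record { attained = λ () ; minimal = λ (_ , y , _) → subst Yes eq y , z≤n }
  ... | _ ∙ _ = record { attained = λ _ → v∈ , subst Yes (sym eq) tt , refl , refl ; minimal = λ _ → tt , z≤n }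

  init-kept : BudgetKept Init
  init-kept (_ , _ , k≡0 , _) = subst (_≤ budget#) (sym k≡0) z≤n

  reach-kept : ∀ its {P} → BudgetKept P → BudgetKept (Reach its P)
  reach-kept nil        kept = kept
  reach-kept (it ∙ its) kept = reach-kept its next-kept

  finalTable-spec : ∀ its → Table (Reach its Init) R (⟦ finalTable ⟧ (c ∷ its ∷ A ∷ R ∷ []))
  finalTable-spec its rewrite finalTable-def {c} {its} {A} {R} =
    steps-spec its init-kept (subst (Table Init R) (sym initialTable-def)
      (table⁺ (λ v → cond (⟦ isInitial ⟧ (v ∷ [])) (nil ∙ nil) nil) init-entry))

  selectStep : Tree → Tree → Tree
  selectStep u a = tail (head a) ∙
    cond (head (head a))
      (cond (⟦ eqU ⟧ (from u ∷ nil ∷ []))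
        (cond (tail a)
          (cond (⟦ leqU ⟧ (base u ∷ head (tail a) ∷ [])) (base u ∙ tail (head (head a))) (tail a))
          (base u ∙ tail (head (head a))))
        (tail a))
      (tail a)

  Found : Triples → Tree → Set
  Found P r = Yes r → ∃[ u ] ∃[ k ] (u ∈ R × len (from u) ≡ 0 × head r ≡ base u × P u k (tail r))

  record Selected (P : Triples) (us b r : Tree) : Set where
    field
      attained : Found P r
      minimal  : ∀ {u k tr} → u ∈ us → len (from u) ≡ 0 → P u k tr → Yes r × len (head r) ≤ len (base u)
      ≤initial : Yes b → Yes r × len (head r) ≤ len (head b)

  selectStep-spec : ∀ {P u en b} → u ∈ R → Entry P u en → Found P b →
    Selected P (u ∙ nil) b (cond en
      (cond (⟦ eqU ⟧ (from u ∷ nil ∷ []))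
        (cond b (cond (⟦ leqU ⟧ (base u ∷ head b ∷ [])) (base u ∙ tail en) b) (base u ∙ tail en)) b) b)
  selectStep-spec {en = nil} u∈ entry found = record
    { attained = found
    ; minimal = λ { here _ q → ⊥-elim (proj₁ (Entry.minimal entry q)) }
    ; ≤initial = λ y → y , ≤-refl }
  selectStep-spec {u = u} {en@(_ ∙ _)} {b} u∈ entry found with ⟦ eqU ⟧ (from u ∷ nil ∷ []) in eq
  ... | nil = record
    { attained = found
    ; minimal = λ { here z _ → ⊥-elim (subst Yes eq (eqU⁺ {from u} {nil} z)) }
    ; ≤initial = λ y → y , ≤-refl }
  ... | _ ∙ _ with b
  ...   | nil = record
    { attained = λ _ → u , _ , u∈ , eqU⁻ {from u} {nil} (subst Yes (sym eq) tt) , refl , Entry.attained entry tt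
    ; minimal = λ { here _ _ → tt , ≤-refl }
    ; ≤initial = λ () }
  ...   | b₁ ∙ b₂ with ⟦ leqU ⟧ (base u ∷ b₁ ∷ []) in eq′
  ...     | nil = record
    { attained = found
    ; minimal = λ { here _ _ → tt , <⇒≤ (≰⇒> λ le → subst Yes eq′ (leqU⁺ le)) }
    ; ≤initial = λ y → y , ≤-refl }
  ...     | _ ∙ _ = record
    { attained = λ _ → u , _ , u∈ , eqU⁻ {from u} {nil} (subst Yes (sym eq) tt) , refl , Entry.attained entry tt
    ; minimal = λ { here _ _ → tt , ≤-refl }
    ; ≤initial = λ _ → tt , leqU⁻ (subst Yes (sym eq′) tt) }

  select-loop : ∀ {P us ens b} → (∀ {u} → u ∈ us → u ∈ R) → Table P us ens → Found P b →
    Selected P us b (tail (iter selectStep us (ens ∙ b)))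
  select-loop sub [] found = record { attained = found ; minimal = λ () ; ≤initial = λ y → y , ≤-refl }
  select-loop {us = u ∙ us} {en ∙ ens} {b} sub (entry ∷ table) found = record
    { attained = Selected.attained rest
    ; minimal = λ { here z q → after (Selected.minimal s here z q) ; (there u∈) → Selected.minimal rest u∈ }
    ; ≤initial = λ y → after (Selected.≤initial s y) }
    where
    a r : Tree
    a = selectStep u ((en ∙ ens) ∙ b)
    r = tail (iter selectStep us a)
    s = selectStep-spec (sub here) entry found
    rest = select-loop (λ u∈ → sub (there u∈)) table (Selected.attained s)
    after : ∀ {k} → Yes (tail a) × len (head (tail a)) ≤ k → Yes r × len (head r) ≤ k
    after (y , le) with y′ , le′ ← Selected.≤initial rest y = y′ , ≤-trans le′ le

  solve-spec : ∀ its → Selected (Reach its Init) R nil (⟦ solve ⟧ (c ∷ its ∷ A ∷ []))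
  solve-spec its = subst (Selected (Reach its Init) R nil)
    (sym (trans (solve-def {c} {its} {A}) (select-def {R} {⟦ finalTable ⟧ (c ∷ its ∷ A ∷ R ∷ [])})))
    (select-loop id (finalTable-spec its) λ ())

-- Rounded instances

ctx#-injective : ∀ {k} {α β : Context k} → ctx# α ≡ ctx# β → α ≡ β
ctx#-injective {α = server}  {server}  _  = refl
ctx#-injective {α = cloud c} {cloud d} eq = cong cloud (toℕ-injective (suc-injective eq))

ctx#≤ : ∀ {k} (α : Context k) → ctx# α ≤ k
ctx#≤ server    = z≤n
ctx#≤ (cloud c) = toℕ<n c

context-of : ∀ {k} m → m ≤ k → ∃[ α ] m ≡ ctx# {k} α
context-of zero    _  = server , refl
context-of (suc m) m< = cloud (fromℕ< m<) , cong suc (sym (toℕ-fromℕ< m<))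

head-table : ∀ {n} (f : Fin n → Tree) → Fin n → ∃[ j ] head (encodeTable f) ≡ f j
head-table {suc n} f _ = zero , refl

record MidOk (c x a b u v : Tree) : Set where
  field
    from≡    : len (from v) ≡ len (from u)
    to≡      : len (to v) ≡ len (to u)
    span≡    : len (span v) ≡ len (span u)
    base≡    : len (base v) ≡ len (base u)
    latency≤ : len (⟦ latency ⟧ (c ∷ x ∷ a ∷ b ∷ u ∷ v ∷ [])) ≤ len (span u)

data Move (p : ℕ) (u v : Tree) : Set where
  outside : Yes (cur v) → len (mach v) ≡ len (mach u) → len (load v) ≡ len (load u) → Move p u v
  stay    : cur v ≡ nil → len (mach v) ≡ len (mach u) → len (load u) ≤ len (span u) →
            len (load v) ≡ len (load u) + p → Move p u v
  advance : cur v ≡ nil → len (mach v) ≡ suc (len (mach u)) → len (load v) ≡ p → Move p u v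

-- The last conjunct of `midOk` as a function of values, to which it reduces by computation.
moveTest : Tree → Tree → Tree → Tree
moveTest p u v = cond (cur v)
  (cond (⟦ eqU ⟧ (mach v ∷ mach u ∷ [])) (⟦ eqU ⟧ (load v ∷ load u ∷ [])) nil)
  (cond (⟦ eqU ⟧ (mach v ∷ mach u ∷ []))
    (cond (⟦ leqU ⟧ (load u ∷ span u ∷ [])) (⟦ eqU ⟧ (load v ∷ ⟦ addU ⟧ (load u ∷ p ∷ []) ∷ [])) nil)
    (cond (⟦ eqU ⟧ (mach v ∷ (nil ∙ mach u) ∷ [])) (⟦ eqU ⟧ (load v ∷ p ∷ [])) nil))

move⁻ : ∀ {p u v} → Yes (moveTest p u v) → Move (len p) u v
move⁻ {p} {u} {v} y with cur v in eq
... | _ ∙ _ with q , l ← and⁻ {⟦ eqU ⟧ (mach v ∷ mach u ∷ [])} y =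
  outside (subst Yes (sym eq) tt) (eqU⁻ q) (eqU⁻ l)
... | nil with ⟦ eqU ⟧ (mach v ∷ mach u ∷ []) in eq′
...   | _ ∙ _ with le , l ← and⁻ {⟦ leqU ⟧ (load u ∷ span u ∷ [])} y =
  stay eq (eqU⁻ (subst Yes (sym eq′) tt)) (leqU⁻ le) (trans (eqU⁻ l) (len-addU (load u) p))
...   | nil with q , l ← and⁻ {⟦ eqU ⟧ (mach v ∷ (nil ∙ mach u) ∷ [])} y =
  advance eq (eqU⁻ q) (eqU⁻ l)

move⁺ : ∀ {p u v} → Move (len p) u v → Yes (moveTest p u v)
move⁺ {p} {u} {v} (outside y q l) with cur v
... | _ ∙ _ = and⁺ (eqU⁺ q) (eqU⁺ l)
move⁺ {p} {u} {v} (stay n q le l) rewrite n with ⟦ eqU ⟧ (mach v ∷ mach u ∷ []) in eq′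
... | nil = ⊥-elim (subst Yes eq′ (eqU⁺ q))
... | _ ∙ _ = and⁺ (leqU⁺ le) (eqU⁺ (trans l (sym (len-addU (load u) _))))
move⁺ {p} {u} {v} (advance n q l) rewrite n with ⟦ eqU ⟧ (mach v ∷ mach u ∷ []) in eq′
... | _ ∙ _ = ⊥-elim (1+n≢n (trans (sym q) (eqU⁻ (subst Yes (sym eq′) tt))))
... | nil = and⁺ (eqU⁺ {b = nil ∙ mach u} q) (eqU⁺ l)

record ChainOk (c x a u v : Tree) : Set where
  field
    cur≡   : len (cur v) ≡ len (to u)
    from≡  : len (from v) ≡ len (to u)
    base≡  : len (base v) ≡ len (⟦ duration̂ ⟧ (c ∷ to u ∷ x ∷ [])) +
             (len (span u) + (len (span u) + (len (span u) + len (base u))))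
    delay≤ : len (⟦ delaŷ ⟧ (c ∷ from u ∷ to u ∷ a ∷ x ∷ [])) ≤ len (span u)
    mach≡  : len (mach v) ≡ 0
    load≡  : len (load v) ≡ 0

opaque
  unfolding check

  midOk⁻ : ∀ {c x a b u v} → Yes (⟦ midOk ⟧ (c ∷ x ∷ a ∷ b ∷ u ∷ v ∷ [])) →
    MidOk c x a b u v × Move (len (⟦ duration̂ ⟧ (c ∷ cur v ∷ x ∷ []))) u v
  midOk⁻ {c} {x} {a} {b} {u} {v} y
    with y₁ , y ← and⁻ {⟦ eqU ⟧ (from v ∷ from u ∷ [])} y
    with y₂ , y ← and⁻ {⟦ eqU ⟧ (to v ∷ to u ∷ [])} y
    with y₃ , y ← and⁻ {⟦ eqU ⟧ (span v ∷ span u ∷ [])} y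
    with y₄ , y ← and⁻ {⟦ eqU ⟧ (base v ∷ base u ∷ [])} y
    with y₅ , y ← and⁻ {⟦ leqU ⟧ (⟦ latency ⟧ (c ∷ x ∷ a ∷ b ∷ u ∷ v ∷ []) ∷ span u ∷ [])} y =
    record { from≡ = eqU⁻ y₁ ; to≡ = eqU⁻ y₂ ; span≡ = eqU⁻ y₃ ; base≡ = eqU⁻ y₄ ; latency≤ = leqU⁻ y₅ } ,
    move⁻ {⟦ duration̂ ⟧ (c ∷ cur v ∷ x ∷ [])} {u} {v} y

  midOk⁺ : ∀ {c x a b u v} → MidOk c x a b u v → Move (len (⟦ duration̂ ⟧ (c ∷ cur v ∷ x ∷ []))) u v →
    Yes (⟦ midOk ⟧ (c ∷ x ∷ a ∷ b ∷ u ∷ v ∷ []))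
  midOk⁺ {c} {x} {a} {b} {u} {v} ok move =
    and⁺ (eqU⁺ from≡) (and⁺ (eqU⁺ to≡) (and⁺ (eqU⁺ span≡) (and⁺ (eqU⁺ base≡) (and⁺ (leqU⁺ latency≤)
      (move⁺ {⟦ duration̂ ⟧ (c ∷ cur v ∷ x ∷ [])} move)))))
    where open MidOk ok

  total : ∀ c x u → len (⟦ addU ⟧ (⟦ duration̂ ⟧ (c ∷ to u ∷ x ∷ []) ∷
      ⟦ addU ⟧ (span u ∷ ⟦ addU ⟧ (span u ∷ ⟦ addU ⟧ (span u ∷ base u ∷ []) ∷ []) ∷ []) ∷ [])) ≡
    len (⟦ duration̂ ⟧ (c ∷ to u ∷ x ∷ [])) + (len (span u) + (len (span u) + (len (span u) + len (base u))))
  total c x u = trans (len-addU (⟦ duration̂ ⟧ (c ∷ to u ∷ x ∷ [])) _)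
    (cong (len (⟦ duration̂ ⟧ (c ∷ to u ∷ x ∷ [])) +_) (trans (len-addU (span u) _)
      (cong (len (span u) +_) (trans (len-addU (span u) _)
        (cong (len (span u) +_) (len-addU (span u) (base u)))))))

  chainOk⁻ : ∀ {c x a u v} → Yes (⟦ chainOk ⟧ (c ∷ x ∷ a ∷ u ∷ v ∷ [])) → ChainOk c x a u v
  chainOk⁻ {c} {x} {a} {u} {v} y
    with y₁ , y ← and⁻ {⟦ eqU ⟧ (cur v ∷ to u ∷ [])} y
    with y₂ , y ← and⁻ {⟦ eqU ⟧ (from v ∷ to u ∷ [])} y
    with y₃ , y ← and⁻ {⟦ eqU ⟧ (base v ∷ ⟦ addU ⟧ (⟦ duration̂ ⟧ (c ∷ to u ∷ x ∷ []) ∷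
      ⟦ addU ⟧ (span u ∷ ⟦ addU ⟧ (span u ∷ ⟦ addU ⟧ (span u ∷ base u ∷ []) ∷ []) ∷ []) ∷ []) ∷ [])} y
    with y₄ , y ← and⁻ {⟦ leqU ⟧ (⟦ delaŷ ⟧ (c ∷ from u ∷ to u ∷ a ∷ x ∷ []) ∷ span u ∷ [])} y
    with y₅ , y₆ ← and⁻ {⟦ eqU ⟧ (mach v ∷ nil ∷ [])} y = record
    { cur≡ = eqU⁻ y₁ ; from≡ = eqU⁻ y₂ ; base≡ = trans (eqU⁻ y₃) (total c x u)
    ; delay≤ = leqU⁻ y₄ ; mach≡ = eqU⁻ y₅ ; load≡ = eqU⁻ y₆ }

  chainOk⁺ : ∀ {c x a u v} → ChainOk c x a u v → Yes (⟦ chainOk ⟧ (c ∷ x ∷ a ∷ u ∷ v ∷ []))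
  chainOk⁺ {c} {x} {a} {u} {v} ok =
    and⁺ (eqU⁺ cur≡) (and⁺ (eqU⁺ from≡) (and⁺ (eqU⁺ (trans base≡ (sym (total c x u))))
      (and⁺ (leqU⁺ delay≤) (and⁺ (eqU⁺ mach≡) (eqU⁺ load≡)))))
    where open ChainOk ok

record Initial (v : Tree) : Set where
  field
    from≡ : len (from v) ≡ 0
    base≡ : len (base v) ≡ 0
    mach≡ : len (mach v) ≡ 0
    load≡ : len (load v) ≡ 0

opaque
  unfolding isInitial

  isInitial⁻ : ∀ {v} → Yes (⟦ isInitial ⟧ (v ∷ [])) → Initial v
  isInitial⁻ {v} y
    with y₁ , y ← and⁻ {⟦ eqU ⟧ (from v ∷ nil ∷ [])} y
    with y₂ , y ← and⁻ {⟦ eqU ⟧ (base v ∷ nil ∷ [])} y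
    with y₃ , y₄ ← and⁻ {⟦ eqU ⟧ (mach v ∷ nil ∷ [])} y =
    record { from≡ = eqU⁻ y₁ ; base≡ = eqU⁻ y₂ ; mach≡ = eqU⁻ y₃ ; load≡ = eqU⁻ y₄ }

  isInitial⁺ : ∀ {v} → Initial v → Yes (⟦ isInitial ⟧ (v ∷ []))
  isInitial⁺ i = and⁺ (eqU⁺ from≡) (and⁺ (eqU⁺ base≡) (and⁺ (eqU⁺ mach≡) (eqU⁺ load≡)))
    where open Initial i

module Rounded (I : Instance) (extended : IsExtendedChain I) (e : Tree) where
  open Walk I extended public

  Î H A : Tree
  Î = encodeInstance I
  H = ⟦ horizon ⟧ (adjacency ∷ [])
  A = ⟦ states ⟧ (Î ∷ H ∷ [])

  open Program e H Î A public

  unit : ℕ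
  unit = 2 ^ len e

  error : ℕ
  error = slack (len e)

  rounded : Tree → ℕ
  rounded t = len (⟦ round ⟧ (e ∷ H ∷ t ∷ []))

  p̂ : Context clouds → Job → ℕ
  p̂ α j = rounded (encodeℕ (processing α j))

  delayCell : Context clouds → Context clouds → Job → Job → Tree
  delayCell α β i j = if Instance.edge I i j then encodeℕ (delay α β i j) else nil

  d̂ : Context clouds → Context clouds → Job → Job → ℕ
  d̂ α β i j = rounded (delayCell α β i j)

  p̂-upper : ∀ α j → unit * p̂ α j ≤ processing α j + unit * error
  p̂-upper α j = ≤-trans (round-upper e H (encodeℕ (processing α j)))
    (≤-reflexive (cong (_+ unit * error) (bval-encodeℕ (processing α j))))

  p̂-lower : ∀ α j → p̂ α j ≤ len H → processing α j ≤ unit * p̂ α j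
  p̂-lower α j le = ≤-trans (≤-reflexive (sym (bval-encodeℕ (processing α j))))
    (round-lower e H (encodeℕ (processing α j)) le)

  delayCell-edge : ∀ {α β i j} → Edge i j → delayCell α β i j ≡ encodeℕ (delay α β i j)
  delayCell-edge {i = i} {j} ed with true ← Instance.edge I i j = refl

  delayCell-none : ∀ {α β i j} → ¬ Edge i j → delayCell α β i j ≡ nil
  delayCell-none {i = i} {j} ¬ed with Instance.edge I i j
  ... | true  = ⊥-elim (¬ed tt)
  ... | false = refl

  d̂-upper : ∀ α β {i j} → Edge i j → unit * d̂ α β i j ≤ delay α β i j + unit * error
  d̂-upper α β {i} {j} ed rewrite delayCell-edge {α} {β} ed =
    ≤-trans (round-upper e H (encodeℕ (delay α β i j)))
      (≤-reflexive (cong (_+ unit * error) (bval-encodeℕ (delay α β i j))))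

  d̂-none : ∀ α β {i j} → ¬ Edge i j → unit * d̂ α β i j ≤ unit * error
  d̂-none α β ¬ed rewrite delayCell-none {α} {β} ¬ed = round-upper e H nil

  d̂-lower : ∀ α β {i j} → Edge i j → d̂ α β i j ≤ len H → delay α β i j ≤ unit * d̂ α β i j
  d̂-lower α β {i} {j} ed le rewrite delayCell-edge {α} {β} ed =
    ≤-trans (≤-reflexive (sym (bval-encodeℕ (delay α β i j)))) (round-lower e H (encodeℕ (delay α β i j)) le)

  duration̂-value : ∀ {m x α j} → len m ≡ ctx# α → Index x j →
    len (⟦ duration̂ ⟧ (c ∷ m ∷ x ∷ [])) ≡ p̂ α j
  duration̂-value {m} {x} {α} {j} m≈ x≈ = cong len (trans duration̂-def
    (cong (λ t → ⟦ round ⟧ (e ∷ H ∷ t ∷ [])) (trans entry-def (trans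
      (cong (λ r → ⟦ nth ⟧ (r ∷ m ∷ []))
        (nth-table (λ j → encodeContextTable (λ m → encodeℕ (processing m j))) j x≈))
      (nth-context (λ m → encodeℕ (processing m j)) α m≈)))))

  delaŷ-value : ∀ {m₁ m₂ s t α β i j} → len m₁ ≡ ctx# α → len m₂ ≡ ctx# β → Index s i → Index t j →
    len (⟦ delaŷ ⟧ (c ∷ m₁ ∷ m₂ ∷ s ∷ t ∷ [])) ≡ d̂ α β i j
  delaŷ-value {m₁} {m₂} {s} {t} {α} {β} {i} {j} m₁≈ m₂≈ s≈ t≈ = cong len (trans delaŷ-def
    (cong (λ t → ⟦ round ⟧ (e ∷ H ∷ t ∷ []))
      (trans (cong (λ r → ⟦ entry ⟧ (r ∷ m₁ ∷ m₂ ∷ [])) (entry-adjacency s≈ t≈)) value)))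
    where
    value : ⟦ entry ⟧ (cell i j ∷ m₁ ∷ m₂ ∷ []) ≡ delayCell α β i j
    value rewrite entry-def {cell i j} {m₁} {m₂} with Instance.edge I i j
    ... | true = trans (cong (λ r → ⟦ nth ⟧ (r ∷ m₂ ∷ []))
                   (nth-context (λ m₁ → encodeContextTable (λ m₂ → encodeℕ (delay m₁ m₂ i j))) α m₁≈))
                   (nth-context (λ m₂ → encodeℕ (delay α m₂ i j)) β m₂≈)
    ... | false = trans (cong (λ r → ⟦ nth ⟧ (r ∷ m₂ ∷ [])) (nth-nil {m₁})) (nth-nil {m₂})

  len-H : len H ≡ jobs * horizonFactor
  len-H = trans (len-horizon adjacency) (cong (_* horizonFactor) len-adjacency)

  machines# : ℕ
  machines# = len (⟦ machines ⟧ (Î ∷ []))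

  machines-capped : Capped jobs machines# servers
  machines-capped = subst₂ (λ m n → Capped m machines# n) len-adjacency (bval-encodeℕ servers)
    (subst (λ t → Capped (len adjacency) (len t) (bval (encodeℕ servers))) (sym machines-def)
      (toUnary-spec adjacency (encodeℕ servers)))

  1≤machines : 1 ≤ machines#
  1≤machines = lemma machines-capped
    where
    lemma : ∀ {r} → Capped jobs r servers → 1 ≤ r
    lemma {zero}  c = ⊥-elim (<-irrefl (Capped.exact c z≤n) servers-positive)
    lemma {suc _} c = s≤s z≤n

  record State (v : Tree) : Set where
    field
      {curᶜ fromᶜ toᶜ} : Context clouds
      cur≡   : len (cur v) ≡ ctx# curᶜ
      from≡  : len (from v) ≡ ctx# fromᶜ
      to≡    : len (to v) ≡ ctx# toᶜ
      span≤  : len (span v) ≤ len H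
      base≤  : len (base v) ≤ len H
      mach<  : len (mach v) < machines#

  contexts : Tree
  contexts = ⟦ range ⟧ (tail (head (processingOf Î)) ∷ [])

  len-contexts : len (tail (head (processingOf Î))) ≡ clouds
  len-contexts with j , eq ← head-table (λ j → encodeContextTable (λ m → encodeℕ (processing m j))) source
    rewrite eq = len-table (λ c → encodeℕ (processing (cloud c) j))

  ∈-contexts⁻ : ∀ {m} → m ∈ contexts → ∃[ α ] len m ≡ ctx# {clouds} α
  ∈-contexts⁻ {m} m∈ = context-of (len m) (subst (len m ≤_) len-contexts (∈-range⁻ _ m∈))

  ∈-contexts⁺ : ∀ α → unary (ctx# {clouds} α) ∈ contexts
  ∈-contexts⁺ α = ∈-range⁺ _ (subst (ctx# α ≤_) (sym len-contexts) (ctx#≤ α))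

  state⁻ : ∀ {v} → v ∈ A → State v
  state⁻ {v} v∈
    with _ , _ , refl , m∈ , v∈ ← ∈-prod⁻ (subst (v ∈_) states-def v∈)
    with _ , _ , refl , α∈ , v∈ ← ∈-prod⁻ v∈
    with _ , _ , refl , β∈ , v∈ ← ∈-prod⁻ v∈
    with _ , _ , refl , L∈ , v∈ ← ∈-prod⁻ v∈
    with _ , _ , refl , V∈ , v∈ ← ∈-prod⁻ v∈
    with q , _ , refl , q∈ , ℓ∈ ← ∈-prod⁻ v∈ = record
    { cur≡ = proj₂ (∈-contexts⁻ m∈) ; from≡ = proj₂ (∈-contexts⁻ α∈) ; to≡ = proj₂ (∈-contexts⁻ β∈)
    ; span≤ = ∈-range⁻ H L∈ ; base≤ = ∈-range⁻ H V∈
    ; mach< = ≤-trans (s≤s (≤-trans (∈-range⁻ _ q∈) (≤-reflexive (len-tail (⟦ machines ⟧ (Î ∷ []))))))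
                      (≤-reflexive (m+[n∸m]≡n 1≤machines)) }

  state : (μ α β : Context clouds) (L V q ℓ : ℕ) → Tree
  state μ α β L V q ℓ = unary (ctx# μ) ∙ (unary (ctx# α) ∙ (unary (ctx# β) ∙
    (unary L ∙ (unary V ∙ (unary q ∙ unary ℓ)))))

  state⁺ : ∀ μ α β {L V q ℓ} → L ≤ len H → V ≤ len H → q < machines# → ℓ ≤ len H → state μ α β L V q ℓ ∈ A
  state⁺ μ α β {L} {V} {q} {ℓ} L≤ V≤ q< ℓ≤ = subst (state μ α β L V q ℓ ∈_) (sym states-def)
    (∈-prod⁺ (∈-contexts⁺ μ) (∈-prod⁺ (∈-contexts⁺ α) (∈-prod⁺ (∈-contexts⁺ β)
      (∈-prod⁺ (∈-range⁺ H L≤) (∈-prod⁺ (∈-range⁺ H V≤) (∈-prod⁺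
        (∈-range⁺ _ (subst (q ≤_) (sym (len-tail (⟦ machines ⟧ (Î ∷ [])))) (∸-monoˡ-≤ 1 q<)))
        (∈-range⁺ H ℓ≤)))))))

  costAtᶜ : Job → Context clouds → ℕ
  costAtᶜ j server    = 0
  costAtᶜ j (cloud c) = cost j c

  weight-value : ∀ {x y v α j} → Index (head x) j → len (cur v) ≡ ctx# α → weight# (x ∙ y) v ≡ costAtᶜ j α
  weight-value {x} {y} {v} {α} {j} x≈ v≈ rewrite weight-def {Î} {x} {y} {v} with cur v | α
  ... | nil | server = refl
  ... | _ ∙ m | cloud k = trans (cong bval (entry-table (λ j c → encodeℕ (cost j c)) j k x≈ (suc-injective v≈)))
      (bval-encodeℕ (cost j k))

-- Soundness

hit : Tree → ℕ → Tree
hit o n = if len (head o) ≡ᵇ n then tail o else nil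

find : Tree → ℕ → Tree
find nil      n = nil
find (o ∙ tr) n = cond (hit o n) (hit o n) (find tr n)

hit-same : ∀ o {n} → len (head o) ≡ n → hit o n ≡ tail o
hit-same o {n} eq with len (head o) ≡ᵇ n | ≡⇒≡ᵇ (len (head o)) n eq
... | true | _ = refl

hit-other : ∀ o {n} → len (head o) ≢ n → hit o n ≡ nil
hit-other o {n} neq with len (head o) ≡ᵇ n in eq
... | true  = ⊥-elim (neq (≡ᵇ⇒≡ (len (head o)) n (subst T (sym eq) tt)))
... | false = refl

eqU-hit : ∀ o x → cond (⟦ eqU ⟧ (head o ∷ x ∷ [])) (tail o) nil ≡ hit o (len x)
eqU-hit o x with ⟦ eqU ⟧ (head o ∷ x ∷ []) in eq
... | nil   = sym (hit-other o λ same → subst Yes eq (eqU⁺ same))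
... | _ ∙ _ = sym (hit-same o (eqU⁻ (subst Yes (sym eq) tt)))

cond-assoc : ∀ a b c → cond (cond a a b) (cond a a b) c ≡ cond a a (cond b b c)
cond-assoc nil     b c = refl
cond-assoc (_ ∙ _) b c = refl

look-spec : ∀ tr x → ⟦ look ⟧ (tr ∷ x ∷ []) ≡ find tr (len x)
look-spec tr x = trans look-def (loop tr nil)
  where
  loop : ∀ tr a → iter (λ o a → cond a a (cond (⟦ eqU ⟧ (head o ∷ x ∷ [])) (tail o) nil)) tr a ≡
    cond a a (find tr (len x))
  loop nil nil = refl
  loop nil (_ ∙ _) = refl
  loop (o ∙ tr) a rewrite eqU-hit o x =
    trans (loop tr (cond a a (hit o (len x)))) (cond-assoc a (hit o (len x)) (find tr (len x)))

find-new : ∀ {o tr n} → len (head o) ≡ n → Yes (tail o) → find (o ∙ tr) n ≡ tail o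
find-new {o} {tr} {n} eq y rewrite hit-same o eq = cond-yes y

find-old : ∀ {o tr n} → len (head o) ≢ n → find (o ∙ tr) n ≡ find tr n
find-old {o} neq rewrite hit-other o neq = refl

update : ∀ {n} {X : Set} → (Fin n → X) → Fin n → X → Fin n → X
update f x t j = if does (j Fin.≟ x) then t else f j

update-same : ∀ {n} {X : Set} (f : Fin n → X) x {t} → update f x t x ≡ t
update-same f x with x Fin.≟ x
... | yes _ = refl
... | no x≢x = ⊥-elim (x≢x refl)

update-other : ∀ {n} {X : Set} (f : Fin n → X) {x t j} → j ≢ x → update f x t j ≡ f j
update-other f {x} {j = j} j≢x with j Fin.≟ x
... | yes j≡x = ⊥-elim (j≢x j≡x)
... | no _ = refl

sum-cong : ∀ {n} {f g : Fin n → ℕ} → (∀ j → f j ≡ g j) → sum (tabulate f) ≡ sum (tabulate g)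
sum-cong {zero}  eq = refl
sum-cong {suc n} eq = cong₂ _+_ (eq zero) (sum-cong (eq ∘ suc))

sum-update : ∀ {n} {f g : Fin n → ℕ} x → f x ≡ 0 → (∀ j → j ≢ x → g j ≡ f j) →
  sum (tabulate g) ≡ sum (tabulate f) + g x
sum-update {f = f} {g} zero f≡0 same rewrite f≡0 =
  trans (cong (g zero +_) (sum-cong λ j → same (suc j) λ ())) (+-comm (g zero) _)
sum-update {f = f} {g} (suc x) f≡0 same =
  trans (cong₂ _+_ (same zero λ ()) (sum-update x f≡0 λ j j≢x → same (suc j) (j≢x ∘ Fin.suc-injective)))
    (sym (+-assoc (f zero) _ _))

scaled₁ : ∀ u {c d t D} → D ≤ u * d → c + d ≤ t → u * c + D ≤ u * t
scaled₁ u {c} {d} D≤ le = ≤-trans (+-monoʳ-≤ (u * c) D≤)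
  (≤-trans (≤-reflexive (sym (*-distribˡ-+ u c d))) (*-monoʳ-≤ u le))

scaled₂ : ∀ u {c d p t D P} → D ≤ u * d → P ≤ u * p → c + d + p ≤ t → u * c + D + P ≤ u * t
scaled₂ u {c} {d} {p} D≤ P≤ le =
  ≤-trans (+-monoˡ-≤ _ (scaled₁ u {c} {d} D≤ ≤-refl)) (scaled₁ u {c + d} {p} P≤ le)

unique-++⁻ : ∀ {X : Set} (xs : List X) {ys} → Unique (xs ++ ys) →
  (∀ {x y} → x ∈ᴸ xs → y ∈ᴸ ys → x ≢ y) × Unique ys
unique-++⁻ [] u = (λ ()) , u
unique-++⁻ (x ∷ xs) (x∉ ∷ u) with disjoint , uys ← unique-++⁻ xs u =
  (λ { (here refl) y∈ → All.lookup x∉ (∈-++⁺ʳ xs y∈) ; (there z∈) y∈ → disjoint z∈ y∈ }) , uys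

module Soundness (I : Instance) (extended : IsExtendedChain I) (e : Tree) where
  open Rounded I extended e public

  Place : Set
  Place = Location servers clouds

  first : Fin servers
  first = fromℕ< servers-positive

  toℕ-first : toℕ first ≡ 0
  toℕ-first = toℕ-fromℕ< servers-positive

  -- The missing record stands for the source as well as for jobs not yet reached; both are at time
  -- 0 on the first machine, where they cost nothing.
  data Match : Tree → ℕ → Place → Set where
    unplaced : Match nil 0 (onServer first)
    atServer : ∀ {t q n s} → len t ≡ n → len q ≡ toℕ s → Match (t ∙ (nil ∙ q)) n (onServer s)
    atCloud  : ∀ {t d m q n k} → len t ≡ n → Index m k → Match (t ∙ ((d ∙ m) ∙ q)) n (onCloud k)

  -- A schedule, in units, of the jobs in P; the other jobs have default values.
  record Partial (P : Job → Set) (tr : Tree) (k : ℕ) (C : Job → ℕ) (η : Job → Place) : Set where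
    field
      match         : ∀ j → Match (find tr (toℕ j)) (C j) (η j)
      default       : ∀ {j} → ¬ P j → η j ≡ onServer first
      source-placed : P source
      source-server : context (η source) ≡ server
      spent         : sum (tabulate (λ j → costAtᶜ j (context (η j)))) ≡ k
      disjoint      : ∀ {i j s} → P i → P j → i ≢ j → η i ≡ onServer s → η j ≡ onServer s →
        unit * C i + processing server j ≤ unit * C j ⊎ unit * C j + processing server i ≤ unit * C i
      precedes      : ∀ {i j} → P j → Edge i j → P i ×
        unit * C i + delay (context (η i)) (context (η j)) i j + processing (context (η j)) j ≤ unit * C j

  Add : Job → (Job → Set) → Job → Set
  Add x P j = j ≡ x ⊎ P j

  -- Placed jobs have all their predecessors placed, so the new job precedes none of them. It also
  -- comes last on its machine. Only the constraints that end in it have to be checked.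
  place : ∀ {P tr k C η} → Partial P tr k C η → ∀ {x o t ℓ} → ¬ P x → Index (head o) x →
    Yes (tail o) → Match (tail o) t ℓ →
    (∀ {i} → Edge i x → P i × unit * C i + delay (context (η i)) (context ℓ) i x + processing (context ℓ) x ≤ unit * t) →
    (∀ {j s} → P j → ℓ ≡ onServer s → η j ≡ onServer s → unit * C j + processing server x ≤ unit * t) →
    Partial (Add x P) (o ∙ tr) (k + costAtᶜ x (context ℓ)) (update C x t) (update η x ℓ)
  place {P} {tr} {k} {C} {η} partial {x} {o} {t} {ℓ} x∉ x≈ y m into apart = record
    { match = match′
    ; default = λ {j} j∉ → trans (update-other η λ j≡x → j∉ (inj₁ j≡x)) (default λ p → j∉ (inj₂ p))
    ; source-placed = inj₂ source-placed
    ; source-server = trans (cong context (ηold source-placed)) source-server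
    ; spent = trans (sum-update x (cong (costAtᶜ x ∘ context) (default x∉))
        λ j j≢x → cong (costAtᶜ j ∘ context) (update-other η j≢x))
        (cong₂ _+_ spent (cong (costAtᶜ x ∘ context) ηnew))
    ; disjoint = disjoint′
    ; precedes = precedes′ }
    where
    open Partial partial
    ≢x : ∀ {j} → P j → j ≢ x
    ≢x p refl = x∉ p
    Cold : ∀ {j} → P j → update C x t j ≡ C j
    Cold p = update-other C (≢x p)
    ηold : ∀ {j} → P j → update η x ℓ j ≡ η j
    ηold p = update-other η (≢x p)
    Cnew : update C x t x ≡ t
    Cnew = update-same C x
    ηnew : update η x ℓ x ≡ ℓ
    ηnew = update-same η x
    match′ : ∀ j → Match (find (o ∙ tr) (toℕ j)) (update C x t j) (update η x ℓ j)
    match′ j with j Fin.≟ x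
    ... | yes refl = subst (λ r → Match r t ℓ) (sym (find-new {o} {tr} x≈ y)) m
    ... | no j≢x = subst (λ r → Match r (C j) (η j))
      (sym (find-old {o} {tr} λ eq → j≢x (toℕ-injective (trans (sym eq) x≈)))) (match j)
    disjoint′ : ∀ {i j s} → Add x P i → Add x P j → i ≢ j → update η x ℓ i ≡ onServer s → update η x ℓ j ≡ onServer s →
      unit * update C x t i + processing server j ≤ unit * update C x t j ⊎
      unit * update C x t j + processing server i ≤ unit * update C x t i
    disjoint′ (inj₁ refl) (inj₁ refl) i≢j _ _ = ⊥-elim (i≢j refl)
    disjoint′ (inj₁ refl) (inj₂ p) _ ηi ηj rewrite Cnew | Cold p =
      inj₂ (apart p (trans (sym ηnew) ηi) (trans (sym (ηold p)) ηj))
    disjoint′ (inj₂ p) (inj₁ refl) _ ηi ηj rewrite Cnew | Cold p =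
      inj₁ (apart p (trans (sym ηnew) ηj) (trans (sym (ηold p)) ηi))
    disjoint′ (inj₂ p) (inj₂ q) i≢j ηi ηj rewrite Cold p | Cold q =
      disjoint p q i≢j (trans (sym (ηold p)) ηi) (trans (sym (ηold q)) ηj)
    precedes′ : ∀ {i j} → Add x P j → Edge i j → Add x P i ×
      unit * update C x t i + delay (context (update η x ℓ i)) (context (update η x ℓ j)) i j +
        processing (context (update η x ℓ j)) j ≤ unit * update C x t j
    precedes′ (inj₁ refl) ed with p , le ← into ed rewrite Cnew | ηnew | Cold p | ηold p = inj₂ p , le
    precedes′ (inj₂ q) ed with p , le ← precedes q ed rewrite Cold q | ηold q | Cold p | ηold p = inj₂ p , le

  finish : Tree → ℕ
  finish v = len (span v) + (len (span v) + (len (span v) + len (base v)))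

  -- An earlier server job was finished before the segment, or lies on a machine already left, or
  -- below the load of the current one. Hence all later machines are free from `base` on.
  Slot : Tree → ℕ → Fin servers → Set
  Slot v t s = t ≤ len (base v) ⊎ toℕ s < len (mach v) ⊎
    (toℕ s ≡ len (mach v) × t ≤ len (span v) + (len (load v) + len (base v)))

  record AtCut (P : Job → Set) (a : Job) (v : Tree) (k : ℕ) (tr : Tree) : Set where
    field
      {C}     : Job → ℕ
      {η}     : Job → Place
      partial : Partial P tr k C η
      placed  : P a
      base≡   : C a ≡ len (base v)
      from≡   : len (from v) ≡ ctx# (context (η a))
      mach≡   : len (mach v) ≡ 0
      load≡   : len (load v) ≡ 0
      before  : ∀ {j} → P j → C j ≤ len (base v)

  record InSegment (P : Job → Set) (a b : Job) (v : Tree) (k : ℕ) (tr : Tree) : Set where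
    field
      {C}     : Job → ℕ
      {η}     : Job → Place
      partial : Partial P tr k C η
      placed  : P a
      base≡   : C a ≡ len (base v)
      from≡   : len (from v) ≡ ctx# (context (η a))
      slots   : ∀ {j s} → P j → η j ≡ onServer s → Slot v (C j) s
      before  : ∀ {j} → P j → C j ≤ finish v
      -- The cut vertex `a` is excluded, since a direct edge from it is covered by the delay test of
      -- `chainOk`.
      exits   : ∀ {y β} → P y → y ≢ a → Edge y b → len (to v) ≡ ctx# β →
        unit * C y + delay (context (η y)) β y b ≤ unit * finish v

  base≤finish : ∀ v → len (base v) ≤ finish v
  base≤finish v = ≤-trans (m≤n+m _ (len (span v))) (≤-trans (m≤n+m _ (len (span v))) (m≤n+m _ (len (span v))))

  enter-segment : ∀ {P a b xs v k tr} → Segment a xs b → (∀ {x} → x ∈ᴸ xs → ¬ P x) →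
    AtCut P a v k tr → InSegment P a b v k tr
  enter-segment {v = v} seg fresh cut = record
    { partial = partial ; placed = placed ; base≡ = base≡ ; from≡ = from≡
    ; slots = λ p _ → inj₁ (before p)
    ; before = λ p → ≤-trans (before p) (base≤finish v)
    ; exits = λ p y≢a ed _ → case Segment.into-cut seg ed of λ
        { (inj₁ y∈) → ⊥-elim (fresh y∈ p) ; (inj₂ y≡a) → ⊥-elim (y≢a y≡a) } }
    where open AtCut cut

  module MidStep {P : Job → Set} {a b x : Job} {ta tb tx u v tr : Tree} {k : ℕ}
    (inv : InSegment P a b u k tr) (x∉ : ¬ P x)
    (into : ∀ {i} → Edge i x → i ≡ a) (ax : Edge a x) (xb : Edge x b)
    (ta≈ : Index ta a) (tb≈ : Index tb b) (tx≈ : Index tx x)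
    (su : State u) (sv : State v)
    (ok : MidOk c tx ta tb u v) where
    open InSegment inv
    open MidOk ok renaming (from≡ to from≡ᵘ; to≡ to to≡ᵘ; span≡ to span≡ᵘ; base≡ to base≡ᵘ)

    item : Tree
    item = (tx ∙ ta) ∙ (nil ∙ tb)

    α μ β : Context clouds
    α = context (η a)
    μ = State.curᶜ sv
    β = State.toᶜ su

    L V d₁ p d₂ t : ℕ
    L  = len (span u)
    V  = len (base u)
    d₁ = d̂ α μ a x
    p  = p̂ μ x
    d₂ = d̂ μ β x b
    t  = len (⟦ completionTime ⟧ (item ∷ v ∷ []))

    p-value : len (⟦ duration̂ ⟧ (c ∷ cur v ∷ tx ∷ [])) ≡ p
    p-value = duration̂-value (State.cur≡ sv) tx≈

    latency-value : d₁ + (p + d₂) ≤ L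
    latency-value = subst (_≤ L) (trans (len-latency {c} {tx} {ta} {tb} {u} {v})
      (cong₂ _+_ (delaŷ-value from≡ (State.cur≡ sv) ta≈ tx≈)
        (cong₂ _+_ p-value (delaŷ-value (State.cur≡ sv) (State.to≡ su) tx≈ tb≈)))) latency≤

    -- What is bounded by the span is bounded by the horizon and so was not truncated; this turns
    -- tests on rounded data into bounds on the true data.
    ≤H : ∀ {m} → m ≤ L → m ≤ len H
    ≤H m≤ = ≤-trans m≤ (State.span≤ su)

    d₁≤ : delay α μ a x ≤ unit * d₁
    d₁≤ = d̂-lower α μ ax (≤H (≤-trans (m≤m+n d₁ _) latency-value))

    p≤ : processing μ x ≤ unit * p
    p≤ = p̂-lower μ x (≤H (≤-trans (≤-trans (m≤m+n p d₂) (m≤n+m _ d₁)) latency-value))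

    d₂≤ : delay μ β x b ≤ unit * d₂
    d₂≤ = d̂-lower μ β xb (≤H (≤-trans (≤-trans (m≤n+m d₂ p) (m≤n+m _ d₁)) latency-value))

    d₁p≤L : d₁ + p ≤ L
    d₁p≤L = ≤-trans (+-monoʳ-≤ d₁ (m≤m+n p d₂)) latency-value

    pd₂≤L : p + d₂ ≤ L
    pd₂≤L = ≤-trans (m≤n+m _ d₁) latency-value

    finish≡ : finish v ≡ finish u
    finish≡ rewrite span≡ᵘ | base≡ᵘ = refl

    weight≡ : weight# item v ≡ costAtᶜ x μ
    weight≡ = weight-value tx≈ (State.cur≡ sv)

    conclude : ∀ {ℓ} → context ℓ ≡ μ → Match (tail (⟦ record̂ ⟧ (item ∷ v ∷ []))) t ℓ →
      V + d₁ + p ≤ t → t + d₂ ≤ finish u →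
      (∀ {j s} → P j → ℓ ≡ onServer s → η j ≡ onServer s → C j + p ≤ t) →
      (∀ {j s} → P j → η j ≡ onServer s → Slot v (C j) s) →
      (∀ {s} → ℓ ≡ onServer s → Slot v t s) →
      InSegment (Add x P) a b v (k + weight# item v) (⟦ record̂ ⟧ (item ∷ v ∷ []) ∙ tr)
    conclude {ℓ} ℓ≡ m start≤ end≤ apart old-slot new-slot = record
      { partial = subst (λ w → Partial (Add x P) _ (k + w) (update C x t) (update η x ℓ))
          (trans (cong (costAtᶜ x) ℓ≡) (sym weight≡))
          (place partial {x} {⟦ record̂ ⟧ (item ∷ v ∷ [])} x∉ (trans (cong (len ∘ head) record̂-def) tx≈)
            (subst (Yes ∘ tail) (sym record̂-def) tt) m into′ apart′)
      ; placed = inj₂ placed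
      ; base≡ = trans (Cold placed) (trans base≡ (sym base≡ᵘ))
      ; from≡ = trans from≡ᵘ (trans from≡ (cong (ctx# ∘ context) (sym (ηold placed))))
      ; slots = λ { (inj₁ refl) eq → subst (λ n → Slot v n _) (sym (update-same C x)) (new-slot (trans (sym (update-same η x)) eq))
                  ; (inj₂ q) eq → subst (λ n → Slot v n _) (sym (Cold q)) (old-slot q (trans (sym (ηold q)) eq)) }
      ; before = λ { (inj₁ refl) → subst₂ _≤_ (sym (update-same C x)) (sym finish≡) (≤-trans (m≤m+n t d₂) end≤)
                   ; (inj₂ q) → subst₂ _≤_ (sym (Cold q)) (sym finish≡) (before q) }
      ; exits = exits′ }
      where
      Cold : ∀ {j} → P j → update C x t j ≡ C j
      Cold q = update-other C λ { refl → x∉ q }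
      ηold : ∀ {j} → P j → update η x ℓ j ≡ η j
      ηold q = update-other η λ { refl → x∉ q }
      into′ : ∀ {i} → Edge i x → P i ×
        unit * C i + delay (context (η i)) (context ℓ) i x + processing (context ℓ) x ≤ unit * t
      into′ ed rewrite into ed | ℓ≡ | base≡ = placed , scaled₂ unit d₁≤ p≤ start≤
      apart′ : ∀ {j s} → P j → ℓ ≡ onServer s → η j ≡ onServer s → unit * C j + processing server x ≤ unit * t
      apart′ {s = s} q ℓ≡s ηj = scaled₁ unit
        (subst (λ γ → processing γ x ≤ unit * p) (trans (sym ℓ≡) (cong context ℓ≡s)) p≤) (apart q ℓ≡s ηj)
      exits′ : ∀ {y β′} → Add x P y → y ≢ a → Edge y b → len (to v) ≡ ctx# β′ →
        unit * update C x t y + delay (context (update η x ℓ y)) β′ y b ≤ unit * finish v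
      exits′ {β′ = β′} (inj₁ refl) _ _ β≈
        rewrite update-same C x {t} | update-same η x {ℓ} | ℓ≡ | finish≡
              | ctx#-injective {α = β′} {β} (trans (sym β≈) (trans to≡ᵘ (State.to≡ su))) =
        scaled₁ unit d₂≤ end≤
      exits′ (inj₂ q) y≢a ed β≈ rewrite Cold q | ηold q | finish≡ = exits q y≢a ed (trans (sym to≡ᵘ) β≈)

    tail-record : tail (⟦ record̂ ⟧ (item ∷ v ∷ [])) ≡ ⟦ completionTime ⟧ (item ∷ v ∷ []) ∙ (cur v ∙ mach v)
    tail-record = cong tail record̂-def

    keep-slot : (∀ {j s} → P j → η j ≡ onServer s → Slot u (C j) s → Slot v (C j) s) →
      ∀ {j s} → P j → η j ≡ onServer s → Slot v (C j) s
    keep-slot f q ηj = f q ηj (slots q ηj)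

    machine : Fin servers
    machine = fromℕ< (≤-trans (State.mach< sv) (Capped.below machines-capped))

    machine≈ : toℕ machine ≡ len (mach v)
    machine≈ = toℕ-fromℕ< (≤-trans (State.mach< sv) (Capped.below machines-capped))

    server-context : cur v ≡ nil → server ≡ μ
    server-context n = ctx#-injective (trans (cong len (sym n)) (State.cur≡ sv))

    server-match : cur v ≡ nil → Match (tail (⟦ record̂ ⟧ (item ∷ v ∷ []))) t (onServer machine)
    server-match n = subst (λ r → Match r t (onServer machine))
      (sym (trans tail-record (cong (λ m → ⟦ completionTime ⟧ (item ∷ v ∷ []) ∙ (m ∙ mach v)) n)))
      (atServer refl (sym machine≈))

    cloud-step : Yes (cur v) → len (mach v) ≡ len (mach u) → len (load v) ≡ len (load u) →
      InSegment (Add x P) a b v (k + weight# item v) (⟦ record̂ ⟧ (item ∷ v ∷ []) ∙ tr)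
    cloud-step y mach≡ load≡ = go μ refl
      where
      t≡ : t ≡ L + (L + V)
      t≡ = trans (len-completionTime-cloud {tx ∙ ta} {nil} {tb} {v} y)
        (cong₂ _+_ span≡ᵘ (cong₂ _+_ span≡ᵘ base≡ᵘ))
      go : ∀ γ → μ ≡ γ → InSegment (Add x P) a b v (k + weight# item v) (⟦ record̂ ⟧ (item ∷ v ∷ []) ∙ tr)
      go server eq = ⊥-elim (lemma (cur v) y (trans (State.cur≡ sv) (cong ctx# eq)))
        where
        lemma : ∀ m → Yes m → len m ≢ 0
        lemma (_ ∙ _) _ ()
      go (cloud κ) eq = conclude {onCloud κ} (sym eq) (match (cur v) refl (trans (State.cur≡ sv) (cong ctx# eq)))
        (subst (V + d₁ + p ≤_) (sym t≡) (begin
          V + d₁ + p      ≡⟨ +-assoc V d₁ p ⟩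
          V + (d₁ + p)    ≤⟨ +-monoʳ-≤ V d₁p≤L ⟩
          V + L           ≡⟨ +-comm V L ⟩
          L + V           ≤⟨ m≤n+m _ L ⟩
          L + (L + V)     ∎))
        (subst (λ n → n + d₂ ≤ finish u) (sym t≡) (begin
          L + (L + V) + d₂  ≤⟨ +-monoʳ-≤ (L + (L + V)) (≤-trans (m≤n+m d₂ p) pd₂≤L) ⟩
          L + (L + V) + L   ≡⟨ +-comm _ L ⟩
          finish u          ∎))
        (λ _ ()) (keep-slot λ _ _ → slot) (λ ())
        where
        open ≤-Reasoning
        match : ∀ m → cur v ≡ m → len m ≡ suc (toℕ κ) → Match (tail (⟦ record̂ ⟧ (item ∷ v ∷ []))) t (onCloud κ)
        match (d ∙ m) m≡ m≈ = subst (λ r → Match r t (onCloud κ))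
          (sym (trans tail-record (cong (λ m → ⟦ completionTime ⟧ (item ∷ v ∷ []) ∙ (m ∙ mach v)) m≡)))
          (atCloud refl (suc-injective m≈))
        slot : ∀ {n s} → Slot u n s → Slot v n s
        slot sl rewrite mach≡ | load≡ | span≡ᵘ | base≡ᵘ = sl

    server-time : cur v ≡ nil → t ≡ L + (len (load v) + V)
    server-time n = trans (len-completionTime-server {tx ∙ ta} {nil} {tb} {v} n)
      (cong₂ _+_ span≡ᵘ (cong (len (load v) +_) base≡ᵘ))

    -- Here `ℓ₀` is the load in front of `x`: the current load on the same machine, zero on a fresh
    -- one. The first span covers the delay from `a`, the second the waiting time `ℓ₀`, the third
    -- the processing and the delay to `b`.
    server-step : cur v ≡ nil → ∀ ℓ₀ → ℓ₀ ≤ L → len (load v) ≡ ℓ₀ + p →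
      (∀ {j} → P j → η j ≡ onServer machine → C j ≤ L + (ℓ₀ + V)) →
      (∀ {j s} → P j → η j ≡ onServer s → Slot v (C j) s) →
      InSegment (Add x P) a b v (k + weight# item v) (⟦ record̂ ⟧ (item ∷ v ∷ []) ∙ tr)
    server-step n ℓ₀ ℓ₀≤ load≡ earlier old-slot = conclude {onServer machine} (server-context n) (server-match n)
      (subst (V + d₁ + p ≤_) (sym t≡) (begin
        V + d₁ + p           ≡⟨ +-assoc V d₁ p ⟩
        V + (d₁ + p)         ≤⟨ +-monoʳ-≤ V d₁p≤L ⟩
        V + L                ≡⟨ +-comm V L ⟩
        L + V                ≤⟨ +-monoʳ-≤ L (m≤n+m V (ℓ₀ + p)) ⟩
        L + (ℓ₀ + p + V)     ∎))
      (subst (λ m → m + d₂ ≤ finish u) (sym t≡) (begin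
        L + (ℓ₀ + p + V) + d₂   ≡⟨ lemma₁ L ℓ₀ p V d₂ ⟩
        L + (ℓ₀ + (p + d₂ + V)) ≤⟨ +-monoʳ-≤ L (+-mono-≤ ℓ₀≤ (+-monoˡ-≤ V pd₂≤L)) ⟩
        L + (L + (L + V))       ∎))
      (λ { {j} q refl ηj → subst (C j + p ≤_) (sym t≡) (≤-trans (+-monoˡ-≤ p (earlier q ηj)) (≤-reflexive (lemma₂ L ℓ₀ V p))) })
      old-slot
      (λ { refl → inj₂ (inj₂ (machine≈ , ≤-reflexive (len-completionTime-server {tx ∙ ta} {nil} {tb} {v} n))) })
      where
      open ≤-Reasoning
      t≡ : t ≡ L + (ℓ₀ + p + V)
      t≡ = trans (server-time n) (cong (λ m → L + (m + V)) load≡)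
      lemma₁ : ∀ L ℓ p V d → L + (ℓ + p + V) + d ≡ L + (ℓ + (p + d + V))
      lemma₁ = solve-∀
      lemma₂ : ∀ L ℓ V p → L + (ℓ + V) + p ≡ L + (ℓ + p + V)
      lemma₂ = solve-∀

    mid-step : Move (len (⟦ duration̂ ⟧ (c ∷ cur v ∷ tx ∷ []))) u v →
      InSegment (Add x P) a b v (k + weight# item v) (⟦ record̂ ⟧ (item ∷ v ∷ []) ∙ tr)
    mid-step (outside y mach≡ load≡) = cloud-step y mach≡ load≡
    mid-step (stay n mach≡ ℓ≤ load≡) =
      server-step n (len (load u)) ℓ≤ load≡′ earlier (keep-slot λ _ _ → slot)
      where
      load≡′ : len (load v) ≡ len (load u) + p
      load≡′ = trans load≡ (cong (len (load u) +_) p-value)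
      earlier : ∀ {j} → P j → η j ≡ onServer machine → C j ≤ L + (len (load u) + V)
      earlier q ηj with slots q ηj
      ... | inj₁ le = ≤-trans le (≤-trans (m≤n+m V (len (load u))) (m≤n+m _ L))
      ... | inj₂ (inj₁ lt) = ⊥-elim (<-irrefl (trans machine≈ mach≡) lt)
      ... | inj₂ (inj₂ (_ , le)) = le
      slot : ∀ {n s} → Slot u n s → Slot v n s
      slot (inj₁ le) = inj₁ (subst (_ ≤_) (sym base≡ᵘ) le)
      slot (inj₂ (inj₁ lt)) = inj₂ (inj₁ (subst (_ <_) (sym mach≡) lt))
      slot (inj₂ (inj₂ (eq , le))) = inj₂ (inj₂ (trans eq (sym mach≡) , ≤-trans le
        (+-mono-≤ (≤-reflexive (sym span≡ᵘ)) (+-mono-≤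
          (subst (len (load u) ≤_) (sym load≡′) (m≤m+n _ p)) (≤-reflexive (sym base≡ᵘ))))))
    mid-step (advance n mach≡ load≡) =
      server-step n 0 z≤n (trans load≡ p-value) earlier (keep-slot λ _ _ → slot)
      where
      earlier : ∀ {j} → P j → η j ≡ onServer machine → C j ≤ L + (0 + V)
      earlier q ηj with slots q ηj
      ... | inj₁ le = ≤-trans le (m≤n+m V L)
      ... | inj₂ (inj₁ lt) = ⊥-elim (<-asym lt (≤-reflexive (sym (trans machine≈ mach≡))))
      ... | inj₂ (inj₂ (eq , _)) = ⊥-elim (1+n≢n (trans (sym (trans machine≈ mach≡)) eq))
      slot : ∀ {n s} → Slot u n s → Slot v n s
      slot (inj₁ le) = inj₁ (subst (_ ≤_) (sym base≡ᵘ) le)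
      slot (inj₂ (inj₁ lt)) = inj₂ (inj₁ (subst (_ <_) (sym mach≡) (≤-trans lt (n≤1+n _))))
      slot (inj₂ (inj₂ (eq , _))) = inj₂ (inj₁ (≤-reflexive (trans (cong suc eq) (sym mach≡))))

-- From units back to times

expand : ℕ → ℕ → ℕ
expand zero    n = n
expand (suc e) n = expand e (1 + 2 * n)

suc-expand : ∀ e n → suc (expand e n) ≡ 2 ^ e * suc n
suc-expand zero    n = sym (+-identityʳ (suc n))
suc-expand (suc e) n = trans (suc-expand e (1 + 2 * n)) (lemma (2 ^ e) n)
  where
  lemma : ∀ u n → u * suc (1 + 2 * n) ≡ (2 * u) * suc n
  lemma = solve-∀

-- Appending `e` digits 1 multiplies by the unit and adds the unit minus one. This shift is the same
-- for all times, so it cancels in every constraint of a schedule.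
expand-mono : ∀ e {m n D} → 2 ^ e * m + D ≤ 2 ^ e * n → expand e m + D ≤ expand e n
expand-mono e {m} {n} {D} le = ≤-pred (begin
  suc (expand e m) + D     ≡⟨ cong (_+ D) (trans (suc-expand e m) (*-suc (2 ^ e) m)) ⟩
  2 ^ e + 2 ^ e * m + D    ≡⟨ +-assoc (2 ^ e) (2 ^ e * m) D ⟩
  2 ^ e + (2 ^ e * m + D)  ≤⟨ +-monoʳ-≤ (2 ^ e) le ⟩
  2 ^ e + 2 ^ e * n        ≡⟨ trans (suc-expand e n) (*-suc (2 ^ e) n) ⟨
  suc (expand e n)         ∎)
  where open ≤-Reasoning

scale-spec : ∀ e n → ⟦ scale ⟧ (e ∷ encodeℕ n ∷ []) ≡ encodeℕ (expand (len e) n)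
scale-spec e n = trans scale-def (lemma e n)
  where
  lemma : ∀ e n → iter (λ _ a → (nil ∙ nil) ∙ a) e (encodeℕ n) ≡ encodeℕ (expand (len e) n)
  lemma nil     n = refl
  lemma (_ ∙ e) n = trans (cong (iter _ e) (cong encodeℕᵇ (sym (toBinary-odd n)))) (lemma e (1 + 2 * n))

listing↑ : (ℕ → Tree) → ℕ → Tree → Tree
listing↑ h zero    t = t
listing↑ h (suc n) t = listing↑ h n (h n ∙ t)

listing↑-suc : ∀ h n t → listing↑ h (suc n) t ≡ h 0 ∙ listing↑ (h ∘ suc) n t
listing↑-suc h zero    t = refl
listing↑-suc h (suc n) t = listing↑-suc h n (h (suc n) ∙ t)

listing↑-table : ∀ {n} (f : Fin n → Tree) h → (∀ j → h (toℕ j) ≡ f j) → listing↑ h n nil ≡ encodeTable f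
listing↑-table {zero}  f h eq = refl
listing↑-table {suc n} f h eq =
  trans (listing↑-suc h n nil) (cong₂ _∙_ (eq zero) (listing↑-table (f ∘ suc) (h ∘ suc) (eq ∘ suc)))

iter-listing↑ : ∀ (h : Tree → Tree) n t → iter (λ x a → h x ∙ a) (downFrom n) t ≡ listing↑ (h ∘ unary) (suc n) t
iter-listing↑ h zero    t = refl
iter-listing↑ h (suc n) t = iter-listing↑ h n (h (unary (suc n)) ∙ t)

module Schedules (I : Instance) (extended : IsExtendedChain I) (e : Tree) where
  open Soundness I extended e public

  -- The cut vertex starts at `finish u`, when everything placed so far is complete, so it may use
  -- any machine without conflict.
  chain-step : ∀ {P : Job → Set} {a b xs ta tb u v tr k} →
    InSegment P a b u k tr → ¬ P b → Segment a xs b → (∀ {x} → x ∈ᴸ xs → P x) →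
    Index ta a → Index tb b → State u → State v → ChainOk c tb ta u v →
    let it = (tb ∙ ta) ∙ nil in
    AtCut (Add b P) b v (k + weight# it v) (⟦ record̂ ⟧ (it ∷ v ∷ []) ∙ tr)
  chain-step {P} {a} {b} {xs} {ta} {tb} {u} {v} {tr} {k} inv b∉ seg xs-placed ta≈ tb≈ su sv ok =
    conclude β refl
    where
    open InSegment inv
    open ChainOk ok renaming (from≡ to from≡ᵘ; base≡ to base≡ᵘ)
    it : Tree
    it = (tb ∙ ta) ∙ nil
    β : Context clouds
    β = State.toᶜ su
    p t d : ℕ
    p = p̂ β b
    t = len (⟦ completionTime ⟧ (it ∷ v ∷ []))
    d = d̂ (context (η a)) β a b
    cur≈ : len (cur v) ≡ ctx# β
    cur≈ = trans cur≡ (State.to≡ su)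
    t≡ : t ≡ p + finish u
    t≡ = trans (len-completionTime-chain {tb ∙ ta} {v})
      (trans base≡ᵘ (cong (_+ finish u) (duration̂-value (State.to≡ su) tb≈)))
    p≤ : processing β b ≤ unit * p
    p≤ = p̂-lower β b (≤-trans (m≤m+n p (finish u)) (≤-trans (≤-reflexive
      (trans (sym t≡) (len-completionTime-chain {tb ∙ ta} {v}))) (State.base≤ sv)))
    d≤L : d ≤ len (span u)
    d≤L = subst (_≤ len (span u)) (delaŷ-value from≡ (State.to≡ su) ta≈ tb≈) delay≤
    into : ∀ {i} → Edge i b → P i × unit * C i + delay (context (η i)) β i b + processing β b ≤ unit * t
    into {i} ed with i Fin.≟ a
    ... | yes refl = placed , scaled₂ unit
      (d̂-lower (context (η a)) β ed (≤-trans d≤L (State.span≤ su))) p≤ (begin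
        C a + d + p                        ≡⟨ cong (λ n → n + d + p) base≡ ⟩
        len (base u) + d + p               ≤⟨ +-monoˡ-≤ p (+-monoʳ-≤ (len (base u)) d≤L) ⟩
        len (base u) + len (span u) + p    ≡⟨ cong (_+ p) (+-comm (len (base u)) (len (span u))) ⟩
        len (span u) + len (base u) + p    ≤⟨ +-monoˡ-≤ p (≤-trans (m≤n+m _ (len (span u))) (m≤n+m _ (len (span u)))) ⟩
        finish u + p                       ≡⟨ +-comm (finish u) p ⟩
        p + finish u                       ≡⟨ t≡ ⟨
        t                                  ∎)
      where open ≤-Reasoning
    ... | no i≢a with Segment.into-cut seg ed
    ...   | inj₂ i≡a = ⊥-elim (i≢a i≡a)
    ...   | inj₁ i∈ = xs-placed i∈ , ≤-trans (+-monoˡ-≤ _ (exits (xs-placed i∈) i≢a ed (State.to≡ su)))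
      (scaled₁ unit p≤ (≤-reflexive (trans (+-comm (finish u) p) (sym t≡))))
    t≈base : t ≡ len (base v)
    t≈base = len-completionTime-chain {tb ∙ ta} {v}
    finish≤t : finish u ≤ t
    finish≤t = subst (finish u ≤_) (sym t≡) (m≤n+m (finish u) p)
    apart : ∀ {ℓ j s} → context ℓ ≡ β → P j → ℓ ≡ onServer s → η j ≡ onServer s →
      unit * C j + processing server b ≤ unit * t
    apart {s = s} ℓ≡ q ℓ≡s ηj = scaled₁ unit
      (subst (λ γ → processing γ b ≤ unit * p) (trans (sym ℓ≡) (cong context ℓ≡s)) p≤)
      (≤-trans (+-monoˡ-≤ p (before q)) (≤-reflexive (trans (+-comm (finish u) p) (sym t≡))))
    at-cut : ∀ ℓ → context ℓ ≡ β → Match (tail (⟦ record̂ ⟧ (it ∷ v ∷ []))) t ℓ →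
      AtCut (Add b P) b v (k + weight# it v) (⟦ record̂ ⟧ (it ∷ v ∷ []) ∙ tr)
    at-cut ℓ ℓ≡ m = record
      { partial = subst (λ w → Partial (Add b P) _ (k + w) (update C b t) (update η b ℓ))
          (trans (cong (costAtᶜ b) ℓ≡) (sym (weight-value tb≈ cur≈)))
          (place partial {b} {⟦ record̂ ⟧ (it ∷ v ∷ [])} b∉ (trans (cong (len ∘ head) record̂-def) tb≈)
            (subst (Yes ∘ tail) (sym record̂-def) tt) m
            (λ {i} ed → subst (λ γ → P i × unit * C i + delay (context (η i)) γ i b + processing γ b ≤ unit * t)
              (sym ℓ≡) (into ed))
            (apart ℓ≡))
      ; placed = inj₁ refl
      ; base≡ = trans (update-same C b) t≈base
      ; from≡ = trans from≡ᵘ (trans (State.to≡ su) (cong ctx# (sym (trans (cong context (update-same η b)) ℓ≡))))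
      ; mach≡ = mach≡
      ; load≡ = load≡
      ; before = λ { (inj₁ refl) → ≤-reflexive (trans (update-same C b) t≈base)
                   ; (inj₂ q) → subst (_≤ len (base v)) (sym (update-other C λ { refl → b∉ q }))
                       (≤-trans (before q) (≤-trans finish≤t (≤-reflexive t≈base))) } }
    tail-record : ∀ {m} → cur v ≡ m →
      tail (⟦ record̂ ⟧ (it ∷ v ∷ [])) ≡ ⟦ completionTime ⟧ (it ∷ v ∷ []) ∙ (m ∙ mach v)
    tail-record m≡ = trans (cong tail record̂-def)
      (cong (λ m → ⟦ completionTime ⟧ (it ∷ v ∷ []) ∙ (m ∙ mach v)) m≡)
    conclude : ∀ γ → γ ≡ β → AtCut (Add b P) b v (k + weight# it v) (⟦ record̂ ⟧ (it ∷ v ∷ []) ∙ tr)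
    conclude server eq = at-cut (onServer first) eq (matches (cur v) refl (trans cur≈ (cong ctx# (sym eq))))
      where
      matches : ∀ m → cur v ≡ m → len m ≡ 0 → Match (tail (⟦ record̂ ⟧ (it ∷ v ∷ []))) t (onServer first)
      matches nil m≡ _ = subst (λ r → Match r t (onServer first)) (sym (tail-record m≡))
        (atServer refl (trans mach≡ (sym toℕ-first)))
    conclude (cloud κ) eq = at-cut (onCloud κ) eq (matches (cur v) refl (trans cur≈ (cong ctx# (sym eq))))
      where
      matches : ∀ m → cur v ≡ m → len m ≡ suc (toℕ κ) → Match (tail (⟦ record̂ ⟧ (it ∷ v ∷ []))) t (onCloud κ)
      matches (d ∙ m) m≡ m≈ = subst (λ r → Match r t (onCloud κ)) (sym (tail-record m≡)) (atCloud refl (suc-injective m≈))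

  _⊆_ : Triples → (Tree → ℕ → Tree → Set) → Set
  P ⊆ Q = ∀ {v k tr} → P v k tr → Q v k tr

  InA : Triples → Set
  InA P = ∀ {v k tr} → P v k tr → v ∈ A

  mid-next : ∀ {P : Job → Set} {a b x ta tb tx u v k tr} → Index ta a → Index tb b → Index tx x →
    Edge a x × Edge x b × (∀ {i} → Edge i x → i ≡ a) → ¬ P x → v ∈ A → u ∈ A → InSegment P a b u k tr →
    let it = (tx ∙ ta) ∙ (nil ∙ tb) in
    Yes (⟦ check ⟧ (c ∷ it ∷ u ∷ v ∷ [])) →
    InSegment (Add x P) a b v (k + weight# it v) (⟦ record̂ ⟧ (it ∷ v ∷ []) ∙ tr)
  mid-next {a = a} {b} {x} {ta} {tb} {tx} {u} {v} ta≈ tb≈ tx≈ (ax , xb , into) x∉ v∈ u∈ inv chk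
    with ok , move ← midOk⁻ (subst Yes (check-def {c} {tx} {ta} {nil ∙ tb} {u} {v}) chk) =
    MidStep.mid-step inv x∉ into ax xb ta≈ tb≈ tx≈ (state⁻ u∈) (state⁻ v∈) ok move

  -- The last component says that nothing but the listed jobs was added; it keeps the jobs of later
  -- segments unplaced.
  mids-sound : ∀ {a b ta tb rest xs its} → Index ta a → Index tb b →
    Listed (λ x → (x ∙ ta) ∙ (nil ∙ tb)) rest xs its → Unique xs →
    (∀ {x} → x ∈ᴸ xs → Edge a x × Edge x b × (∀ {i} → Edge i x → i ≡ a)) →
    ∀ {P Q} → (∀ {x} → x ∈ᴸ xs → ¬ P x) → Q ⊆ InSegment P a b →
    Σ[ P′ ∈ (Job → Set) ] Σ[ Q′ ∈ Triples ]
      (Reach its Q ⊆ Reach rest Q′ × Q′ ⊆ InSegment P′ a b ×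
       (∀ {j} → P j → P′ j) × (∀ {x} → x ∈ᴸ xs → P′ x) × (∀ {j} → P′ j → j ∈ᴸ xs ⊎ P j))
  mids-sound ta≈ tb≈ [] _ _ {P} {Q} _ inv = P , Q , id , inv , id , (λ ()) , inj₂
  mids-sound {a} {b} {ta} {tb} ta≈ tb≈ (_∷_ {x} {xs} {tx} x≈ l) (x∉xs ∷ unique) edges {P} {Q} fresh inv
    with P′ , Q′ , reach , inv′ , old , new , only ← mids-sound ta≈ tb≈ l unique (λ x∈ → edges (there x∈))
           {Add x P} {Next ((tx ∙ ta) ∙ (nil ∙ tb)) Q}
           (λ { y∈ (inj₁ y≡x) → All.lookup x∉xs y∈ (sym y≡x) ; y∈ (inj₂ p) → fresh (there y∈) p })
           (λ { (next v∈ u∈ q chk _) → mid-next ta≈ tb≈ x≈ (edges (here refl)) (fresh (here refl)) v∈ u∈ (inv q) chk }) =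
    P′ , Q′ , reach , inv′ , (λ p → old (inj₂ p)) ,
    (λ { (here refl) → old (inj₁ refl) ; (there y∈) → new y∈ }) ,
    (λ p → case only p of λ { (inj₁ y∈) → inj₁ (there y∈) ; (inj₂ (inj₁ refl)) → inj₁ (here refl) ; (inj₂ (inj₂ q)) → inj₂ q })

  plan-sound : ∀ {a js its} → Plan a js its → Unique js → ∀ {P Q} → (∀ {j} → j ∈ᴸ js → ¬ P j) →
    Q ⊆ AtCut P a →
    Σ[ P′ ∈ (Job → Set) ] (Reach its Q ⊆ AtCut P′ sink × (∀ {j} → P j → P′ j) × (∀ {j} → j ∈ᴸ js → P′ j))
  plan-sound end _ {P} _ inv = P , inv , id , λ ()
  plan-sound (segment {a} {b} {xs} {js} {ta} {tb} {tb′} {its} {rest} ta≈ tb≈ tb′≈ seg l plan) unique {P} {Q} fresh inv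
    with P₁ , Q₁ , reach₁ , inv₁ , old₁ , new₁ , only₁ ← mids-sound ta≈ tb≈ l (Segment.distinct seg)
           (λ x∈ → Segment.enters seg x∈ , Segment.leaves seg x∈ , Segment.into-mid seg x∈)
           (λ x∈ → fresh (∈-++⁺ˡ x∈))
           (λ q → enter-segment seg (λ x∈ → fresh (∈-++⁺ˡ x∈)) (inv q))
    with apart , b∉js ∷ unique-js ← unique-++⁻ xs unique
    with b∉ ← (λ (p : P₁ b) → case only₁ p of λ
           { (inj₁ b∈) → apart b∈ (here refl) refl ; (inj₂ q) → fresh (∈-++⁺ʳ xs (here refl)) q })
    with P₂ , reach₂ , old₂ , new₂ ← plan-sound plan unique-js {Add b P₁} {Next ((tb′ ∙ ta) ∙ nil) Q₁}
           (λ { j∈ (inj₁ refl) → All.lookup b∉js j∈ refl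
              ; j∈ (inj₂ p) → case only₁ p of λ
                  { (inj₁ j∈xs) → apart j∈xs (there j∈) refl ; (inj₂ q) → fresh (∈-++⁺ʳ xs (there j∈)) q } })
           (λ { (next {u} v∈ u∈ q chk _) → chain-step (inv₁ q) b∉ seg new₁ ta≈ tb′≈ (state⁻ u∈) (state⁻ v∈)
                (chainOk⁻ (subst Yes (check-def {c} {tb′} {ta} {nil} {u}) chk)) }) =
    P₂ , (λ r → reach₂ (reach₁ r)) , (λ p → old₂ (inj₂ (old₁ p))) ,
    (λ j∈ → case ∈-++⁻ xs j∈ of λ
      { (inj₁ j∈xs) → old₂ (inj₂ (new₁ j∈xs))
      ; (inj₂ (here refl)) → old₂ (inj₁ refl)
      ; (inj₂ (there j∈js)) → new₂ j∈js })

  init-sound : Init ⊆ AtCut (_≡ source) source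
  init-sound {v} (_ , y , refl , refl) = record
    { C = λ _ → 0 ; η = λ _ → onServer first
    ; partial = record
        { match = λ _ → unplaced ; default = λ _ → refl ; source-placed = refl ; source-server = refl
        ; spent = zeros jobs
        ; disjoint = λ { refl refl i≢j → ⊥-elim (i≢j refl) }
        ; precedes = λ { refl ed → ⊥-elim (no-pred-source _ ed) } }
    ; placed = refl ; base≡ = sym base≡ ; from≡ = from≡ ; mach≡ = mach≡ ; load≡ = load≡ ; before = λ _ → z≤n }
    where
    open Initial (isInitial⁻ {v} y)
    zeros : ∀ n → sum (tabulate {n = n} λ _ → 0) ≡ 0
    zeros zero    = refl
    zeros (suc n) = zeros n

  plan-later : ∀ {a js its} → Plan a js its → ∀ {j} → j ∈ᴸ js → rank a < rank j
  plan-later (segment {a} {b} {xs} _ _ _ seg _ plan) j∈ with ∈-++⁻ xs j∈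
  ... | inj₁ j∈xs = rank-edge (Segment.enters seg j∈xs)
  ... | inj₂ (here refl) = Segment.forward seg
  ... | inj₂ (there j∈js) = <-trans (Segment.forward seg) (plan-later plan j∈js)

  plan-complete : ∀ {a js its} → Plan a js its → ∀ j → rank a < rank j → j ∈ᴸ js
  plan-complete end j lt = ⊥-elim (<-irrefl refl (≤-trans lt (max-rank j)))
  plan-complete (segment {a} {b} {xs} _ _ _ seg _ plan) j lt with rank j ≤? rank b
  ... | no gt = ∈-++⁺ʳ xs (there (plan-complete plan j (≰⇒> gt)))
  ... | yes le with Segment.covers seg j lt le
  ...   | inj₁ j∈ = ∈-++⁺ˡ j∈
  ...   | inj₂ refl = ∈-++⁺ʳ xs (here refl)

  plan-unique : ∀ {a js its} → Plan a js its → Unique js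
  plan-unique end = []
  plan-unique (segment {a} {b} {xs} {js} _ _ _ seg _ plan) = unique-++⁺ (Segment.distinct seg)
    (All.tabulate (λ j∈ b≡j → <-irrefl (cong rank b≡j) (plan-later plan j∈)) ∷ plan-unique plan)
    λ { (x∈ , here refl) → <-irrefl refl (rank-edge (Segment.leaves seg x∈))
      ; (x∈ , there x∈js) → <-asym (rank-edge (Segment.leaves seg x∈)) (plan-later plan x∈js) }

  -- The jobs are listed downwards and the fold conses, so the rows come out in the ascending order
  -- of `encodeTable`.
  output-spec : (tr : Tree) (C : Job → ℕ) (η : Job → Place) → (∀ j → Match (find tr (toℕ j)) (C j) (η j)) →
    ⟦ output ⟧ (adjacency ∷ e ∷ tr ∷ []) ≡
    encodeTable (λ j → encodeℕ (expand (len e) (C j)) ∙ encodeLocation (η j))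
  output-spec tr C η match = trans (output-def {adjacency} {e} {tr}) (trans
    (cong (λ J → iter (λ x a → ⟦ row ⟧ (e ∷ ⟦ look ⟧ (tr ∷ x ∷ []) ∷ []) ∙ a) J nil) jobIndices-spec)
    (trans (iter-listing↑ (λ x → ⟦ row ⟧ (e ∷ ⟦ look ⟧ (tr ∷ x ∷ []) ∷ [])) (jobs ∸ 1) nil)
      (trans (cong (λ n → listing↑ (λ i → ⟦ row ⟧ (e ∷ ⟦ look ⟧ (tr ∷ unary i ∷ []) ∷ [])) n nil) (suc-pred′ source))
        (listing↑-table (λ j → encodeℕ (expand (len e) (C j)) ∙ encodeLocation (η j))
          (λ i → ⟦ row ⟧ (e ∷ ⟦ look ⟧ (tr ∷ unary i ∷ []) ∷ [])) λ j → trans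
          (cong (λ r → ⟦ row ⟧ (e ∷ r ∷ [])) (trans (look-spec tr (unary (toℕ j))) (cong (find tr) (len-unary (toℕ j)))))
          (row-spec (match j))))))
    where
    suc-pred′ : ∀ {n} → Fin n → suc (n ∸ 1) ≡ n
    suc-pred′ {suc n} _ = refl
    digits : ∀ {t n} → len t ≡ n → ⟦ toDigits ⟧ (t ∷ []) ≡ encodeℕ n
    digits {t} eq = trans (toDigits-spec t) (cong encodeℕ eq)
    scaled : ∀ {t n} → len t ≡ n → ⟦ scale ⟧ (e ∷ ⟦ toDigits ⟧ (t ∷ []) ∷ []) ≡ encodeℕ (expand (len e) n)
    scaled {n = n} eq = trans (cong (λ t → ⟦ scale ⟧ (e ∷ t ∷ [])) (digits eq)) (scale-spec e n)
    row-spec : ∀ {r n ℓ} → Match r n ℓ → ⟦ row ⟧ (e ∷ r ∷ []) ≡ encodeℕ (expand (len e) n) ∙ encodeLocation ℓ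
    row-spec unplaced = trans row-nil (cong₂ _∙_ (scaled {nil} refl)
      (cong (nil ∙_) (digits {nil} (sym toℕ-first))))
    row-spec (atServer {t} {q} t≡ q≡) = trans (row-def {e} {t} {nil} {q}) (cong₂ _∙_ (scaled t≡) (cong (nil ∙_) (digits q≡)))
    row-spec (atCloud {t} {d} {m} {q} t≡ m≡) =
      trans (row-def {e} {t} {d ∙ m} {q}) (cong₂ _∙_ (scaled t≡) (cong ((nil ∙ nil) ∙_) (digits m≡)))

  record Solution (v tr : Tree) : Set where
    field
      schedule   : Schedule I
      valid      : IsValid I schedule
      in-budget  : totalCost I schedule ≤ budget
      makespan≡  : makespan I schedule ≡ expand (len e) (len (base v))
      encoded    : ⟦ output ⟧ (adjacency ∷ e ∷ tr ∷ []) ≡ encodeSchedule I schedule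

  solution : ∀ {js v k tr} → Plan source js items → Reach items Init v k tr → k ≤ budget →
    len (from v) ≡ 0 → Solution v tr
  solution {js} {v} {k} {tr} plan r k≤ z
    with P , inv , old , new ← plan-sound plan (plan-unique plan) {_≡ source}
           (λ { j∈ refl → <-irrefl refl (plan-later plan j∈) }) init-sound
    = result (inv r) (λ j → all-placed j)
    where
    all-placed : ∀ j → P j
    all-placed j with rank j in eq
    ... | zero = subst P (sym (source-cut j (trans eq (sym rank-source)))) (old refl)
    ... | suc _ = new (plan-complete plan j (subst₂ _<_ (sym rank-source) (sym eq) (s≤s z≤n)))
    result : AtCut P sink v k tr → (∀ j → P j) → Solution v tr
    result cut all = record
      { schedule = S
      ; valid = record
          { source-on-server = source-server
          ; sink-on-server = ctx#-injective (trans (sym from≡) z)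
          ; no-overlap = λ i j q i≢j ηi ηj → case disjoint (all i) (all j) i≢j ηi ηj of λ
              { (inj₁ le) → inj₁ (expand-mono (len e) le) ; (inj₂ le) → inj₂ (expand-mono (len e) le) }
          ; precedence = λ i j ed → ≤-trans (≤-reflexive (+-assoc (expand (len e) (C i)) _ _))
              (expand-mono (len e) (≤-trans (≤-reflexive (sym (+-assoc (unit * C i) _ _))) (proj₂ (precedes (all j) ed)))) }
      ; in-budget = ≤-trans (≤-reflexive (trans (sum-cong λ j → costs j (context (η j))) spent)) k≤
      ; makespan≡ = cong (expand (len e)) base≡
      ; encoded = output-spec tr C η match }
      where
      open AtCut cut
      open Partial partial
      S : Schedule I
      S = record { completion = λ j → expand (len e) (C j) ; location = η }
      costs : ∀ j α → costAt I S j α ≡ costAtᶜ j α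
      costs j server    = refl
      costs j (cloud κ) = refl

  Completed : Tree → ℕ → Set
  Completed its T = ∃[ v ] ∃[ k ] ∃[ tr ] (Reach its Init v k tr × len (from v) ≡ 0 × len (base v) ≤ T)

-- Completeness

sumᴸ : ∀ {X : Set} → (X → ℕ) → List X → ℕ
sumᴸ f []       = 0
sumᴸ f (x ∷ xs) = f x + sumᴸ f xs

sumᴸ-++ : ∀ {X : Set} (f : X → ℕ) xs ys → sumᴸ f (xs ++ ys) ≡ sumᴸ f xs + sumᴸ f ys
sumᴸ-++ f []       ys = refl
sumᴸ-++ f (x ∷ xs) ys = trans (cong (f x +_) (sumᴸ-++ f xs ys)) (sym (+-assoc (f x) _ _))

ifServer : ∀ {k} → Context k → ℕ → ℕ
ifServer server    n = n
ifServer (cloud _) n = 0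

module Completeness (I : Instance) (extended : IsExtendedChain I) (e : Tree)
  (κ : Instance.Job I → Context (Instance.clouds I)) where
  open Schedules I extended e public

  work : Job → ℕ
  work x = ifServer (κ x) (p̂ (κ x) x)

  costᶜ : Job → ℕ
  costᶜ x = costAtᶜ x (κ x)

  -- Only the contexts of a schedule enter here; of its completion times nothing is kept but a
  -- segment length.
  record Fits (a : Job) (xs : List Job) (b : Job) (L : ℕ) : Set where
    field
      latencies : ∀ {x} → x ∈ᴸ xs → d̂ (κ a) (κ x) a x + (p̂ (κ x) x + d̂ (κ x) (κ b) x b) ≤ L
      direct    : d̂ (κ a) (κ b) a b ≤ L
      capacity  : sumᴸ work xs ≤ machines# * L

  data Timed : ∀ {a js its} → Plan a js its → ℕ → Set where
    end     : Timed end 0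
    segment : ∀ {a b xs js ta tb tb′ its rest T L}
      {ta≈ : Index ta a} {tb≈ : Index tb b} {tb′≈ : Index tb′ b} {seg : Segment a xs b}
      {l : Listed (λ x → (x ∙ ta) ∙ (nil ∙ tb)) (((tb′ ∙ ta) ∙ nil) ∙ rest) xs its} {plan : Plan b js rest} →
      Fits a xs b L → Timed plan T →
      Timed (segment ta≈ tb≈ tb′≈ seg l plan) (p̂ (κ b) b + (L + (L + (L + T))))

  cutState : Job → Context clouds → ℕ → ℕ → Tree
  cutState a β L V = state (κ a) (κ a) β L V 0 0

  mid-go : ∀ {a b x ta tb tx μ ν L V q ℓ q′ ℓ′ Q k tr} → Index ta a → Index tb b → Index tx x →
    let it = (tx ∙ ta) ∙ (nil ∙ tb)
        u = state μ (κ a) (κ b) L V q ℓ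
        v = state ν (κ a) (κ b) L V q′ ℓ′ in
    u ∈ A → v ∈ A → d̂ (κ a) ν a x + (p̂ ν x + d̂ ν (κ b) x b) ≤ L → Move (p̂ ν x) u v →
    Q u k tr → k + costAtᶜ x ν ≤ budget# →
    Next it Q v (k + costAtᶜ x ν) (⟦ record̂ ⟧ (it ∷ v ∷ []) ∙ tr)
  mid-go {a} {b} {x} {ta} {tb} {tx} {μ} {ν} {L} {V} {q} {ℓ} {q′} {ℓ′} {Q} {k} {tr}
    ta≈ tb≈ tx≈ u∈ v∈ lat move r k≤ =
    subst (λ w → Next it Q v (k + w) (⟦ record̂ ⟧ (it ∷ v ∷ []) ∙ tr)) weight≡
      (next v∈ u∈ r (subst Yes (sym (check-def {c} {tx} {ta} {nil ∙ tb} {u} {v})) (midOk⁺ holds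
        (subst (λ p → Move p u v) (sym p≡) move))) (subst (λ w → k + w ≤ budget#) (sym weight≡) k≤))
    where
    it u v : Tree
    it = (tx ∙ ta) ∙ (nil ∙ tb)
    u = state μ (κ a) (κ b) L V q ℓ
    v = state ν (κ a) (κ b) L V q′ ℓ′
    weight≡ : weight# it v ≡ costAtᶜ x ν
    weight≡ = weight-value tx≈ (len-unary (ctx# ν))
    p≡ : len (⟦ duration̂ ⟧ (c ∷ cur v ∷ tx ∷ [])) ≡ p̂ ν x
    p≡ = duration̂-value (len-unary (ctx# ν)) tx≈
    holds : MidOk c tx ta tb u v
    holds = record
      { from≡ = refl ; to≡ = refl ; span≡ = refl ; base≡ = refl
      ; latency≤ = subst₂ _≤_ (sym (trans (len-latency {c} {tx} {ta} {tb} {u} {v})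
          (cong₂ _+_ (delaŷ-value (len-unary (ctx# (κ a))) (len-unary (ctx# ν)) ta≈ tx≈)
            (cong₂ _+_ p≡ (delaŷ-value (len-unary (ctx# ν)) (len-unary (ctx# (κ b))) tx≈ tb≈)))))
          (sym (len-unary L)) lat }

  -- A machine left behind carries more than `L`, so counting it as `L` in `room` errs on the safe
  -- side. Once the load exceeds `L`, the same inequality shows that another machine is left.
  record Filled (a b : Job) (L V W : ℕ) (Q : Triples) (k : ℕ) : Set where
    field
      {μ}    : Context clouds
      {q ℓ}  : ℕ
      {tr}   : Tree
      mach<  : q < machines#
      load≤  : ℓ ≤ len H
      room   : q * L + ℓ + W ≤ machines# * L
      member : Q (state μ (κ a) (κ b) L V q ℓ) k tr

  -- Machines are filled one after the other, each until its load exceeds L.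
  mid-reach : ∀ {a b x ta tb tx L V W Q k} → Index ta a → Index tb b → Index tx x →
    d̂ (κ a) (κ x) a x + (p̂ (κ x) x + d̂ (κ x) (κ b) x b) ≤ L →
    L + L ≤ len H → V ≤ len H → k + costᶜ x ≤ budget# →
    Filled a b L V (work x + W) Q k → Filled a b L V W (Next ((tx ∙ ta) ∙ (nil ∙ tb)) Q) (k + costᶜ x)
  mid-reach {a} {b} {x} {L = L} {V} {W} {Q} {k} ta≈ tb≈ tx≈ lat 2L≤ V≤ k≤ filled with κ x
  ... | cloud γ = record
    { mach< = mach< ; load≤ = load≤ ; room = room
    ; member = mid-go ta≈ tb≈ tx≈ (state⁺ μ (κ a) (κ b) L≤ V≤ mach< load≤)
        (state⁺ (cloud γ) (κ a) (κ b) L≤ V≤ mach< load≤) lat (outside tt refl refl) member k≤ }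
    where
    open Filled filled
    L≤ : L ≤ len H
    L≤ = ≤-trans (m≤m+n L L) 2L≤
  ... | server = go (ℓ ≤? L)
    where
    open Filled filled
    p : ℕ
    p = p̂ server x
    p≤L : p ≤ L
    p≤L = ≤-trans (≤-trans (m≤m+n p _) (m≤n+m _ (d̂ (κ a) server a x))) lat
    L≤ : L ≤ len H
    L≤ = ≤-trans (m≤m+n L L) 2L≤
    u∈ : state μ (κ a) (κ b) L V q ℓ ∈ A
    u∈ = state⁺ μ (κ a) (κ b) L≤ V≤ mach< load≤
    go : _ → Filled a b L V W _ (k + 0)
    go (yes ℓ≤L) = record
      { mach< = mach< ; load≤ = load≤′
      ; room = ≤-trans (≤-reflexive (lemma (q * L) ℓ p W)) room
      ; member = mid-go ta≈ tb≈ tx≈ u∈ (state⁺ server (κ a) (κ b) L≤ V≤ mach< load≤′) lat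
          (stay refl refl (subst₂ _≤_ (sym (len-unary ℓ)) (sym (len-unary L)) ℓ≤L)
            (trans (len-unary (ℓ + p)) (cong (_+ p) (sym (len-unary ℓ))))) member k≤ }
      where
      load≤′ : ℓ + p ≤ len H
      load≤′ = ≤-trans (+-mono-≤ ℓ≤L p≤L) 2L≤
      lemma : ∀ m ℓ p W → m + (ℓ + p) + W ≡ m + ℓ + (p + W)
      lemma = solve-∀
    go (no ℓ≰L) = record
      { mach< = mach<′ ; load≤ = ≤-trans p≤L L≤
      ; room = ≤-trans (≤-trans (≤-reflexive (lemma L (q * L) p W))
          (+-monoˡ-≤ (p + W) (+-monoʳ-≤ (q * L) (<⇒≤ L<ℓ)))) room
      ; member = mid-go ta≈ tb≈ tx≈ u∈ (state⁺ server (κ a) (κ b) L≤ V≤ mach<′ (≤-trans p≤L L≤)) lat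
          (advance refl (trans (len-unary (suc q)) (cong suc (sym (len-unary q)))) (len-unary p)) member k≤ }
      where
      L<ℓ : L < ℓ
      L<ℓ = ≰⇒> ℓ≰L
      mach<′ : suc q < machines#
      mach<′ = *-cancelʳ-< L (suc q) machines# (≤-trans
        (s≤s (≤-reflexive (+-comm L (q * L)))) (≤-trans (≤-reflexive (sym (+-suc (q * L) L)))
          (≤-trans (+-monoʳ-≤ (q * L) L<ℓ) (≤-trans (m≤m+n (q * L + ℓ) (p + W)) room))))
      lemma : ∀ L m p W → L + m + p + W ≡ m + L + (p + W)
      lemma = solve-∀

  mids-reach : ∀ {a b ta tb rest xs its L V Q k} → Index ta a → Index tb b →
    Listed (λ x → (x ∙ ta) ∙ (nil ∙ tb)) rest xs its →
    (∀ {x} → x ∈ᴸ xs → d̂ (κ a) (κ x) a x + (p̂ (κ x) x + d̂ (κ x) (κ b) x b) ≤ L) →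
    L + L ≤ len H → V ≤ len H → k + sumᴸ costᶜ xs ≤ budget# →
    Filled a b L V (sumᴸ work xs) Q k →
    Σ[ Q′ ∈ Triples ] (Reach rest Q′ ⊆ Reach its Q × Filled a b L V 0 Q′ (k + sumᴸ costᶜ xs))
  mids-reach {a} {b} {L = L} {V} {Q} {k} ta≈ tb≈ [] lat 2L≤ V≤ k≤ filled =
    Q , id , subst (Filled a b L V 0 Q) (sym (+-identityʳ k)) filled
  mids-reach {a} {b} {L = L} {V} {k = k} ta≈ tb≈ (_∷_ {x} {xs} x≈ l) lat 2L≤ V≤ k≤ filled
    with Q′ , sub , filled′ ← mids-reach ta≈ tb≈ l (λ x∈ → lat (there x∈)) 2L≤ V≤
           (≤-trans (≤-reflexive (+-assoc k _ _)) k≤)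
           (mid-reach ta≈ tb≈ x≈ (lat (here refl)) 2L≤ V≤
             (≤-trans (+-monoʳ-≤ k (m≤m+n (costᶜ x) _)) k≤) filled) =
    Q′ , sub , subst (Filled a b L V 0 Q′) (+-assoc k _ _) filled′

  chain-reach : ∀ {a b ta tb β L L′ V Q k} → Index ta a → Index tb b →
    d̂ (κ a) (κ b) a b ≤ L →
    let V′ = p̂ (κ b) b + (L + (L + (L + V))) in
    V′ ≤ len H → L′ ≤ len H → k + costᶜ b ≤ budget# → Filled a b L V 0 Q k →
    ∃[ tr ] Next ((tb ∙ ta) ∙ nil) Q (cutState b β L′ V′) (k + costᶜ b) tr
  chain-reach {a} {b} {ta} {tb} {β} {L} {L′} {V} {Q} {k} ta≈ tb≈ direct V′≤ L′≤ k≤ filled =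
    _ , subst (λ w → Next it Q v (k + w) (⟦ record̂ ⟧ (it ∷ v ∷ []) ∙ tr)) weight≡
      (next (state⁺ (κ b) (κ b) β L′≤ V′≤ 1≤machines z≤n) (state⁺ μ (κ a) (κ b) L≤ V≤ mach< load≤) member
        (subst Yes (sym (check-def {c} {tb} {ta} {nil} {u} {v})) (chainOk⁺ holds))
        (subst (λ w → k + w ≤ budget#) (sym weight≡) k≤))
    where
    open Filled filled
    V′ : ℕ
    V′ = p̂ (κ b) b + (L + (L + (L + V)))
    it u v : Tree
    it = (tb ∙ ta) ∙ nil
    u = state μ (κ a) (κ b) L V q ℓ
    v = cutState b β L′ V′
    weight≡ : weight# it v ≡ costᶜ b
    weight≡ = weight-value tb≈ (len-unary (ctx# (κ b)))
    L≤ : L ≤ len H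
    L≤ = ≤-trans (≤-trans (m≤m+n L _) (m≤n+m _ (p̂ (κ b) b))) V′≤
    V≤ : V ≤ len H
    V≤ = ≤-trans (≤-trans (≤-trans (≤-trans (m≤n+m V L) (m≤n+m _ L)) (m≤n+m _ L)) (m≤n+m _ (p̂ (κ b) b))) V′≤
    holds : ChainOk c tb ta u v
    holds = record
      { cur≡ = refl
      ; from≡ = refl
      ; base≡ = trans (len-unary V′) (cong₂ _+_ (sym (duration̂-value (len-unary (ctx# (κ b))) tb≈))
          (cong₂ _+_ (sym (len-unary L)) (cong₂ _+_ (sym (len-unary L)) (cong₂ _+_ (sym (len-unary L)) (sym (len-unary V))))))
      ; delay≤ = subst₂ _≤_ (sym (delaŷ-value (len-unary (ctx# (κ a))) (len-unary (ctx# (κ b))) ta≈ tb≈))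
          (sym (len-unary L)) direct
      ; mach≡ = refl
      ; load≡ = refl }

  record Reached′ (V k : ℕ) (Q : Triples) : Set where
    field
      {v tr} : Tree
      member : Q v k tr
      from≡  : len (from v) ≡ ctx# (κ sink)
      base≡  : len (base v) ≡ V

  -- The state at a cut vertex already contains the guesses for the following segment, so these are
  -- supplied first and the path is continued from them.
  plan-reach : ∀ {a js its T} {plan : Plan a js its} → Timed plan T → ∀ {V} → V + T ≤ len H →
    ∃[ β ] ∃[ L ] (L ≤ len H × (∀ {Q k tr} → k + sumᴸ costᶜ js ≤ budget# → Q (cutState a β L V) k tr →
      Reached′ (V + T) (k + sumᴸ costᶜ js) (Reach its Q)))
  plan-reach end {V} V≤ = server , 0 , z≤n , λ {Q} {k} {tr} k≤ r → record
    { member = subst (λ k → Q (cutState sink server 0 V) k tr) (sym (+-identityʳ k)) r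
    ; from≡ = len-unary (ctx# (κ sink))
    ; base≡ = trans (len-unary V) (sym (+-identityʳ V)) }
  plan-reach (segment {a} {b} {xs} {js} {ta} {tb} {tb′} {its} {rest} {T} {L} {ta≈} {tb≈} {tb′≈} {_} {l} fits timed) {V} V+T≤ =
    κ b , L , L≤ , λ {Q} k≤ r → go {Q} k≤ r
    where
    open Fits fits
    V′ : ℕ
    V′ = p̂ (κ b) b + (L + (L + (L + V)))
    sum≡ : V′ + T ≡ V + (p̂ (κ b) b + (L + (L + (L + T))))
    sum≡ = lemma (p̂ (κ b) b) L V T
      where
      lemma : ∀ p L V T → p + (L + (L + (L + V))) + T ≡ V + (p + (L + (L + (L + T))))
      lemma = solve-∀
    V′+T≤ : V′ + T ≤ len H
    V′+T≤ = ≤-trans (≤-reflexive sum≡) V+T≤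
    V′≤ : V′ ≤ len H
    V′≤ = ≤-trans (m≤m+n V′ T) V′+T≤
    3L≤ : L + (L + (L + V)) ≤ len H
    3L≤ = ≤-trans (m≤n+m _ (p̂ (κ b) b)) V′≤
    2L≤ : L + L ≤ len H
    2L≤ = ≤-trans (+-monoʳ-≤ L (m≤m+n L _)) 3L≤
    L≤ : L ≤ len H
    L≤ = ≤-trans (m≤m+n L L) 2L≤
    V≤ : V ≤ len H
    V≤ = ≤-trans (m≤m+n V _) V+T≤
    costs : ∀ k → k + sumᴸ costᶜ (xs ++ b ∷ js) ≡ k + sumᴸ costᶜ xs + costᶜ b + sumᴸ costᶜ js
    costs k = trans (cong (k +_) (sumᴸ-++ costᶜ xs (b ∷ js)))
      (lemma k (sumᴸ costᶜ xs) (costᶜ b) (sumᴸ costᶜ js))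
      where
      lemma : ∀ k x b j → k + (x + (b + j)) ≡ k + x + b + j
      lemma = solve-∀
    go : ∀ {Q k tr} → k + sumᴸ costᶜ (xs ++ b ∷ js) ≤ budget# → Q (cutState a (κ b) L V) k tr →
      Reached′ (V + (p̂ (κ b) b + (L + (L + (L + T))))) (k + sumᴸ costᶜ (xs ++ b ∷ js)) (Reach its Q)
    go {Q} {k} k≤ r
      with k≤′ ← subst (_≤ budget#) (costs k) k≤
      with Q′ , sub , filled ← mids-reach {Q = Q} ta≈ tb≈ l latencies 2L≤ V≤
             (≤-trans (≤-trans (m≤m+n _ (costᶜ b)) (m≤m+n _ _)) k≤′)
             (record { μ = κ a ; q = 0 ; ℓ = 0 ; mach< = 1≤machines ; load≤ = z≤n ; room = capacity ; member = r })
      with β , L′ , L′≤ , continue ← plan-reach timed V′+T≤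
      with tr′ , r′ ← chain-reach {β = β} {L′ = L′} {Q = Q′} ta≈ tb′≈ direct V′≤ L′≤ (≤-trans (m≤m+n _ _) k≤′) filled
      with done ← continue {Next ((tb′ ∙ ta) ∙ nil) Q′} k≤′ r′ = record
        { member = sub (subst (λ k → Reach rest (Next ((tb′ ∙ ta) ∙ nil) Q′) (Reached′.v done) k (Reached′.tr done)) (sym (costs k)) (Reached′.member done))
        ; from≡ = Reached′.from≡ done
        ; base≡ = trans (Reached′.base≡ done) sum≡ }

  plan-reach-source : ∀ {js its T} {plan : Plan source js its} → Timed plan T → T ≤ len H →
    κ source ≡ server → sumᴸ costᶜ js ≤ budget# → Reached′ T (sumᴸ costᶜ js) (Reach its Init)
  plan-reach-source timed T≤ source≡ k≤ with β , L , L≤ , continue ← plan-reach timed {0} T≤ =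
    continue {Init} k≤ (state⁺ (κ source) (κ source) β L≤ z≤n 1≤machines z≤n ,
      isInitial⁺ (record { from≡ = trans (len-unary (ctx# (κ source))) (cong ctx# source≡)
                         ; base≡ = refl ; mach≡ = refl ; load≡ = refl }) , refl , refl)

  completed : ∀ {its T k} → Reached′ T k (Reach its Init) → κ sink ≡ server → Completed its T
  completed r sink≡ = Reached′.v r , _ , Reached′.tr r , Reached′.member r ,
    trans (Reached′.from≡ r) (cong ctx# sink≡) , ≤-reflexive (Reached′.base≡ r)

-- Comparison with an optimal schedule

sumᴸ-mono : ∀ {X : Set} {f g : X → ℕ} xs → (∀ {x} → x ∈ᴸ xs → f x ≤ g x) → sumᴸ f xs ≤ sumᴸ g xs
sumᴸ-mono []       le = z≤n
sumᴸ-mono (x ∷ xs) le = +-mono-≤ (le (here refl)) (sumᴸ-mono xs (λ x∈ → le (there x∈)))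

sumᴸ-const : ∀ {X : Set} (xs : List X) d → sumᴸ (λ _ → d) xs ≡ length xs * d
sumᴸ-const []       d = refl
sumᴸ-const (x ∷ xs) d = cong (d +_) (sumᴸ-const xs d)

sum-const : ∀ n d → sum (tabulate {n = n} (λ _ → d)) ≡ n * d
sum-const zero    d = refl
sum-const (suc n) d = cong (d +_) (sum-const n d)

sum-mono : ∀ {n} {f g : Fin n → ℕ} → (∀ j → f j ≤ g j) → sum (tabulate f) ≤ sum (tabulate g)
sum-mono {zero}  le = z≤n
sum-mono {suc n} le = +-mono-≤ (le zero) (sum-mono (le ∘ suc))

sum-bump : ∀ {n} {f g : Fin n → ℕ} x d → g x ≡ d + f x → (∀ j → j ≢ x → g j ≡ f j) →
  sum (tabulate g) ≡ d + sum (tabulate f)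
sum-bump {f = f} {g} zero d bump same =
  trans (cong₂ _+_ bump (sum-cong λ j → same (suc j) λ ())) (+-assoc d (f zero) _)
sum-bump {f = f} {g} (suc x) d bump same = trans
  (cong₂ _+_ (same zero λ ()) (sum-bump x d bump λ j j≢x → same (suc j) (j≢x ∘ Fin.suc-injective)))
  (lemma (f zero) d _)
  where
  lemma : ∀ a b c → a + (b + c) ≡ b + (a + c)
  lemma = solve-∀

sumᴸ-unique : ∀ {n} (f : Fin n → ℕ) {xs} → Unique xs → sumᴸ f xs ≤ sum (tabulate f)
sumᴸ-unique f [] = z≤n
sumᴸ-unique f {x ∷ xs} (x∉ ∷ unique) = begin
  f x + sumᴸ f xs                       ≤⟨ +-monoʳ-≤ (f x) (sumᴸ-mono xs λ y∈ → ≤-reflexive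
                                             (sym (update-other f λ y≡x → All.lookup x∉ y∈ (sym y≡x)))) ⟩
  f x + sumᴸ (update f x 0) xs          ≤⟨ +-monoʳ-≤ (f x) (sumᴸ-unique (update f x 0) unique) ⟩
  f x + sum (tabulate (update f x 0))   ≡⟨ +-comm (f x) _ ⟩
  sum (tabulate (update f x 0)) + f x   ≡⟨ sum-update x (update-same f x) (λ j j≢x → sym (update-other f j≢x)) ⟨
  sum (tabulate f)                      ∎
  where open ≤-Reasoning

unique-length : ∀ {n} {xs : List (Fin n)} → Unique xs → length xs ≤ n
unique-length {n} {xs} unique = subst₂ _≤_ (trans (sumᴸ-const xs 1) (*-identityʳ _)) (trans (sum-const n 1) (*-identityʳ n))
  (sumᴸ-unique (λ _ → 1) unique)

sumᴸ-filter : ∀ {X : Set} (f : X → ℕ) {P : X → Set} (P? : ∀ x → Dec (P x)) xs →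
  sumᴸ f xs ≡ sumᴸ f (filter P? xs) + sumᴸ f (filter (¬? ∘ P?) xs)
sumᴸ-filter f P? [] = refl
sumᴸ-filter f P? (x ∷ xs) with P? x
... | yes _ = trans (cong (f x +_) (sumᴸ-filter f P? xs)) (sym (+-assoc (f x) _ _))
... | no _ = trans (cong (f x +_) (sumᴸ-filter f P? xs))
  (lemma (f x) (sumᴸ f (filter P? xs)) (sumᴸ f (filter (¬? ∘ P?) xs)))
  where
  lemma : ∀ a b c → a + (b + c) ≡ b + (a + c)
  lemma = solve-∀

-- Disjoint intervals (C x − p x, C x] within (A, B].
packed : ∀ {X : Set} (C p : X → ℕ) n {A B} xs → length xs ≤ n → Unique xs → A ≤ B →
  (∀ {x} → x ∈ᴸ xs → A + p x ≤ C x × C x ≤ B) →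
  (∀ {x y} → x ∈ᴸ xs → y ∈ᴸ xs → x ≢ y → C x + p y ≤ C y ⊎ C y + p x ≤ C x) →
  A + sumᴸ p xs ≤ B
packed C p n {A} [] _ _ A≤B _ _ = ≤-trans (≤-reflexive (+-identityʳ A)) A≤B
packed {X} C p (suc n) {A} {B} (x ∷ xs) (s≤s xs≤n) (x∉ ∷ unique) A≤B within apart = begin
  A + (p x + sumᴸ p xs)                  ≡⟨ cong (λ m → A + (p x + m)) (sumᴸ-filter p left? xs) ⟩
  A + (p x + (sumᴸ p ls + sumᴸ p rs))    ≡⟨ lemma A (p x) (sumᴸ p ls) (sumᴸ p rs) ⟩
  (A + sumᴸ p ls) + p x + sumᴸ p rs      ≤⟨ +-monoˡ-≤ (sumᴸ p rs) (+-monoˡ-≤ (p x) lefts) ⟩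
  (C x ∸ p x) + p x + sumᴸ p rs          ≡⟨ cong (_+ sumᴸ p rs) (m∸n+n≡m p≤C) ⟩
  C x + sumᴸ p rs                        ≤⟨ rights ⟩
  B                                      ∎
  where
  open ≤-Reasoning
  -- As in quicksort, the interval of `x` divides the others into earlier and later ones. The
  -- filtered lists are not subterms, hence the bound `n` on the length.
  left? : ∀ y → Dec (C y + p x ≤ C x)
  left? y = C y + p x ≤? C x
  ls rs : List X
  ls = filter left? xs
  rs = filter (¬? ∘ left?) xs
  p≤C : p x ≤ C x
  p≤C = ≤-trans (m≤n+m (p x) A) (proj₁ (within (here refl)))
  lefts : A + sumᴸ p ls ≤ C x ∸ p x
  lefts = packed C p n ls (≤-trans (length-filter left? xs) xs≤n) (unique-filter⁺ left? unique)
    (m+n≤o⇒m≤o∸n A (proj₁ (within (here refl))))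
    (λ {y} y∈ → let y∈xs , left = ∈-filter⁻ left? {xs = xs} y∈ in
      proj₁ (within (there y∈xs)) , m+n≤o⇒m≤o∸n (C y) left)
    (λ y∈ z∈ → apart (there (proj₁ (∈-filter⁻ left? {xs = xs} y∈))) (there (proj₁ (∈-filter⁻ left? {xs = xs} z∈))))
  rights : C x + sumᴸ p rs ≤ B
  rights = packed C p n rs (≤-trans (length-filter (¬? ∘ left?) xs) xs≤n) (unique-filter⁺ (¬? ∘ left?) unique)
    (proj₂ (within (here refl)))
    (λ y∈ → let y∈xs , right = ∈-filter⁻ (¬? ∘ left?) {xs = xs} y∈ in
      (case apart (here refl) (there y∈xs) (All.lookup x∉ y∈xs) of λ
        { (inj₁ le) → le ; (inj₂ le) → ⊥-elim (right le) }) ,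
      proj₂ (within (there y∈xs)))
    (λ y∈ z∈ → apart (there (proj₁ (∈-filter⁻ (¬? ∘ left?) {xs = xs} y∈)))
                     (there (proj₁ (∈-filter⁻ (¬? ∘ left?) {xs = xs} z∈))))
  lemma : ∀ A p l r → A + (p + (l + r)) ≡ (A + l) + p + r
  lemma = solve-∀

on? : ∀ {z k} (s : Fin z) (ℓ : Location z k) → Dec (ℓ ≡ onServer s)
on? s (onServer s′) with s′ Fin.≟ s
... | yes refl = yes refl
... | no s′≢s = no λ { refl → s′≢s refl }
on? s (onCloud _) = no λ ()

module _ {X : Set} {z k : ℕ} (η : X → Location z k) (p : X → ℕ) where
  onMachine : Fin z → List X → List X
  onMachine s = filter (on? s ∘ η)

  serverSum : List X → ℕ
  serverSum = sumᴸ (λ x → ifServer (context (η x)) (p x))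

  serverSum-machines : ∀ xs → serverSum xs ≡ sum (tabulate λ s → sumᴸ p (onMachine s xs))
  serverSum-machines [] = sym (trans (sum-const z 0) (*-zeroʳ z))
  serverSum-machines (x ∷ xs) = trans (cong (ifServer (context (η x)) (p x) +_) (serverSum-machines xs)) (go (η x) refl)
    where
    rest : ℕ
    rest = sum (tabulate λ s → sumᴸ p (onMachine s xs))
    accept : ∀ {s} → η x ≡ onServer s → sumᴸ p (onMachine s (x ∷ xs)) ≡ p x + sumᴸ p (onMachine s xs)
    accept {s} eq with on? s (η x)
    ... | yes _ = refl
    ... | no neq = ⊥-elim (neq eq)
    reject : ∀ {s} → η x ≢ onServer s → sumᴸ p (onMachine s (x ∷ xs)) ≡ sumᴸ p (onMachine s xs)
    reject {s} neq with on? s (η x)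
    ... | yes eq = ⊥-elim (neq eq)
    ... | no _ = refl
    go : ∀ ℓ → η x ≡ ℓ → ifServer (context (η x)) (p x) + rest ≡
      sum (tabulate λ s → sumᴸ p (onMachine s (x ∷ xs)))
    go (onServer s) eq = trans (cong (λ ℓ → ifServer (context ℓ) (p x) + rest) eq)
      (sym (sum-bump {f = λ s → sumᴸ p (onMachine s xs)} s (p x) (accept eq) λ j j≢s → reject {j} λ eq′ → j≢s (onServer-injective (trans (sym eq′) eq))))
      where
      onServer-injective : ∀ {i j} → onServer {z} {k} i ≡ onServer j → i ≡ j
      onServer-injective refl = refl
    go (onCloud c) eq = trans (cong (λ ℓ → ifServer (context ℓ) (p x) + rest) eq)
      (sum-cong λ s → sym (reject {s} λ eq′ → case trans (sym eq) eq′ of λ ()))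

roundUp : ∀ e n → ∃[ g ] (n ≤ 2 ^ e * g × 2 ^ e * g ≤ n + 2 ^ e * slack e)
roundUp zero n = n , ≤-reflexive (sym (+-identityʳ n)) , ≤-refl
roundUp (suc e) n = suc (n / u) , lower , upper
  where
  open ≤-Reasoning
  u : ℕ
  u = 2 ^ suc e
  instance
    u≢0 = m^n≢0 2 (suc e)
  lower : n ≤ u * suc (n / u)
  lower = begin
    n                       ≡⟨ m≡m%n+[m/n]*n n u ⟩
    n % u + n / u * u       ≤⟨ +-monoˡ-≤ (n / u * u) (<⇒≤ (m%n<n n u)) ⟩
    u + n / u * u           ≡⟨ *-comm (suc (n / u)) u ⟩
    u * suc (n / u)         ∎
  upper : u * suc (n / u) ≤ n + u * 2
  upper = begin
    u * suc (n / u)         ≡⟨ *-comm u (suc (n / u)) ⟩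
    u + n / u * u           ≤⟨ +-mono-≤ (m≤m*n u 2) (≤-trans (m≤n+m _ (n % u)) (≤-reflexive (sym (m≡m%n+[m/n]*n n u)))) ⟩
    u * 2 + n               ≡⟨ +-comm (u * 2) n ⟩
    n + u * 2               ∎

module Optimum (I : Instance) (extended : IsExtendedChain I) (e : Tree)
  (S : Schedule I) (valid : IsValid I S) where
  open Schedule S renaming (completion to C; location to η)
  open IsValid valid
  open Completeness I extended e (λ j → context (η j)) public

  κ : Job → Context clouds
  κ j = context (η j)

  E : ℕ
  E = unit * error

  dur : Job → ℕ
  dur j = processing (κ j) j

  instance
    unit≢0 = m^n≢0 2 (len e)

  module OneSegment {a xs b} (seg : Segment a xs b) where
    open Segment seg

    through : ∀ {x} → x ∈ᴸ xs →
      C a + (delay (κ a) (κ x) a x + (dur x + delay (κ x) (κ b) x b)) + dur b ≤ C b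
    through {x} x∈ = begin
      C a + (d₁ + (dur x + d₂)) + dur b   ≡⟨ lemma (C a) d₁ (dur x) d₂ (dur b) ⟩
      C a + d₁ + dur x + d₂ + dur b       ≤⟨ +-monoˡ-≤ (dur b) (+-monoˡ-≤ d₂ (precedence a x (enters x∈))) ⟩
      C x + d₂ + dur b                    ≤⟨ precedence x b (leaves x∈) ⟩
      C b                                 ∎
      where
      open ≤-Reasoning
      d₁ d₂ : ℕ
      d₁ = delay (κ a) (κ x) a x
      d₂ = delay (κ x) (κ b) x b
      lemma : ∀ c d p d′ q → c + (d + (p + d′)) + q ≡ c + d + p + d′ + q
      lemma = solve-∀

    start≤ : C a + dur b ≤ C b
    start≤ with linked
    ... | inj₁ ab = ≤-trans (+-monoˡ-≤ (dur b) (m≤m+n (C a) _)) (precedence a b ab)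
    ... | inj₂ (x , x∈) = ≤-trans (+-monoˡ-≤ (dur b) (m≤m+n (C a) _)) (through x∈)

    Λ m g L : ℕ
    Λ = C b ∸ (C a + dur b)
    m = length xs
    g = proj₁ (roundUp (len e) Λ)
    -- Three errors for a path, which rounds two delays and a job, and `m` errors for the rounded
    -- work of the jobs in between.
    L = g + error * (3 + m)

    C-b : C b ≡ C a + Λ + dur b
    C-b = trans (sym (m+[n∸m]≡n start≤)) (lemma (C a) (dur b) Λ)
      where
      lemma : ∀ c q l → c + q + l ≡ c + l + q
      lemma = solve-∀

    within-Λ : ∀ {l} → C a + l + dur b ≤ C b → l ≤ Λ
    within-Λ {l} le = +-cancelˡ-≤ (C a) l Λ (+-cancelʳ-≤ (dur b) _ _ (≤-trans le (≤-reflexive C-b)))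

    L-lower : Λ + E * (3 + m) ≤ unit * L
    L-lower = ≤-trans (+-mono-≤ (proj₁ (proj₂ (roundUp (len e) Λ))) (≤-reflexive (*-assoc unit error (3 + m))))
      (≤-reflexive (sym (*-distribˡ-+ unit g (error * (3 + m)))))

    L-upper : unit * L ≤ Λ + E * (4 + m)
    L-upper = begin
      unit * L                              ≡⟨ *-distribˡ-+ unit g (error * (3 + m)) ⟩
      unit * g + unit * (error * (3 + m))   ≤⟨ +-mono-≤ (proj₂ (proj₂ (roundUp (len e) Λ)))
                                                         (≤-reflexive (sym (*-assoc unit error (3 + m)))) ⟩
      Λ + E + E * (3 + m)                   ≡⟨ lemma Λ E m ⟩
      Λ + E * (4 + m)                       ∎
      where
      open ≤-Reasoning
      lemma : ∀ l E m → l + E + E * (3 + m) ≡ l + E * (4 + m)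
      lemma = solve-∀

    latencies : ∀ {x} → x ∈ᴸ xs → d̂ (κ a) (κ x) a x + (p̂ (κ x) x + d̂ (κ x) (κ b) x b) ≤ L
    latencies {x} x∈ = *-cancelˡ-≤ unit (begin
      unit * (d₁ + (p + d₂))                ≡⟨ lemma₁ unit d₁ p d₂ ⟩
      unit * d₁ + (unit * p + unit * d₂)    ≤⟨ +-mono-≤ (d̂-upper (κ a) (κ x) (enters x∈))
                                                 (+-mono-≤ (p̂-upper (κ x) x) (d̂-upper (κ x) (κ b) (leaves x∈))) ⟩
      (D₁ + E) + ((dur x + E) + (D₂ + E))   ≡⟨ lemma₂ D₁ (dur x) D₂ E ⟩
      (D₁ + (dur x + D₂)) + E * 3           ≤⟨ +-mono-≤ (within-Λ (through x∈)) (*-monoʳ-≤ E (m≤m+n 3 m)) ⟩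
      Λ + E * (3 + m)                       ≤⟨ L-lower ⟩
      unit * L                              ∎)
      where
      open ≤-Reasoning
      d₁ p d₂ D₁ D₂ : ℕ
      d₁ = d̂ (κ a) (κ x) a x
      p  = p̂ (κ x) x
      d₂ = d̂ (κ x) (κ b) x b
      D₁ = delay (κ a) (κ x) a x
      D₂ = delay (κ x) (κ b) x b
      lemma₁ : ∀ u a b c → u * (a + (b + c)) ≡ u * a + (u * b + u * c)
      lemma₁ = solve-∀
      lemma₂ : ∀ a b c E → (a + E) + ((b + E) + (c + E)) ≡ (a + (b + c)) + E * 3
      lemma₂ = solve-∀

    direct : d̂ (κ a) (κ b) a b ≤ L
    direct = *-cancelˡ-≤ unit (≤-trans bound (≤-trans (+-monoʳ-≤ Λ (m≤m*n E (3 + m))) L-lower))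
      where
      bound : unit * d̂ (κ a) (κ b) a b ≤ Λ + E
      bound with cell-edge a b
      ... | inj₁ ab = ≤-trans (d̂-upper (κ a) (κ b) ab) (+-monoˡ-≤ E (within-Λ (precedence a b ab)))
      ... | inj₂ (¬ab , _) = ≤-trans (d̂-none (κ a) (κ b) ¬ab) (m≤n+m E Λ)

    -- Jobs of the segment on one machine are disjoint and lie in the window of length `Λ` between
    -- the completion of `a` and the start of `b`.
    machine-load : ∀ s → sumᴸ dur (onMachine η dur s xs) ≤ Λ
    machine-load s = +-cancelˡ-≤ (C a) _ Λ (packed C dur (length ys) ys ≤-refl
      (unique-filter⁺ (on? s ∘ η) distinct) (m≤m+n (C a) Λ)
      (λ {x} x∈ → let x∈xs , _ = ∈-filter⁻ (on? s ∘ η) {xs = xs} x∈ in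
        ≤-trans (+-monoˡ-≤ (dur x) (m≤m+n (C a) _)) (precedence a x (enters x∈xs)) ,
        +-cancelʳ-≤ (dur b) _ _ (≤-trans (≤-trans (+-monoˡ-≤ (dur b) (m≤m+n (C x) _))
          (precedence x b (leaves x∈xs))) (≤-reflexive C-b)))
      λ {x} {y} x∈ y∈ x≢y →
        let _ , ηx = ∈-filter⁻ (on? s ∘ η) {xs = xs} x∈
            _ , ηy = ∈-filter⁻ (on? s ∘ η) {xs = xs} y∈
        in subst₂ (λ α β → C x + processing β y ≤ C y ⊎ C y + processing α x ≤ C x)
             (sym (cong context ηx)) (sym (cong context ηy)) (no-overlap x y s x≢y ηx ηy))
      where
      ys : List Job
      ys = onMachine η dur s xs

    real-work : serverSum η dur xs ≤ servers * Λ
    real-work = ≤-trans (≤-reflexive (serverSum-machines η dur xs))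
      (≤-trans (sum-mono machine-load) (≤-reflexive (sum-const servers Λ)))

    rounded-work : ∀ ys → unit * sumᴸ work ys ≤ serverSum η dur ys + E * length ys
    rounded-work [] = ≤-trans (≤-reflexive (*-zeroʳ unit)) z≤n
    rounded-work (y ∷ ys) = begin
      unit * (work y + sumᴸ work ys)           ≡⟨ *-distribˡ-+ unit (work y) _ ⟩
      unit * work y + unit * sumᴸ work ys      ≤⟨ +-mono-≤ (one (κ y)) (rounded-work ys) ⟩
      (w + E) + (serverSum η dur ys + E * length ys)  ≡⟨ lemma w E (serverSum η dur ys) (length ys) ⟩
      (w + serverSum η dur ys) + E * suc (length ys)  ∎
      where
      open ≤-Reasoning
      w : ℕ
      w = ifServer (κ y) (dur y)
      one : ∀ α → unit * ifServer α (p̂ (κ y) y) ≤ ifServer α (dur y) + E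
      one server    = p̂-upper (κ y) y
      one (cloud _) = ≤-trans (≤-reflexive (*-zeroʳ unit)) z≤n
      lemma : ∀ w E s n → (w + E) + (s + E * n) ≡ (w + s) + E * suc n
      lemma = solve-∀

    capacity : sumᴸ work xs ≤ machines# * L
    capacity with machines# ≤? jobs
    -- The count is the true number of machines here, so the loads of the single machines can be
    -- summed.
    ... | yes le rewrite Capped.exact machines-capped le = *-cancelˡ-≤ unit (begin
      unit * sumᴸ work xs                  ≤⟨ rounded-work xs ⟩
      serverSum η dur xs + E * m           ≤⟨ +-mono-≤ real-work (≤-trans (≤-trans (*-monoʳ-≤ E (m≤n+m m 3))
                                                (≤-reflexive (sym (+-identityʳ _)))) (*-monoˡ-≤ (E * (3 + m)) servers-positive)) ⟩
      servers * Λ + servers * (E * (3 + m)) ≡⟨ *-distribˡ-+ servers Λ _ ⟨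
      servers * (Λ + E * (3 + m))          ≤⟨ *-monoʳ-≤ servers L-lower ⟩
      servers * (unit * L)                 ≡⟨ lemma servers unit L ⟩
      unit * (servers * L)                 ∎)
      where
      open ≤-Reasoning
      lemma : ∀ a b c → a * (b * c) ≡ b * (a * c)
      lemma = solve-∀
    -- There are more machines than jobs, and one span per job is enough.
    ... | no gt = begin
      sumᴸ work xs            ≤⟨ sumᴸ-mono xs (λ {x} x∈ → ≤-trans (ifServer≤ (κ x)) (≤-trans
                                   (≤-trans (m≤m+n _ (d̂ (κ x) (κ b) x b)) (m≤n+m _ (d̂ (κ a) (κ x) a x))) (latencies x∈))) ⟩
      sumᴸ (λ _ → L) xs       ≡⟨ sumᴸ-const xs L ⟩
      m * L                   ≤⟨ *-monoˡ-≤ L (≤-trans (unique-length distinct) (<⇒≤ (≰⇒> gt))) ⟩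
      machines# * L           ∎
      where
      open ≤-Reasoning
      ifServer≤ : ∀ {n} α → ifServer {clouds} α n ≤ n
      ifServer≤ server    = ≤-refl
      ifServer≤ (cloud _) = z≤n

    fits : Fits a xs b L
    fits = record { latencies = latencies ; direct = direct ; capacity = capacity }

  -- Three times the completion time telescopes over the cut vertices. A segment adds one error for
  -- `b` and 4 + m errors in each of three spans, that is 13 + 3m, at most 13 for each of its m + 1
  -- jobs.
  timed : ∀ {a js its} (plan : Plan a js its) →
    ∃[ T ] (Timed plan T × unit * T + 3 * C a ≤ 3 * C sink + E * (13 * length js))
  timed end = 0 , end , ≤-trans (≤-reflexive (cong (_+ 3 * C sink) (*-zeroʳ unit))) (m≤m+n _ _)
  timed (segment {a} {b} {xs} {js} _ _ _ seg _ plan) with T , t , bound ← timed plan =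
    p̂ (κ b) b + (L + (L + (L + T))) , segment fits t , (begin
      unit * (p̂ (κ b) b + (L + (L + (L + T)))) + 3 * C a
        ≡⟨ lemma₁ unit (p̂ (κ b) b) L T (C a) ⟩
      unit * p̂ (κ b) b + 3 * (unit * L) + (unit * T + 3 * C a)
        ≤⟨ +-monoˡ-≤ _ (+-mono-≤ (p̂-upper (κ b) b) (*-monoʳ-≤ 3 L-upper)) ⟩
      (dur b + E) + 3 * (Λ + E * (4 + m)) + (unit * T + 3 * C a)
        ≤⟨ +-monoˡ-≤ _ (+-monoˡ-≤ _ (+-monoˡ-≤ E (m≤m+n (dur b) (2 * dur b)))) ⟩
      (dur b + 2 * dur b + E) + 3 * (Λ + E * (4 + m)) + (unit * T + 3 * C a)
        ≡⟨ lemma₂ (dur b) E Λ m (unit * T) (C a) ⟩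
      (unit * T + 3 * (C a + Λ + dur b)) + E * (13 + 3 * m)
        ≡⟨ cong (λ n → unit * T + 3 * n + E * (13 + 3 * m)) C-b ⟨
      (unit * T + 3 * C b) + E * (13 + 3 * m)
        ≤⟨ +-mono-≤ bound (*-monoʳ-≤ E (+-monoʳ-≤ 13 (*-monoˡ-≤ m (m≤m+n 3 10)))) ⟩
      (3 * C sink + E * (13 * length js)) + E * (13 + 13 * m)
        ≡⟨ lemma₃ (3 * C sink) E (length js) m ⟩
      3 * C sink + E * (13 * (m + suc (length js)))
        ≡⟨ cong (λ n → 3 * C sink + E * (13 * n)) (length-++ xs) ⟨
      3 * C sink + E * (13 * length (xs ++ b ∷ js)) ∎)
    where
    open ≤-Reasoning
    open OneSegment seg
    lemma₁ : ∀ u p L T c → u * (p + (L + (L + (L + T)))) + 3 * c ≡ u * p + 3 * (u * L) + (u * T + 3 * c)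
    lemma₁ = solve-∀
    lemma₂ : ∀ q E l m t c → (q + 2 * q + E) + 3 * (l + E * (4 + m)) + (t + 3 * c) ≡
      (t + 3 * (c + l + q)) + E * (13 + 3 * m)
    lemma₂ = solve-∀
    lemma₃ : ∀ s E j m → (s + E * (13 * j)) + E * (13 + 13 * m) ≡ s + E * (13 * (m + suc j))
    lemma₃ = solve-∀

  cost≤ : ∀ {js} → Unique js → sumᴸ costᶜ js ≤ totalCost I S
  cost≤ unique = ≤-trans (sumᴸ-unique costᶜ unique) (≤-reflexive (sum-cong λ j → costs j (κ j)))
    where
    costs : ∀ j α → costAtᶜ j α ≡ costAt I S j α
    costs j server    = refl
    costs j (cloud c) = refl

  optimum : ∀ {js its} → Plan source js its → totalCost I S ≤ budget →
    ∃[ T ] (unit * T ≤ 3 * makespan I S + E * (13 * jobs) × (T ≤ len H → Completed its T))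
  optimum {js} {its} plan affordable′ with T , t , bound ← timed plan =
    T , ≤-trans (m≤m+n _ (3 * C source)) (≤-trans bound (+-monoʳ-≤ (3 * C sink)
      (*-monoʳ-≤ E (*-monoʳ-≤ 13 (unique-length (plan-unique plan)))))) ,
    λ T≤ → completed {its} (plan-reach-source t T≤ source-on-server
             (≤-trans (cost≤ (plan-unique plan)) (≤-trans affordable′ (≤-reflexive (sym (bval-encodeℕ budget))))))
             sink-on-server

-- The choice of the scale

error≤2 : ∀ e → slack e ≤ 2
error≤2 zero    = z≤n
error≤2 (suc _) = ≤-refl

∈-table : ∀ {n} (f : Fin n → Tree) j → f j ∈ encodeTable f
∈-table f zero    = here
∈-table f (suc j) = there (∈-table (f ∘ suc) j)

maxScale-≤ : ∀ {x} P → x ∈ P → len (head x) ≤ len (⟦ maxScale ⟧ (P ∷ []))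
maxScale-≤ {x} P x∈ = subst (λ t → len (head x) ≤ len t) (sym maxScale-def) (loop P nil x∈)
  where
  g : Tree → Tree → Tree
  g y a = ⟦ append ⟧ (head y ∷ a ∷ [])
  len-g : ∀ y a → len (g y a) ≡ len (head y) + len a
  len-g y a = trans (cong len (append-spec (head y) a)) (len-revOnto (head y) a)
  grows : ∀ P a → len a ≤ len (iter g P a)
  grows nil     a = ≤-refl
  grows (y ∙ P) a = ≤-trans (≤-trans (m≤n+m (len a) (len (head y))) (≤-reflexive (sym (len-g y a)))) (grows P (g y a))
  loop : ∀ P a → x ∈ P → len (head x) ≤ len (iter g P a)
  loop (x ∙ P) a here = ≤-trans (≤-trans (m≤m+n (len (head x)) (len a)) (≤-reflexive (sym (len-g x a)))) (grows P (g x a))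
  loop (y ∙ P) a (there x∈) = loop P (g y a) x∈

searchStep : (Tree → Tree) → Tree → Tree → Tree
searchStep f e a = cond (f e) (e ∙ f e) a

data Searched (f : Tree → Tree) (n : ℕ) (a : Tree) : Tree → Set where
  success : ∀ i → i ≤ n → Yes (f (unary i)) → (∀ j → j < i → f (unary j) ≡ nil) →
            Searched f n a (unary i ∙ f (unary i))
  failure : (∀ j → j ≤ n → f (unary j) ≡ nil) → Searched f n a a

searched : ∀ f n a → Searched f n a (iter (searchStep f) (downFrom n) a)
searched f zero a with Yes? (f nil)
... | inj₁ y rewrite cond-yes {f nil} {nil ∙ f nil} {a} y = success 0 z≤n y λ _ ()
... | inj₂ eq = subst (Searched f 0 a) (sym (cong (λ t → cond t (nil ∙ t) a) eq)) (failure λ { zero _ → eq })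
searched f (suc n) a = extend-search refl (searched f n (searchStep f (unary (suc n)) a))
  where
  extend-search : ∀ {a′ t} → searchStep f (unary (suc n)) a ≡ a′ → Searched f n a′ t → Searched f (suc n) a t
  extend-search eq (success i i≤ y none) = success i (m≤n⇒m≤1+n i≤) y none
  extend-search eq (failure none) with Yes? (f (unary (suc n)))
  ... | inj₁ y = subst (Searched f (suc n) a) (trans (sym (cond-yes y)) eq)
    (success (suc n) ≤-refl y λ j j≤n → none j (≤-pred j≤n))
  ... | inj₂ no-y = subst (Searched f (suc n) a)
    (trans (sym (cong (λ t → cond t (unary (suc n) ∙ t) a) no-y)) eq)
    (failure λ j j≤ → case m≤n⇒m<n∨m≡n j≤ of λ { (inj₁ lt) → none j (≤-pred lt) ; (inj₂ refl) → no-y })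

module AllOnServers (I : Instance) (extended : IsExtendedChain I) (e : Tree)
  (large : len e ≡ len (⟦ maxScale ⟧ (processingOf (encodeInstance I) ∷ []))) where
  open Completeness I extended e (λ _ → server) public

  instance
    unit≢0 = m^n≢0 2 (len e)

  d̂≤2 : ∀ i j → d̂ server server i j ≤ 2
  d̂≤2 i j = ≤-trans (*-cancelˡ-≤ unit bound) (error≤2 (len e))
    where
    bound : unit * d̂ server server i j ≤ unit * error
    bound with cell-edge i j
    ... | inj₁ ed = ≤-trans (d̂-upper server server ed)
      (≤-reflexive (cong (_+ unit * error) (delay-self server i j ed)))
    ... | inj₂ (¬ed , _) = d̂-none server server ¬ed

  -- At this scale a server time has at most `len e` digits and is below two units; rounding adds at
  -- most two, which leaves it strictly below four.
  p̂≤3 : ∀ j → p̂ server j ≤ 3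
  p̂≤3 j = ≤-pred (*-cancelˡ-< unit _ _ (begin-strict
    unit * p̂ server j                   ≤⟨ p̂-upper server j ⟩
    processing server j + unit * error  <⟨ +-mono-<-≤ p< (*-monoʳ-≤ unit (error≤2 (len e))) ⟩
    2 * unit + unit * 2                 ≡⟨ lemma unit ⟩
    unit * 4                            ∎))
    where
    open ≤-Reasoning
    digits : Tree
    digits = encodeℕ (processing server j)
    short : len digits ≤ len e
    short = subst (len digits ≤_) (sym large) (maxScale-≤ _
      (∈-table (λ j → encodeContextTable (λ m → encodeℕ (processing m j))) j))
    p< : processing server j < 2 * unit
    p< = begin-strict
      processing server j         ≡⟨ bval-encodeℕ (processing server j) ⟨
      bval digits                 <⟨ m<m+n (bval digits) (s≤s z≤n) ⟩
      bval digits + 2             ≤⟨ digits< digits ⟩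
      2 * 2 ^ len digits          ≤⟨ *-monoʳ-≤ 2 (^-monoʳ-≤ 2 short) ⟩
      2 * unit                    ∎
    lemma : ∀ u → 2 * u + u * 2 ≡ u * 4
    lemma = solve-∀

  -- A segment without jobs in between takes 3 + 3 · 7 = 24 units, and each job in between adds 9.
  timed : ∀ {a js its} (plan : Plan a js its) → ∃[ T ] (Timed plan T × T ≤ 24 * length js)
  timed end = 0 , end , z≤n
  timed (segment {a} {b} {xs} {js} _ _ _ seg _ plan) with T , t , bound ← timed plan =
    p̂ server b + (L + (L + (L + T))) , segment fits t , (begin
      p̂ server b + (L + (L + (L + T)))   ≤⟨ +-mono-≤ (p̂≤3 b) (+-monoʳ-≤ L (+-monoʳ-≤ L (+-monoʳ-≤ L bound))) ⟩
      3 + (L + (L + (L + 24 * length js))) ≡⟨ lemma₁ (length xs) (24 * length js) ⟩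
      24 + 9 * length xs + 24 * length js  ≤⟨ +-monoˡ-≤ _ (+-monoʳ-≤ 24 (*-monoˡ-≤ (length xs) (m≤m+n 9 15))) ⟩
      24 + 24 * length xs + 24 * length js ≡⟨ lemma₂ (length xs) (length js) ⟩
      24 * (length xs + suc (length js))   ≡⟨ cong (24 *_) (length-++ xs) ⟨
      24 * length (xs ++ b ∷ js)           ∎)
    where
    open ≤-Reasoning
    L : ℕ
    -- The 7 = 2 + 3 + 2 covers a path, and 3 for each job lets a single machine carry all the work.
    L = 7 + 3 * length xs
    lemma₁ : ∀ m t → 3 + ((7 + 3 * m) + ((7 + 3 * m) + ((7 + 3 * m) + t))) ≡ 24 + 9 * m + t
    lemma₁ = solve-∀
    lemma₂ : ∀ m j → 24 + 24 * m + 24 * j ≡ 24 * (m + suc j)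
    lemma₂ = solve-∀
    fits : Fits a xs b L
    fits = record
      { latencies = λ {x} _ → ≤-trans (+-mono-≤ (d̂≤2 a x) (+-mono-≤ (p̂≤3 x) (d̂≤2 x b))) (m≤m+n 7 _)
      ; direct = ≤-trans (d̂≤2 a b) (m≤m+n 2 _)
      ; capacity = ≤-trans (≤-trans (sumᴸ-mono xs (λ {x} _ → p̂≤3 x)) (≤-reflexive (sumᴸ-const xs 3)))
          (≤-trans (≤-trans (≤-reflexive (*-comm (length xs) 3)) (m≤n+m _ 7))
            (≤-trans (≤-reflexive (sym (+-identityʳ L))) (*-monoˡ-≤ L 1≤machines))) }

  -- A schedule on servers alone costs nothing and is within every budget, so the search cannot fail
  -- at its last scale.
  feasible : ∀ {js its} → Plan source js its → ∃[ T ] Completed its T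
  feasible {js} {its} plan with T , t , bound ← timed plan =
    T , completed {its} (plan-reach-source t T≤ refl (subst (_≤ budget#) (sym (zeros js)) z≤n)) refl
    where
    zeros : ∀ js → sumᴸ costᶜ js ≡ 0
    zeros []       = refl
    zeros (_ ∷ js) = zeros js
    T≤ : T ≤ len H
    T≤ = begin
      T                       ≤⟨ bound ⟩
      24 * length js          ≤⟨ *-monoʳ-≤ 24 (unique-length (plan-unique plan)) ⟩
      24 * jobs               ≡⟨ *-comm 24 jobs ⟩
      jobs * 24               ≤⟨ *-monoʳ-≤ jobs (≤-trans (m≤m+n 24 166) 190≤horizonFactor) ⟩
      jobs * horizonFactor    ≡⟨ len-H ⟨
      len H                   ∎
      where open ≤-Reasoning

-- The computed schedule and its ratio

record Result (I : Instance) (e s : Tree) : Set where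
  field
    {V}        : ℕ
    schedule   : Schedule I
    valid      : IsValid I schedule
    in-budget  : totalCost I schedule ≤ Instance.budget I
    V≡         : V ≡ len (head s)
    V≤         : V ≤ len (⟦ horizon ⟧ (adjacencyOf (encodeInstance I) ∷ []))
    makespan≡  : makespan I schedule ≡ expand (len e) V
    encoded    : ⟦ output ⟧ (adjacencyOf (encodeInstance I) ∷ e ∷ tail s ∷ []) ≡ encodeSchedule I schedule

module AtScale (I : Instance) (extended : IsExtendedChain I) (e : Tree) where
  open Schedules I extended e public

  solution-tree : Tree
  solution-tree = ⟦ solve ⟧ (c ∷ items ∷ A ∷ [])

  selected : Selected (Reach items Init) R nil solution-tree
  selected = solve-spec items

  reached-in-A : ∀ its {P} → InA P → InA (Reach its P)
  reached-in-A nil        inA = inA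
  reached-in-A (it ∙ its) inA = reached-in-A its λ { (next v∈ _ _ _ _) → v∈ }

  solved : ∀ {t} → Completed items t → Yes solution-tree × len (head solution-tree) ≤ t
  solved (v , k , tr , r , z , le)
    with y , le′ ← Selected.minimal selected
           (∈-R⁺ (reached-in-A items {Init} (λ {v} {k} {tr} → proj₁) {v} {k} {tr} r)) z r = y , ≤-trans le′ le

  result : Yes solution-tree → Result I e solution-tree
  result y with v , k , v∈ , z , head≡ , r ← Selected.attained selected y = record
    { schedule = Solution.schedule sol ; valid = Solution.valid sol ; in-budget = Solution.in-budget sol
    ; V≡ = cong len (sym head≡) ; V≤ = State.base≤ (state⁻ (∈-R⁻ v∈))
    ; makespan≡ = Solution.makespan≡ sol ; encoded = Solution.encoded sol }
    where
    kept : k ≤ budget#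
    kept = reach-kept items {Init} (λ {v} {k} {tr} → init-kept {v} {k} {tr}) r
    sol : Solution v (tail solution-tree)
    sol = solution (proj₂ items-plan) r (≤-trans kept (≤-reflexive (bval-encodeℕ budget))) z

module Approximation (I : Instance) (extended : IsExtendedChain I) where
  open Walk I extended

  Ĩ H A : Tree
  Ĩ = encodeInstance I
  H = ⟦ horizon ⟧ (adjacency ∷ [])
  A = ⟦ states ⟧ (Ĩ ∷ H ∷ [])

  solveAt : Tree → Tree
  solveAt e = ⟦ solve ⟧ ((e ∙ (H ∙ Ĩ)) ∷ items ∷ A ∷ [])


  plan : Plan source (proj₁ items-plan) items
  plan = proj₂ items-plan

  module _ (S : Schedule I) (valid : IsValid I S) (in-budget : totalCost I S ≤ budget) where
    M : ℕ
    M = makespan I S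

    N : ℕ
    N = jobs

    bound : ∀ e → ∃[ τ ] (2 ^ len e * τ ≤ 3 * M + 2 ^ len e * slack (len e) * (13 * N) ×
      (τ ≤ len H → Schedules.Completed I extended e items τ))
    bound e = Optimum.optimum I extended e S valid plan in-budget

    found : ∀ e {τ} → Schedules.Completed I extended e items τ → Yes (solveAt e) × len (head (solveAt e)) ≤ τ
    found e {τ} = AtScale.solved I extended e {τ}

    -- If the value derived from the optimum lies within the horizon, the program found one at least
    -- as good; if not, every value found lies within the horizon and is smaller anyway.
    value-bound : ∀ e (r : Result I e (solveAt e)) →
      2 ^ len e * Result.V r ≤ 3 * M + 2 ^ len e * slack (len e) * (13 * N)
    value-bound e r = go (bound e)
      where
      go : ∃[ τ ] (2 ^ len e * τ ≤ 3 * M + 2 ^ len e * slack (len e) * (13 * N) ×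
        (τ ≤ len H → Schedules.Completed I extended e items τ)) →
        2 ^ len e * Result.V r ≤ 3 * M + 2 ^ len e * slack (len e) * (13 * N)
      go (τ , upper , complete) = ≤-trans (*-monoʳ-≤ (2 ^ len e) (V≤τ (τ ≤? len H))) upper
        where
        V≤τ : Dec (τ ≤ len H) → Result.V r ≤ τ
        V≤τ (yes τ≤) = ≤-trans (≤-reflexive (Result.V≡ r)) (proj₂ (found e (complete τ≤)))
        V≤τ (no τ≰)  = ≤-trans (Result.V≤ r) (<⇒≤ (≰⇒> τ≰))

    -- The value derived from the optimum must lie beyond the horizon, or it would have been found.
    -- Of the 188 units per job, 26 are rounding errors and 3 · 54 remain.
    failure-bound : ∀ i → solveAt (unary i) ≡ nil → 54 * (N * 2 ^ i) ≤ M
    failure-bound i none = *-cancelˡ-≤ 3 (+-cancelʳ-≤ (26 * (N * u)) _ _ (begin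
      3 * (54 * (N * u)) + 26 * (N * u)    ≡⟨ lemma₁ N u ⟩
      u * (N * 188)                        ≤⟨ *-monoʳ-≤ u (*-monoʳ-≤ N (≤-trans (m≤m+n 188 2) 190≤horizonFactor)) ⟩
      u * (N * horizonFactor)              ≡⟨ cong (u *_) len-H′ ⟨
      u * len H                            ≤⟨ *-monoʳ-≤ u (<⇒≤ H<τ) ⟩
      u * τ                                ≤⟨ upper ⟩
      3 * M + u * slack (len (unary i)) * (13 * N)
        ≤⟨ +-monoʳ-≤ (3 * M) (*-monoˡ-≤ (13 * N) (*-monoʳ-≤ u (error≤2 (len (unary i))))) ⟩
      3 * M + u * 2 * (13 * N)             ≡⟨ lemma₂ (3 * M) u N ⟩
      3 * M + 26 * (N * u)                 ∎))
      where
      open ≤-Reasoning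
      u : ℕ
      u = 2 ^ i
      τ : ℕ
      τ = proj₁ (bound (unary i))
      upper : u * τ ≤ 3 * M + u * slack (len (unary i)) * (13 * N)
      upper = subst (λ j → 2 ^ j * τ ≤ 3 * M + 2 ^ j * slack (len (unary i)) * (13 * N)) (len-unary i) (proj₁ (proj₂ (bound (unary i))))
      H<τ : len H < τ
      H<τ = ≰⇒> λ τ≤ → subst Yes none (proj₁ (found (unary i) (proj₂ (proj₂ (bound (unary i))) τ≤)))
      len-H′ : len H ≡ N * horizonFactor
      len-H′ = Rounded.len-H I extended nil
      lemma₁ : ∀ N u → 3 * (54 * (N * u)) + 26 * (N * u) ≡ u * (N * 188)
      lemma₁ = solve-∀
      lemma₂ : ∀ m u N → m + u * 2 * (13 * N) ≡ m + 26 * (N * u)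
      lemma₂ = solve-∀

    ratio : ∀ i (r : Result I (unary i) (solveAt (unary i))) → (∀ j → j < i → solveAt (unary j) ≡ nil) →
      makespan I (Result.schedule r) ≤ 4 * M
    ratio zero r _ = begin
      makespan I (Result.schedule r)  ≡⟨ Result.makespan≡ r ⟩
      V                                  ≡⟨ +-identityʳ V ⟨
      V + 0                              ≤⟨ value-bound nil r ⟩
      3 * M + 0                          ≡⟨ +-identityʳ (3 * M) ⟩
      3 * M                              ≤⟨ *-monoˡ-≤ M (n≤1+n 3) ⟩
      4 * M                              ∎
      where
      open ≤-Reasoning
      V : ℕ
      V = Result.V r
    ratio (suc i) r none = begin
      makespan I (Result.schedule r)     ≡⟨ Result.makespan≡ r ⟩
      expand (len (unary (suc i))) V        ≡⟨ cong (λ j → expand j V) (len-unary (suc i)) ⟩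
      expand (suc i) V                      ≤⟨ n≤1+n _ ⟩
      suc (expand (suc i) V)                ≡⟨ trans (suc-expand (suc i) V) (*-suc (2 ^ suc i) V) ⟩
      -- The extra unit is the price of the low digits 1 in the output.
      2 ^ suc i + 2 ^ suc i * V             ≤⟨ +-monoʳ-≤ (2 ^ suc i) value ⟩
      2 * u + (3 * M + 2 * u * 2 * (13 * N)) ≡⟨ lemma₁ u M N ⟩
      3 * M + (2 * u + 52 * (N * u))        ≤⟨ +-monoʳ-≤ (3 * M) (+-monoˡ-≤ (52 * (N * u)) (*-monoʳ-≤ 2 u≤Nu)) ⟩
      3 * M + (2 * (N * u) + 52 * (N * u))  ≡⟨ cong (3 * M +_) (*-distribʳ-+ (N * u) 2 52) ⟨
      3 * M + 54 * (N * u)                  ≤⟨ +-monoʳ-≤ (3 * M) (failure-bound i (none i ≤-refl)) ⟩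
      3 * M + M                             ≡⟨ +-comm (3 * M) M ⟩
      4 * M                                 ∎
      where
      open ≤-Reasoning
      u V : ℕ
      u = 2 ^ i
      V = Result.V r
      value : 2 ^ suc i * V ≤ 3 * M + 2 ^ suc i * 2 * (13 * N)
      value = subst (λ j → 2 ^ j * V ≤ 3 * M + 2 ^ j * 2 * (13 * N)) (len-unary (suc i)) (value-bound (unary (suc i)) r)
      1≤N : ∀ {n} → Fin n → 1 ≤ n
      1≤N zero    = s≤s z≤n
      1≤N (suc _) = s≤s z≤n
      u≤Nu : u ≤ N * u
      u≤Nu = ≤-trans (≤-reflexive (sym (+-identityʳ u))) (*-monoˡ-≤ u (1≤N source))
      lemma₁ : ∀ u M N → 2 * u + (3 * M + 2 * u * 2 * (13 * N)) ≡ 3 * M + (2 * u + 52 * (N * u))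
      lemma₁ = solve-∀

  record Approximate : Set where
    field
      schedule  : Schedule I
      valid     : IsValid I schedule
      in-budget : totalCost I schedule ≤ budget
      near      : ∀ S → IsValid I S → totalCost I S ≤ budget → makespan I schedule ≤ 4 * makespan I S
      computed  : ⟦ main ⟧ (encodeInstance I ∷ []) ≡ encodeSchedule I schedule

  maxScale# : ℕ
  maxScale# = len (⟦ maxScale ⟧ (processingOf Ĩ ∷ []))

  succeeds : ∀ e → len e ≡ maxScale# → Yes (solveAt e)
  succeeds e large = proj₁ (AtScale.solved I extended e {proj₁ completed} (proj₂ completed))
    where
    completed : ∃[ τ ] Schedules.Completed I extended e items τ
    completed = AllOnServers.feasible I extended e large plan

  search-result : Searched solveAt maxScale# nil (⟦ search ⟧ (Ĩ ∷ H ∷ items ∷ A ∷ []))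
  search-result = subst (Searched solveAt maxScale# nil)
    (sym (trans search-def (cong (λ l → iter (searchStep solveAt) l nil) (range-spec (⟦ maxScale ⟧ (processingOf Ĩ ∷ []))))))
    (searched solveAt maxScale# nil)

  approximate : Approximate
  approximate = go search-result refl
    where
    go : ∀ {t} → Searched solveAt maxScale# nil t → t ≡ ⟦ search ⟧ (Ĩ ∷ H ∷ items ∷ A ∷ []) → Approximate
    go (failure none) _ = ⊥-elim (subst Yes (none maxScale# ≤-refl) (succeeds (unary maxScale#) (len-unary maxScale#)))
    go (success i _ y none) eq = record
      { schedule  = Result.schedule r
      ; valid     = Result.valid r
      ; in-budget = Result.in-budget r
      ; near      = λ S valid in-budget → ratio S valid in-budget i r none
      ; computed  = trans main-def (trans
          (cong (λ t → ⟦ output ⟧ (adjacency ∷ head t ∷ tail (tail t) ∷ [])) (sym eq)) (Result.encoded r)) }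
      where
      r : Result I (unary i) (solveAt (unary i))
      r = AtScale.result I extended (unary i) y

-- Output size and rational ratio

-- An encoded number is a comb whose digits add at most four nodes each, so its height controls its
-- size.
size-encodeℕᵇ : ∀ b → size (encodeℕᵇ b) ≤ 1 + 4 * height (encodeℕᵇ b)
size-encodeℕᵇ zeroᵇ    = ≤-refl
size-encodeℕᵇ 2[1+ b ] = begin
  2 + size (encodeℕᵇ b)                    ≤⟨ +-mono-≤ (m≤m+n 2 2) (size-encodeℕᵇ b) ⟩
  4 + (1 + 4 * height (encodeℕᵇ b))        ≡⟨ lemma (height (encodeℕᵇ b)) ⟩
  1 + 4 * suc (height (encodeℕᵇ b))        ∎
  where
  open ≤-Reasoning
  lemma : ∀ h → 4 + (1 + 4 * h) ≡ 1 + 4 * suc h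
  lemma = solve-∀
size-encodeℕᵇ 1+[2 b ] = begin
  4 + size (encodeℕᵇ b)                    ≤⟨ +-monoʳ-≤ 4 (size-encodeℕᵇ b) ⟩
  4 + (1 + 4 * height (encodeℕᵇ b))        ≡⟨ lemma (height (encodeℕᵇ b)) ⟩
  1 + 4 * suc (height (encodeℕᵇ b))        ≤⟨ +-monoʳ-≤ 1 (*-monoʳ-≤ 4 (s≤s (m≤n⊔m 1 (height (encodeℕᵇ b))))) ⟩
  1 + 4 * suc (1 ⊔ height (encodeℕᵇ b))    ∎
  where
  open ≤-Reasoning
  lemma : ∀ h → 4 + (1 + 4 * h) ≡ 1 + 4 * suc h
  lemma = solve-∀

size-encodeℕ : ∀ n {h} → height (encodeℕ n) ≤ h → size (encodeℕ n) ≤ 1 + 4 * h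
size-encodeℕ n h≥ = ≤-trans (size-encodeℕᵇ (toBinary n)) (+-monoʳ-≤ 1 (*-monoʳ-≤ 4 h≥))

size-encodeLocation : ∀ {z k} (ℓ : Location z k) {h} → height (encodeLocation ℓ) ≤ h →
  size (encodeLocation ℓ) ≤ 5 + 4 * h
size-encodeLocation (onServer s) h≥ = ≤-trans
  (+-monoʳ-≤ 2 (size-encodeℕ (toℕ s) (≤-trans (height-tail (nil ∙ encodeFin s)) h≥))) (+-monoˡ-≤ _ (m≤m+n 3 2))
size-encodeLocation (onCloud c) h≥ =
  +-monoʳ-≤ 4 (size-encodeℕ (toℕ c) (≤-trans (height-tail ((nil ∙ nil) ∙ encodeFin c)) h≥))

len≤height : ∀ t → len t ≤ height t
len≤height nil     = z≤n
len≤height (a ∙ t) = s≤s (≤-trans (len≤height t) (m≤n⊔m (height a) (height t)))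

size-table : ∀ {n} (f : Fin n → Tree) {h s} → height (encodeTable f) ≤ h →
  (∀ j → height (f j) ≤ h → size (f j) ≤ s) → size (encodeTable f) ≤ 1 + n * suc s
size-table {zero}  f h≥ bounded = ≤-refl
size-table {suc n} f {h} {s} h≥ bounded = begin
  1 + size (f zero) + size (encodeTable (f ∘ suc))
    ≤⟨ +-mono-≤ (s≤s (bounded zero (≤-trans (height-head (encodeTable f)) h≥)))
         (size-table (f ∘ suc) (≤-trans (height-tail (encodeTable f)) h≥) (bounded ∘ suc)) ⟩
  suc s + (1 + n * suc s)    ≡⟨ +-suc (suc s) (n * suc s) ⟩
  1 + suc n * suc s          ∎
  where open ≤-Reasoning

-- Heights do not bound sizes polynomially in general. Here they do, since the output is a list of
-- at most `h` rows, each made of two encoded numbers and a tag.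
size-encodeSchedule : ∀ I S {h} → height (encodeSchedule I S) ≤ h → size (encodeSchedule I S) ≤ 1 + h * (8 + 8 * h)
size-encodeSchedule I S {h} h≥ = ≤-trans
  (size-table entries h≥ λ j hj≥ → begin
    1 + size (encodeℕ (completion j)) + size (encodeLocation (location j))
      ≤⟨ +-mono-≤ (s≤s (size-encodeℕ (completion j) (≤-trans (height-head (entries j)) hj≥)))
                  (size-encodeLocation (location j) (≤-trans (height-tail (entries j)) hj≥)) ⟩
    1 + (1 + 4 * h) + (5 + 4 * h)   ≡⟨ lemma h ⟩
    7 + 8 * h                       ∎)
  (+-monoʳ-≤ 1 (*-monoˡ-≤ (8 + 8 * h) (≤-trans (≤-reflexive (sym (len-table entries)))
    (≤-trans (len≤height (encodeTable entries)) h≥))))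
  where
  open ≤-Reasoning
  open Schedule S
  entries : Instance.Job I → Tree
  entries j = encodeℕ (completion j) ∙ encodeLocation (location j)
  lemma : ∀ h → 1 + (1 + 4 * h) + (5 + 4 * h) ≡ 7 + 8 * h
  lemma = solve-∀

fromNat-mono : ∀ {m n} → m ≤ n → fromNat m ℚ.≤ fromNat n
fromNat-mono {m} {n} m≤n = ℚ.toℚᵘ-cancel-≤ (ℚᵘ.≤-respˡ-≃ (ℚᵘ.≃-sym (ℚ.toℚᵘ-fromℚᵘ (ℚᵘ.mkℚᵘ (ℤ.+ m) 0)))
  (ℚᵘ.≤-respʳ-≃ (ℚᵘ.≃-sym (ℚ.toℚᵘ-fromℚᵘ (ℚᵘ.mkℚᵘ (ℤ.+ n) 0)))
    (ℚᵘ.*≤* (ℤ.*-monoʳ-≤-nonNeg (ℤ.+ 1) (ℤ.+≤+ m≤n)))))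

fromNat-* : ∀ m n → fromNat (m * n) ≡ fromNat m ℚ.* fromNat n
fromNat-* m n = ℚ.toℚᵘ-injective (ℚᵘ.≃-trans (ℚ.toℚᵘ-fromℚᵘ (ℚᵘ.mkℚᵘ (ℤ.+ (m * n)) 0))
  (ℚᵘ.≃-trans (ℚᵘ.*≡* (cong (ℤ._* (ℤ.+ 1)) (ℤ.pos-* m n)))
  (ℚᵘ.≃-sym (ℚᵘ.≃-trans (ℚ.toℚᵘ-homo-* (fromNat m) (fromNat n))
    (ℚᵘ.*-cong (ℚ.toℚᵘ-fromℚᵘ (ℚᵘ.mkℚᵘ (ℤ.+ m) 0)) (ℚ.toℚᵘ-fromℚᵘ (ℚᵘ.mkℚᵘ (ℤ.+ n) 0)))))))

scaled-fromNat : ∀ m n ε → 0ℚ ℚ.< ε → m ≤ 4 * n → fromNat m ℚ.≤ (fromNat 4 ℚ.+ ε) ℚ.* fromNat n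
scaled-fromNat m n ε ε>0 m≤4n = begin
  fromNat m                           ≤⟨ fromNat-mono m≤4n ⟩
  fromNat (4 * n)                     ≡⟨ fromNat-* 4 n ⟩
  fromNat 4 ℚ.* fromNat n             ≤⟨ ℚ.*-monoʳ-≤-nonNeg (fromNat n) ⦃ ℚ.normalize-nonNeg n 1 ⦄ 4≤4+ε ⟩
  (fromNat 4 ℚ.+ ε) ℚ.* fromNat n     ∎
  where
  open ℚ.≤-Reasoning
  4≤4+ε : fromNat 4 ℚ.≤ fromNat 4 ℚ.+ ε
  4≤4+ε = subst (ℚ._≤ fromNat 4 ℚ.+ ε) (ℚ.+-identityʳ (fromNat 4)) (ℚ.+-monoʳ-≤ (fromNat 4) (ℚ.<⇒≤ ε>0))

-- The program and its polynomial bounds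

program : Command
program = 1 := cons (var 0) nil ⨾ compile main

program-computes : ∀ d → Computes program On d To (⟦ main ⟧ (d ∷ [])) InTime (5 + time main (d ∷ []))
program-computes d
  with τ , run , τ₀ , _ ← runs main (d ∷ []) (initial d [ 1 ↦ d ∙ nil ]) refl = τ , seq assign run , τ₀

-- The three summands of `totalBound` stand for the initial assignment, the run of `main` and the
-- size of the output in terms of its height.
outputBound totalBound : Poly
outputBound = growth main (size♯ ∷ [])
totalBound  = con 5 ⊕ timeBound main (size♯ ∷ []) ⊕ (con 1 ⊕ outputBound ⊗ (con 8 ⊕ con 8 ⊗ outputBound))

main-sound : ∀ d → height (⟦ main ⟧ (d ∷ [])) ≤ at outputBound (size d) ×
  time main (d ∷ []) ≤ at (timeBound main (size♯ ∷ [])) (size d)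
main-sound d with height≤ , time≤ ← sound main {W = 0} main-ok (height≤size d ∷ []) =
  ≤-trans height≤ (+-monoˡ-≤ (at outputBound (size d)) (allowance≤ (flag main (false ∷ [])) 0)) , time≤

theorem15 : (ε : ℚ) → 0ℚ ℚ.< ε → HasPolynomialTimeApproximation (fromNat 4 ℚ.+ ε) extendedChainMakespan
theorem15 ε ε>0 = program , coefficient totalBound , degree totalBound , λ (I , extended) →
  let open Approximation.Approximate (Approximation.approximate I extended)
      d = encodeInstance I
      height≤ , time≤ = main-sound d
  in schedule , 5 + time main (d ∷ []) ,
     subst (λ r → Computes program On d To r InTime (5 + time main (d ∷ []))) computed (program-computes d) ,
     ≤-trans (+-mono-≤ (+-monoʳ-≤ 5 time≤) (size-encodeSchedule I schedule (subst (λ r → height r ≤ at outputBound (size d)) computed height≤)))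
       (≤-trans (at≤monomial totalBound (1≤size d) ≤-refl) (m≤m+n _ (coefficient totalBound))) ,
     (valid , in-budget) , λ S (valid′ , in-budget′) → scaled-fromNat (makespan I schedule) (makespan I S) ε ε>0 (near S valid′ in-budget′)
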